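{- For every integer $\eta\geq 1$ there exists an integer $\mu=\mu(\eta)\geq 1$ with the following property. Let $G$ be a graph and $S\subseteq V(G)$ with $|S|\geq \mu$ such that $S$ is contained in a single connected component of $G$. Then $G$ contains an $(S,\eta)$-connectifier $H$. In particular, $H$ is connected, $|V(H)\cap S|=\eta$, and every vertex in $V(H)\cap S$ has degree at most $\eta$ in $H$.
   Context: All graphs are finite and simple. A path in $G$ is an induced subgraph that is a path; $P[x,y]$ denotes the subpath between $x$ and $y$; length = number of edges. A leaf of a forest is a vertex of degree at most one; $\mathcal{L}(F)$ is the set of leaves. A subdivided star is a tree with at most one vertex of degree more than two (a branch vertex); a rooted subdivided star is one with a chosen root $r$ which, if the tree is not a path, is its unique branch vertex; a stem is a path from a leaf to the root. A vertex is simplicial if its neighborhood is a clique; $\mathcal{Z}(G)$ denotes the set of simplicial vertices. For a path $P$, a tuple $(p_1,\ldots,p_\theta)$ of vertices of $P$ is a $1$-widening of $P$ if $p_1,p_\theta$ are the ends of $P$, the $p_i$ appear in this order along $P$, and $P[p_i,p_{i+1}]$ has length at least $1$ for each $i\in[\theta-1]$. A caterpillar is a tree of maximum degree three whose branch vertices all lie on a common path; a spine is an inclusion-maximal path containing all branch vertices. For a caterpillar $C$ with at least three leaves and a leaf $l$, $v_l$ is the unique branch vertex such that the path from $l$ to $v_l$ contains no other branch vertex; an enumeration $(l_1,\ldots,l_\theta)$ of $\mathcal{L}(C)$ is $1$-wide if for some spine $P$, $(l_1,v_{l_2},\ldots,v_{l_{\theta-1}},l_\theta)$ is a $1$-widening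 of $P$; a $1$-caterpillar is a caterpillar with at least three leaves admitting a $1$-wide enumeration of its leaves. For a set $S$, a graph $H$ is $(S,\eta)$-tied if $\mathcal{Z}(H)\subseteq V(H)\cap S$ and $|V(H)\cap S|=\eta$, and loosely $(S,\eta)$-tied if $\mathcal{Z}(H)=V(H)\cap S$ and $|V(H)\cap S|=\eta$. An induced subgraph $H$ of $G$ is an $(S,\eta)$-connectifier if one of the following holds: (type 0) $H$ is a loosely $(S,\eta)$-tied graph isomorphic to the line graph of a rooted subdivided star in which every stem has length at least $1$; (type 1) $H$ is an $(S,\eta)$-tied rooted subdivided star with root $r$ in which every stem has length at least $1$ and $(V(H)\cap S)\setminus\mathcal{L}(H)\subseteq\{r\}$; (type 2) $H$ is an $(S,\eta)$-tied path with $V(H)\cap S=\{s_1,\ldots,s_\eta\}$ where $(s_1,\ldots,s_\eta)$ is a $1$-widening of $H$; (type 3) $H$ is a loosely $(S,\eta)$-tied $1$-caterpillar; (type 4) $H$ is a loosely $(S,\eta)$-tied graph isomorphic to the line graph of a $1$-caterpillar. -}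

module Defs where

open import Data.Nat using (ℕ; zero; suc; _+_; _≤_; _<_)
open import Data.Fin using (Fin; toℕ; fromℕ; inject₁) renaming (zero to fzero; suc to fsuc)
open import Data.Fin.Subset using (Subset; _∈_; ∣_∣)
open import Data.Bool using (Bool; true; false; if_then_else_)
open import Data.List using (List; map; allFin)
open import Data.Nat.ListAction using (sum)
open import Data.Vec using (tabulate; lookup)
open import Data.Product using (Σ; Σ-syntax; _×_; ∃; ∃-syntax)
open import Data.Sum using (_⊎_)
open import Relation.Nullary using (¬_)
open import Relation.Binary.PropositionalEquality using (_≡_; _≢_)
open import Function.Bundles using (_⇔_)

record Graph (n : ℕ) : Set where
  field
    adj    : Fin n → Fin n → Bool
    sym    : ∀ u v → adj u v ≡ adj v u
    irrefl : ∀ u → adj u u ≡ false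
open Graph public

module _ {n : ℕ} (G : Graph n) where

  Adj : Fin n → Fin n → Set
  Adj u v = adj G u v ≡ true

  deg : Fin n → ℕ
  deg v = sum (map (λ u → if adj G v u then 1 else 0) (allFin n))

  Leaf : Fin n → Set
  Leaf v = deg v ≤ 1

  Branch : Fin n → Set
  Branch v = 2 < deg v

  data Walk : Fin n → Fin n → Set where
    here : ∀ {u} → Walk u u
    step : ∀ {u v w} → Adj u v → Walk v w → Walk u w

  Connected : Set
  Connected = ∀ u v → Walk u v

  Cycle : Set
  Cycle = Σ[ k ∈ ℕ ] Σ[ c ∈ (Fin (suc (suc (suc k))) → Fin n) ]
            ((∀ i j → c i ≡ c j → i ≡ j)
            × (∀ (i : Fin (suc (suc k))) → Adj (c (inject₁ i)) (c (fsuc i)))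
            × Adj (c (fromℕ (suc (suc k)))) (c fzero))

  Acyclic : Set
  Acyclic = ¬ Cycle

  Tree : Set
  Tree = Connected × Acyclic

  Simplicial : Fin n → Set
  Simplicial v = ∀ x y → Adj v x → Adj v y → x ≢ y → Adj x y

  IsPathSeq : {k : ℕ} → (Fin k → Fin n) → Set
  IsPathSeq p = (∀ i j → p i ≡ p j → i ≡ j)
              × (∀ i j → Adj (p i) (p j) ⇔ (suc (toℕ i) ≡ toℕ j ⊎ suc (toℕ j) ≡ toℕ i))

  IsPathGraphEnum : {k : ℕ} → (Fin k → Fin n) → Set
  IsPathGraphEnum p = IsPathSeq p × (∀ v → ∃[ i ] p i ≡ v)

  RootedSubdividedStar : Fin n → Set
  RootedSubdividedStar r = Tree × (∀ v → Branch v → v ≡ r)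

  StemsPositive : Fin n → Set
  StemsPositive r = ∀ l → Leaf l → l ≢ r

  ContainsBranches : {k : ℕ} → (Fin k → Fin n) → Set
  ContainsBranches p = ∀ v → Branch v → ∃[ i ] p i ≡ v

  Caterpillar : Set
  Caterpillar = Tree × (∀ v → deg v ≤ 3)
              × (Σ[ k ∈ ℕ ] Σ[ p ∈ (Fin k → Fin n) ] (IsPathSeq p × ContainsBranches p))

  Spine : {k : ℕ} → (Fin k → Fin n) → Set
  Spine p = IsPathSeq p × ContainsBranches p
          × (∀ (k' : ℕ) (q : Fin k' → Fin n) → IsPathSeq q
               → (∀ i → ∃[ j ] q j ≡ p i) → ∀ j → ∃[ i ] p i ≡ q j)

  IsVl : Fin n → Fin n → Set
  IsVl l v = Branch v × (Σ[ k ∈ ℕ ] Σ[ q ∈ (Fin (suc k) → Fin n) ]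
               (IsPathSeq q × q fzero ≡ l × q (fromℕ k) ≡ v
               × (∀ i → Branch (q i) → q i ≡ v)))

OneWidening : {A : Set} {k θ : ℕ} → (Fin k → A) → (Fin θ → A) → Set
OneWidening {k = k} {θ = θ} p x =
  1 ≤ θ × (Σ[ j ∈ (Fin θ → Fin k) ]
    ((∀ a b → toℕ a < toℕ b → toℕ (j a) < toℕ (j b))
    × (∀ a → x a ≡ p (j a))
    × (∀ a → toℕ a ≡ 0 → toℕ (j a) ≡ 0)
    × (∀ a → suc (toℕ a) ≡ θ → suc (toℕ (j a)) ≡ k)))

module _ {n : ℕ} (G : Graph n) where

  OneWideEnum : {θ : ℕ} → (Fin θ → Fin n) → Set
  OneWideEnum {θ} l =
    (∀ i j → l i ≡ l j → i ≡ j) × (∀ i → Leaf G (l i)) × (∀ v → Leaf G v → ∃[ i ] l i ≡ v)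
    × (Σ[ k ∈ ℕ ] Σ[ p ∈ (Fin k → Fin n) ] Σ[ w ∈ (Fin θ → Fin n) ]
        (Spine G p
        × (∀ i → toℕ i ≡ 0 → w i ≡ l i)
        × (∀ i → suc (toℕ i) ≡ θ → w i ≡ l i)
        × (∀ i → 0 < toℕ i → suc (toℕ i) < θ → IsVl G (l i) (w i))
        × OneWidening p w))

  OneCaterpillar : Set
  OneCaterpillar = Caterpillar G
    × (Σ[ θ ∈ ℕ ] Σ[ l ∈ (Fin θ → Fin n) ] (3 ≤ θ × OneWideEnum l))

IsLineGraphOf : {m t : ℕ} → Graph m → Graph t → Set
IsLineGraphOf {m} {t} H T =
  Σ[ a ∈ (Fin m → Fin t) ] Σ[ b ∈ (Fin m → Fin t) ]
    ((∀ i → Adj T (a i) (b i))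
    × (∀ x y → Adj T x y → ∃[ i ] ((a i ≡ x × b i ≡ y) ⊎ (a i ≡ y × b i ≡ x)))
    × (∀ i j → ((a i ≡ a j × b i ≡ b j) ⊎ (a i ≡ b j × b i ≡ a j)) → i ≡ j)
    × (∀ i j → Adj H i j ⇔ (i ≢ j × (a i ≡ a j ⊎ a i ≡ b j ⊎ b i ≡ a j ⊎ b i ≡ b j))))

InducedEmbedding : {m n : ℕ} → Graph m → Graph n → (Fin m → Fin n) → Set
InducedEmbedding H G f = (∀ i j → f i ≡ f j → i ≡ j) × (∀ i j → adj H i j ≡ adj G (f i) (f j))

-- V(H) ∩ S, as a subset of V(H)
pullback : {m n : ℕ} → (Fin m → Fin n) → Subset n → Subset m
pullback f S = tabulate (λ i → lookup S (f i))

Tied : {m : ℕ} → Graph m → Subset m → ℕ → Set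
Tied H SH η = (∀ v → Simplicial H v → v ∈ SH) × ∣ SH ∣ ≡ η

LooselyTied : {m : ℕ} → Graph m → Subset m → ℕ → Set
LooselyTied H SH η = (∀ v → Simplicial H v ⇔ v ∈ SH) × ∣ SH ∣ ≡ η

-- H (with SH = V(H) ∩ S) is an (S,η)-connectifier
Connectifier : {m : ℕ} → Graph m → Subset m → ℕ → Set
Connectifier {m} H SH η =
  (LooselyTied H SH η × (Σ[ t ∈ ℕ ] Σ[ T ∈ Graph t ] Σ[ r ∈ Fin t ]
      (RootedSubdividedStar T r × StemsPositive T r × IsLineGraphOf H T)))
  ⊎ (Tied H SH η × (Σ[ r ∈ Fin m ]
      (RootedSubdividedStar H r × StemsPositive H r
      × (∀ v → v ∈ SH → Leaf H v ⊎ v ≡ r))))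
  ⊎ (Tied H SH η × (Σ[ k ∈ ℕ ] Σ[ p ∈ (Fin k → Fin m) ] Σ[ s ∈ (Fin η → Fin m) ]
      (IsPathGraphEnum H p × (∀ v → v ∈ SH ⇔ (∃[ i ] s i ≡ v)) × OneWidening p s)))
  ⊎ (LooselyTied H SH η × OneCaterpillar H)
  ⊎ (LooselyTied H SH η × (Σ[ t ∈ ℕ ] Σ[ T ∈ Graph t ] (OneCaterpillar T × IsLineGraphOf H T)))

{-# OPTIONS --safe #-}
-- Prune the component of S to a connected set M ⊇ S in which every vertex x outside S separates some
-- vertex of S from any given other vertex. So every vertex x of M that does not disconnect a given
-- part of M carries a pendant: an induced path from x to S leaving that part, and pendants of
-- different vertices touch at most in their first vertices.
--
-- If a vertex of M has many neighbours in M, then Ramsey's theorem gives a clique or a stable set among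
-- them, and the pendants complete it to the line graph of a subdivided star or to a subdivided star.
--
-- Otherwise M has bounded degree, and a breadth-first search tree has a root path p with many
-- vertices that are in S or branch in the tree. If p meets S often, it is the connectifier. Otherwise
-- many forks lie between two consecutive vertices of S on p. At a fork, p i has a neighbour y ≠ p (i+1)
-- one level further. If y is adjacent to p (i+2), then p (i+1) is not a cut vertex of the path and
-- has a private pendant; if not, y has one, and y is attached to p i alone or to p i and p (i+1). A majority
-- kind of attachment gives a caterpillar or the line graph of one.
module Submission where

open import Defs hiding (sym)
open import Data.Bool using (Bool; true; false; if_then_else_; not; _∧_; _∨_)
open import Data.Bool.Properties using () renaming (_≟_ to _≟ᵇ_)
open import Data.Empty using (⊥; ⊥-elim)
open import Data.Fin using (Fin; toℕ; fromℕ; inject₁; fromℕ<; opposite; join; splitAt) renaming (zero to fzero; suc to fsuc)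
open import Data.Fin.Properties using (toℕ-injective; toℕ-inject₁; toℕ-fromℕ; toℕ-fromℕ<; toℕ<n; injective⇒≤; any?; all?; suc-injective; opposite-prop; opposite-involutive; splitAt-join; join-splitAt) renaming (_≟_ to _≟ᶠ_)
open import Data.Fin.Relation.Unary.Top using (view; ‵fromℕ; ‵inject₁; view-fromℕ; view-inject₁)
open import Data.Fin.Subset using (Subset; _∈_; ∣_∣)
open import Data.List using (List; []; _∷_; map; allFin; length; lookup; tabulate; filter; take)
open import Data.List.Properties using (map-tabulate; length-map; length-take)
open import Data.List.Relation.Unary.All as All using (All; []; _∷_)
open import Data.List.Relation.Unary.Any as Any using (Any; here; there)
open import Data.List.Relation.Unary.AllPairs as AllPairs using (AllPairs; []; _∷_)
open import Data.List.Membership.Propositional using (find)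
open import Data.List.Membership.Propositional.Properties using (∈-filter⁺; ∈-filter⁻; ∈-allFin)
open import Data.List.Relation.Unary.Unique.Propositional.Properties using (allFin⁺)
import Data.List.Relation.Unary.All.Properties as Allₚ
import Data.List.Relation.Unary.AllPairs.Properties as AllPairsₚ
open import Data.Maybe using (Maybe; just; nothing)
open import Data.Maybe.Properties using (just-injective)
open import Data.Nat using (ℕ; zero; suc; _+_; _*_; _∸_; _≤_; _<_; z≤n; s≤s; _≤?_; _<?_)
open import Data.Nat.ListAction using (sum)
open import Data.Nat.Properties as ℕ using (≤-refl; ≤-trans; ≤-antisym; ≤-reflexive; ≤-pred; n≤1+n; 1+n≢n; <⇒≢; <⇒≤; <⇒≱; ≰⇒>; ≤∧≢⇒<; <-≤-trans; ≤-<-trans; <-cmp)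
open import Data.Product using (Σ; Σ-syntax; _×_; _,_; proj₁; proj₂; ∃; ∃-syntax)
open import Data.Sum using (_⊎_; inj₁; inj₂)
import Data.Vec as Vec
open import Data.Vec.Properties using (lookup∘tabulate; lookup⇒[]=; []=⇒lookup)
open import Function.Bundles using (_⇔_; mk⇔; Equivalence)
open import Function using (_∘_; id)
open import Relation.Nullary using (¬_; Dec; yes; no; does)
open import Relation.Nullary.Decidable using (_×-dec_; _⊎-dec_; ¬?; map′; dec-true; dec-false)
open import Relation.Binary using (tri<; tri≈; tri>)
open import Relation.Binary.PropositionalEquality using (_≡_; _≢_; refl; trans; cong; subst; cong₂; subst₂; sym)

open Equivalence using (to; from)

-- A connectifier may meet `S` only in prescribed vertices, so each leg has to reach `S` without
-- passing another vertex of it and without touching the other legs. Pruning settles both against a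
-- common base vertex: the centre of a star, or the root `r`. Once each of two vertices lies on the
-- base side of the other, each pendant stays on the base side of the other's start, which the other
-- pendant avoids. The remaining danger is contact between a fork and the root path. Levels confine
-- it to three consecutive path vertices. Contact with the farthest one closes an induced four-cycle
-- or a diamond, which neither a caterpillar nor the line graph of one contains; hence the change of
-- roles, in which `y` serves only as a detour and stays outside the connectifier. The two vertices
-- of `S` that bound a stretch of forks become the ends of the spine. They account for the 2 in
-- `η = t + 2`; a stretch with `4 t` forks suffices, because one halving spaces them and a second
-- one selects the kind of attachment.

-- Counting in finite subsets

elements : ∀ {n} (S : Subset n) → List (Fin n)
elements Vec.[] = []
elements (true Vec.∷ S) = fzero ∷ map fsuc (elements S)
elements (false Vec.∷ S) = map fsuc (elements S)

length-elements : ∀ {n} (S : Subset n) → length (elements S) ≡ ∣ S ∣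
length-elements Vec.[] = refl
length-elements (true Vec.∷ S) = cong suc (trans (length-map fsuc (elements S)) (length-elements S))
length-elements (false Vec.∷ S) = trans (length-map fsuc (elements S)) (length-elements S)

elements-⊆ : ∀ {n} (S : Subset n) → All (λ x → Vec.lookup S x ≡ true) (elements S)
elements-⊆ Vec.[] = []
elements-⊆ (true Vec.∷ S) = refl ∷ Allₚ.map⁺ (elements-⊆ S)
elements-⊆ (false Vec.∷ S) = Allₚ.map⁺ (elements-⊆ S)

elements-unique : ∀ {n} (S : Subset n) → AllPairs _≢_ (elements S)
elements-unique Vec.[] = []
elements-unique (true Vec.∷ S) = Allₚ.map⁺ (All.map (λ _ ()) (elements-⊆ S)) ∷ AllPairsₚ.map⁺ (AllPairs.map (λ ne eq → ne (suc-injective eq)) (elements-unique S))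
elements-unique (false Vec.∷ S) = AllPairsₚ.map⁺ (AllPairs.map (λ ne eq → ne (suc-injective eq)) (elements-unique S))

lookup-map : ∀ {A B : Set} (f : A → B) (xs : List A) (i : Fin (length xs)) → ∃[ j ] lookup (map f xs) j ≡ f (lookup xs i)
lookup-map f (x ∷ xs) fzero = fzero , refl
lookup-map f (x ∷ xs) (fsuc i) = let (j , e) = lookup-map f xs i in fsuc j , e

elements-⊇ : ∀ {n} (S : Subset n) (x : Fin n) → Vec.lookup S x ≡ true → ∃[ i ] lookup (elements S) i ≡ x
elements-⊇ (true Vec.∷ S) fzero h = fzero , refl
elements-⊇ (true Vec.∷ S) (fsuc x) h =
  let (i , e) = elements-⊇ S x h ; (j , e') = lookup-map fsuc (elements S) i in fsuc j , trans e' (cong fsuc e)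
elements-⊇ (false Vec.∷ S) (fsuc x) h =
  let (i , e) = elements-⊇ S x h ; (j , e') = lookup-map fsuc (elements S) i in j , trans e' (cong fsuc e)

all-lookup : ∀ {A : Set} {P : A → Set} {xs : List A} → All P xs → ∀ i → P (lookup xs i)
all-lookup (p ∷ ps) fzero = p
all-lookup (p ∷ ps) (fsuc i) = all-lookup ps i

allpairs-lookup : ∀ {A : Set} {R : A → A → Set} {xs : List A} → AllPairs R xs → ∀ i j → toℕ i < toℕ j → R (lookup xs i) (lookup xs j)
allpairs-lookup (p ∷ ps) fzero (fsuc j) lt = all-lookup p j
allpairs-lookup (p ∷ ps) (fsuc i) (fsuc j) (s≤s lt) = allpairs-lookup ps i j lt

unique-lookup : ∀ {A : Set} {xs : List A} → AllPairs _≢_ xs → ∀ i j → lookup xs i ≡ lookup xs j → i ≡ j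
unique-lookup u i j e with <-cmp (toℕ i) (toℕ j)
... | tri< lt _ _ = ⊥-elim (allpairs-lookup u i j lt e)
... | tri≈ _ eq _ = toℕ-injective eq
... | tri> _ _ gt = ⊥-elim (allpairs-lookup u j i gt (sym e))

-- Choosing an index of `g` for every entry of `elements S` is injective, because the entries are
-- distinct.
card≤ : ∀ {n} (S : Subset n) {k} (g : Fin k → Fin n) → (∀ x → Vec.lookup S x ≡ true → ∃[ i ] g i ≡ x) → ∣ S ∣ ≤ k
card≤ S {k} g cov = subst (_≤ k) (length-elements S) (injective⇒≤ {f = λ i → proj₁ (c i)} inj)
  where
    c : ∀ i → ∃[ j ] g j ≡ lookup (elements S) i
    c i = cov (lookup (elements S) i) (all-lookup (elements-⊆ S) i)
    inj : ∀ {i j} → proj₁ (c i) ≡ proj₁ (c j) → i ≡ j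
    inj {i} {j} e = unique-lookup (elements-unique S) i j (trans (sym (proj₂ (c i))) (trans (cong g e) (proj₂ (c j))))

card≥ : ∀ {n} (S : Subset n) {k} (g : Fin k → Fin n) → (∀ i j → g i ≡ g j → i ≡ j) → (∀ i → Vec.lookup S (g i) ≡ true) → k ≤ ∣ S ∣
card≥ S {k} g ginj gin = subst (k ≤_) (length-elements S) (injective⇒≤ {f = λ i → proj₁ (c i)} inj)
  where
    c : ∀ i → ∃[ j ] lookup (elements S) j ≡ g i
    c i = elements-⊇ S (g i) (gin i)
    inj : ∀ {i j} → proj₁ (c i) ≡ proj₁ (c j) → i ≡ j
    inj {i} {j} e = ginj i j (trans (sym (proj₂ (c i))) (trans (cong (lookup (elements S)) e) (proj₂ (c j))))

-- Degrees and walks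

sum-tabulate : ∀ {n} (b : Fin n → Bool) → sum (tabulate (λ u → if b u then 1 else 0)) ≡ ∣ Vec.tabulate b ∣
sum-tabulate {zero} b = refl
sum-tabulate {suc n} b with b fzero
... | true = cong suc (sum-tabulate (b ∘ fsuc))
... | false = sum-tabulate (b ∘ fsuc)

deg-card : ∀ {n} (G : Graph n) v → deg G v ≡ ∣ Vec.tabulate (adj G v) ∣
deg-card {n} G v = trans (cong sum (map-tabulate id (λ u → if adj G v u then 1 else 0))) (sum-tabulate (adj G v))

deg≤ : ∀ {n} (G : Graph n) v {k} (g : Fin k → Fin n) → (∀ x → Adj G v x → ∃[ i ] g i ≡ x) → deg G v ≤ k
deg≤ G v g cov = subst (_≤ _) (sym (deg-card G v))
  (card≤ (Vec.tabulate (adj G v)) g (λ x h → cov x (trans (sym (lookup∘tabulate (adj G v) x)) h)))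

deg≥ : ∀ {n} (G : Graph n) v {k} (g : Fin k → Fin n) → (∀ i j → g i ≡ g j → i ≡ j) → (∀ i → Adj G v (g i)) → k ≤ deg G v
deg≥ G v g inj h = subst (_ ≤_) (sym (deg-card G v))
  (card≥ (Vec.tabulate (adj G v)) g inj (λ i → trans (lookup∘tabulate (adj G v) (g i)) (h i)))

Adj-sym : ∀ {n} (G : Graph n) {u v} → Adj G u v → Adj G v u
Adj-sym G {u} {v} h = trans (Graph.sym G v u) h

Adj-irrefl : ∀ {n} (G : Graph n) {u v} → Adj G u v → u ≢ v
Adj-irrefl G {u} h refl with trans (sym h) (Graph.irrefl G u)
... | ()

walk-++ : ∀ {n} {G : Graph n} {u v w} → Walk G u v → Walk G v w → Walk G u w
walk-++ here q = q
walk-++ (step a p) q = step a (walk-++ p q)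

walk-reverse : ∀ {n} {G : Graph n} {u v} → Walk G u v → Walk G v u
walk-reverse here = here
walk-reverse {G = G} (step a p) = walk-++ (walk-reverse p) (step (Adj-sym G a) here)

deg≤1 : ∀ {n} (G : Graph n) v → (∀ x y → Adj G v x → Adj G v y → x ≡ y) → deg G v ≤ 1
deg≤1 G v un with any? (λ x → adj G v x ≟ᵇ true)
... | yes (x , h) = deg≤ G v {1} (λ _ → x) (λ y h' → fzero , un x y h h')
... | no no-nbr = ≤-trans (deg≤ G v {0} (λ ()) (λ x h → ⊥-elim (no-nbr (x , h)))) z≤n

deg≥2 : ∀ {n} (G : Graph n) v x y → Adj G v x → Adj G v y → x ≢ y → 2 ≤ deg G v
deg≥2 G v x y hx hy ne = deg≥ G v {2} (λ { fzero → x ; (fsuc _) → y })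
  (λ { fzero fzero e → refl ; fzero (fsuc fzero) e → ⊥-elim (ne e) ; (fsuc fzero) fzero e → ⊥-elim (ne (sym e)) ; (fsuc fzero) (fsuc fzero) e → refl })
  (λ { fzero → hx ; (fsuc _) → hy })

deg≥3 : ∀ {n} (G : Graph n) v x y z → Adj G v x → Adj G v y → Adj G v z → x ≢ y → x ≢ z → y ≢ z → 3 ≤ deg G v
deg≥3 {n} G v x y z hx hy hz xy xz yz = deg≥ G v {3} g inj (λ { fzero → hx ; (fsuc fzero) → hy ; (fsuc (fsuc _)) → hz })
  where
    g : Fin 3 → Fin n
    g fzero = x
    g (fsuc fzero) = y
    g (fsuc (fsuc _)) = z
    inj : ∀ i j → g i ≡ g j → i ≡ j
    inj fzero fzero e = refl
    inj fzero (fsuc fzero) e = ⊥-elim (xy e)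
    inj fzero (fsuc (fsuc fzero)) e = ⊥-elim (xz e)
    inj (fsuc fzero) fzero e = ⊥-elim (xy (sym e))
    inj (fsuc fzero) (fsuc fzero) e = refl
    inj (fsuc fzero) (fsuc (fsuc fzero)) e = ⊥-elim (yz e)
    inj (fsuc (fsuc fzero)) fzero e = ⊥-elim (xz (sym e))
    inj (fsuc (fsuc fzero)) (fsuc fzero) e = ⊥-elim (yz (sym e))
    inj (fsuc (fsuc fzero)) (fsuc (fsuc fzero)) e = refl

strictly-monotone-injective : ∀ {k m} (f : Fin k → Fin m) → (∀ i j → toℕ i < toℕ j → toℕ (f i) < toℕ (f j)) → ∀ i j → f i ≡ f j → i ≡ j
strictly-monotone-injective f mono i j e with <-cmp (toℕ i) (toℕ j)
... | tri< lt _ _ = ⊥-elim (<⇒≢ (mono i j lt) (cong toℕ e))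
... | tri≈ _ eq _ = toℕ-injective eq
... | tri> _ _ gt = ⊥-elim (<⇒≢ (mono j i gt) (sym (cong toℕ e)))

Consecutive : ℕ → ℕ → Set
Consecutive x y = suc x ≡ y ⊎ suc y ≡ x

Consecutive-suc : ∀ {x y} → Consecutive x y ⇔ Consecutive (suc x) (suc y)
Consecutive-suc = mk⇔ (λ { (inj₁ e) → inj₁ (cong suc e) ; (inj₂ e) → inj₂ (cong suc e) })
                      (λ { (inj₁ e) → inj₁ (ℕ.suc-injective e) ; (inj₂ e) → inj₂ (ℕ.suc-injective e) })

-- Rooted trees and their line graphs

argmax : ∀ {k} (f : Fin (suc k) → ℕ) → ∃[ i ] (∀ j → f j ≤ f i)
argmax {zero} f = fzero , λ { fzero → ≤-refl }
argmax {suc k} f with argmax (f ∘ fsuc)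
... | i , mx with f fzero ≤? f (fsuc i)
... | yes le = fsuc i , λ { fzero → le ; (fsuc j) → mx j }
... | no nle = fzero , λ { fzero → ≤-refl ; (fsuc j) → ≤-trans (mx j) (<⇒≤ (≰⇒> nle)) }

-- Away from the ends these are the predecessor and the successor; at the first and last index the
-- closing edge replaces one of them. The two differ because a cycle has at least three vertices.
cycle-neighbours : ∀ {n} (G : Graph n) {k} (c : Fin (suc (suc (suc k))) → Fin n) →
  (∀ (i : Fin (suc (suc k))) → Adj G (c (inject₁ i)) (c (fsuc i))) → Adj G (c (fromℕ (suc (suc k)))) (c fzero) →
  ∀ i → Σ[ a ∈ Fin (suc (suc (suc k))) ] Σ[ b ∈ Fin (suc (suc (suc k))) ] (a ≢ b × Adj G (c i) (c a) × Adj G (c i) (c b))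
cycle-neighbours G c st cl fzero = fsuc fzero , fromℕ _ , (λ ()) , st fzero , Adj-sym G cl
cycle-neighbours G {k} c st cl (fsuc i) with view i
... | ‵fromℕ = inject₁ i , fzero , (λ ()) , Adj-sym G (st i) , cl
... | ‵inject₁ j = inject₁ i , fsuc (fsuc j) , ne , Adj-sym G (st i) , st (fsuc j)
  where
    ne : inject₁ (inject₁ j) ≢ fsuc (fsuc j)
    ne e = ℕ.m≢1+m+n (toℕ j) {1} (trans (trans (sym (trans (toℕ-inject₁ _) (toℕ-inject₁ j))) (cong toℕ e)) (sym (cong suc (ℕ.+-comm (toℕ j) 1))))

does-true : ∀ {A : Set} (a : Dec A) → (does a ≡ true) ⇔ A
does-true (yes a) = mk⇔ (λ _ → a) (λ _ → refl)
does-true (no ¬a) = mk⇔ (λ ()) (λ a → ⊥-elim (¬a a))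

-- A finite type with an encoding into Fin m, whose elements are the non-root vertices of a tree;
-- `nothing` is the root.
record RootedTree (W : Set) (m : ℕ) : Set where
  field
    enc   : W → Fin m
    dec   : Fin m → W
    dec-enc : ∀ w → dec (enc w) ≡ w
    enc-dec : ∀ i → enc (dec i) ≡ i
    par   : W → Maybe W
    depth : Maybe W → ℕ
    depth-par : ∀ w → depth (just w) ≡ suc (depth (par w))

  enc₀ : Maybe W → Fin (suc m)
  enc₀ nothing = fzero
  enc₀ (just w) = fsuc (enc w)

  dec₀ : Fin (suc m) → Maybe W
  dec₀ fzero = nothing
  dec₀ (fsuc i) = just (dec i)

  dec-enc₀ : ∀ u → dec₀ (enc₀ u) ≡ u
  dec-enc₀ nothing = refl
  dec-enc₀ (just w) = cong just (dec-enc w)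

  enc-dec₀ : ∀ i → enc₀ (dec₀ i) ≡ i
  enc-dec₀ fzero = refl
  enc-dec₀ (fsuc i) = cong fsuc (enc-dec i)

  dec-injective : ∀ i j → dec i ≡ dec j → i ≡ j
  dec-injective i j e = trans (sym (enc-dec i)) (trans (cong enc e) (enc-dec j))

  dec₀-injective : ∀ i j → dec₀ i ≡ dec₀ j → i ≡ j
  dec₀-injective i j e = trans (sym (enc-dec₀ i)) (trans (cong enc₀ e) (enc-dec₀ j))

  enc₀-injective : ∀ u v → enc₀ u ≡ enc₀ v → u ≡ v
  enc₀-injective u v e = trans (sym (dec-enc₀ u)) (trans (cong dec₀ e) (dec-enc₀ v))

  _≟₀_ : (u v : Maybe W) → Dec (u ≡ v)
  u ≟₀ v = map′ (enc₀-injective u v) (cong enc₀) (enc₀ u ≟ᶠ enc₀ v)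

  Up : Maybe W → Maybe W → Set
  Up (just w) v = par w ≡ v
  Up nothing v = ⊥

  TreeAdj : Maybe W → Maybe W → Set
  TreeAdj u v = Up u v ⊎ Up v u

  -- An element `w` also stands for the tree edge from `just w` to its parent, so the line graph has
  -- vertex type `W`. Two edges meet in a common upper end, or the upper end of one is the lower end
  -- of the other.
  LineAdj : W → W → Set
  LineAdj u v = u ≢ v × (par u ≡ par v ⊎ par u ≡ just v ⊎ just u ≡ par v)

  Up? : ∀ u v → Dec (Up u v)
  Up? (just w) v = par w ≟₀ v
  Up? nothing v = no λ ()

  TreeAdj? : ∀ u v → Dec (TreeAdj u v)
  TreeAdj? u v = Up? u v ⊎-dec Up? v u

  TreeAdj-sym : ∀ {u v} → TreeAdj u v → TreeAdj v u
  TreeAdj-sym (inj₁ x) = inj₂ x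
  TreeAdj-sym (inj₂ x) = inj₁ x

  Up-depth : ∀ u v → Up u v → depth u ≡ suc (depth v)
  Up-depth (just w) v e = trans (depth-par w) (cong (λ z → suc (depth z)) e)

  Up-functional : ∀ u {v v'} → Up u v → Up u v' → v ≡ v'
  Up-functional (just w) e e' = trans (sym e) e'

  Up-irrefl : ∀ u → ¬ Up u u
  Up-irrefl u h = ℕ.m≢1+m+n (depth u) {0} (trans (Up-depth u u h) (cong suc (sym (ℕ.+-identityʳ _))))

  -- Orient the edges towards parents. In a transitive triangle one vertex has two parents, which
  -- must coincide; in a cyclic one the depth would change by three around the triangle.
  no-triangle : ∀ u v w → TreeAdj u v → TreeAdj u w → TreeAdj v w → ⊥
  no-triangle u v w (inj₁ uv) (inj₁ uw) vw with Up-functional u uv uw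
  ... | refl = Up-irrefl v (diag vw)
    where
      diag : TreeAdj v v → Up v v
      diag (inj₁ x) = x
      diag (inj₂ x) = x
  no-triangle u v w (inj₂ vu) (inj₂ wu) (inj₁ vw) with Up-functional v vu vw
  ... | refl = Up-irrefl u wu
  no-triangle u v w (inj₂ vu) (inj₂ wu) (inj₂ wv) with Up-functional w wu wv
  ... | refl = Up-irrefl u vu
  no-triangle u v w (inj₁ uv) (inj₂ wu) (inj₁ vw) =
    ℕ.m≢1+m+n (depth u) {2} (trans (Up-depth u v uv) (trans (cong suc (Up-depth v w vw)) (trans (cong (suc ∘ suc) (Up-depth w u wu)) (cong suc (ℕ.+-comm 2 (depth u))))))
  no-triangle u v w (inj₁ uv) (inj₂ wu) (inj₂ wv) with Up-functional w wu wv
  ... | refl = Up-irrefl u uv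
  no-triangle u v w (inj₂ vu) (inj₁ uw) (inj₁ vw) with Up-functional v vu vw
  ... | refl = Up-irrefl u uw
  no-triangle u v w (inj₂ vu) (inj₁ uw) (inj₂ wv) = no-triangle u w v (inj₁ uw) (inj₂ vu) (inj₁ wv)

  treeGraph : Graph (suc m)
  treeGraph = record
    { adj = λ i j → does (TreeAdj? (dec₀ i) (dec₀ j))
    ; sym = λ i j → does-cong (TreeAdj? (dec₀ i) (dec₀ j)) (TreeAdj? (dec₀ j) (dec₀ i)) TreeAdj-sym TreeAdj-sym
    ; irrefl = λ i → dec-false (TreeAdj? (dec₀ i) (dec₀ i)) (λ { (inj₁ x) → Up-irrefl (dec₀ i) x ; (inj₂ x) → Up-irrefl (dec₀ i) x }) }
    where
      does-cong : ∀ {A B : Set} (a : Dec A) (b : Dec B) → (A → B) → (B → A) → does a ≡ does b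
      does-cong (yes a) b f g = sym (dec-true b (f a))
      does-cong (no ¬a) b f g = sym (dec-false b (λ x → ¬a (g x)))

  treeGraph-adj : ∀ i j → Adj treeGraph i j ⇔ TreeAdj (dec₀ i) (dec₀ j)
  treeGraph-adj i j = does-true (TreeAdj? (dec₀ i) (dec₀ j))

  -- Stated for any graph with this adjacency, since it serves two graphs: `treeGraph`, the tree
  -- behind a line graph, and an induced subgraph of the ambient graph.
  module IsTreeGraph (X : Graph (suc m)) (adjX : ∀ i j → Adj X i j ⇔ TreeAdj (dec₀ i) (dec₀ j)) where

    adj-enc : ∀ {u v} → TreeAdj u v → Adj X (enc₀ u) (enc₀ v)
    adj-enc {u} {v} h = from (adjX _ _) (subst₂ TreeAdj (sym (dec-enc₀ u)) (sym (dec-enc₀ v)) h)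

    walk-to-root : ∀ d u → depth u ≤ d → Walk X (enc₀ u) fzero
    walk-to-root d nothing _ = here
    walk-to-root zero (just w) le with ≤-trans (≤-reflexive (sym (depth-par w))) le
    ... | ()
    walk-to-root (suc d) (just w) le = step (adj-enc {just w} {par w} (inj₁ refl))
      (walk-to-root d (par w) (≤-pred (≤-trans (≤-reflexive (sym (depth-par w))) le)))

    connected : Connected X
    connected i j = walk-++ (w i) (walk-reverse (w j))
      where
        w : ∀ i → Walk X i fzero
        w i = subst (λ z → Walk X z fzero) (enc-dec₀ i) (walk-to-root _ (dec₀ i) ≤-refl)

    -- The deepest vertex of a cycle would have two distinct parents.
    acyclic : Acyclic X
    acyclic (k , c , inj , st , cl) = contra
      where
        mx = argmax (λ i → depth (dec₀ (c i)))
        top = proj₁ mx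
        up-at-top : ∀ a → Adj X (c top) (c a) → Up (dec₀ (c top)) (dec₀ (c a))
        up-at-top a h with to (adjX _ _) h
        ... | inj₁ x = x
        ... | inj₂ x = ⊥-elim (ℕ.1+n≰n (≤-trans (≤-reflexive (sym (Up-depth _ _ x))) (proj₂ mx a)))
        contra : ⊥
        contra with cycle-neighbours X c st cl top
        ... | a , b , a≢b , ha , hb = a≢b (inj a b (dec₀-injective _ _ (Up-functional (dec₀ (c top)) (up-at-top a ha) (up-at-top b hb))))

    tree : Tree X
    tree = connected , acyclic

    leaf : ∀ u → (∀ v v' → TreeAdj u v → TreeAdj u v' → v ≡ v') → Leaf X (enc₀ u)
    leaf u un = deg≤1 X (enc₀ u) λ x y hx hy → dec₀-injective x y
      (un _ _ (subst (λ z → TreeAdj z (dec₀ x)) (dec-enc₀ u) (to (adjX _ _) hx)) (subst (λ z → TreeAdj z (dec₀ y)) (dec-enc₀ u) (to (adjX _ _) hy)))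

    not-leaf : ∀ u v v' → TreeAdj u v → TreeAdj u v' → v ≢ v' → ¬ Leaf X (enc₀ u)
    not-leaf u v v' h h' ne le = <⇒≱ (deg≥2 X (enc₀ u) (enc₀ v) (enc₀ v') (adj-enc h) (adj-enc h') (λ e → ne (enc₀-injective _ _ e))) le

    branch : ∀ u v v' v'' → TreeAdj u v → TreeAdj u v' → TreeAdj u v'' → v ≢ v' → v ≢ v'' → v' ≢ v'' → Branch X (enc₀ u)
    branch u v v' v'' h h' h'' ne ne' ne'' = deg≥3 X (enc₀ u) (enc₀ v) (enc₀ v') (enc₀ v'') (adj-enc h) (adj-enc h') (adj-enc h'')
      (λ e → ne (enc₀-injective _ _ e)) (λ e → ne' (enc₀-injective _ _ e)) (λ e → ne'' (enc₀-injective _ _ e))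

    degree≤ : ∀ u {k} (g : Fin k → Maybe W) → (∀ v → TreeAdj u v → ∃[ i ] g i ≡ v) → deg X (enc₀ u) ≤ k
    degree≤ u g cov = deg≤ X (enc₀ u) (λ i → enc₀ (g i)) λ x hx →
      let (i , e) = cov (dec₀ x) (subst (λ z → TreeAdj z (dec₀ x)) (dec-enc₀ u) (to (adjX _ _) hx))
      in i , trans (cong enc₀ e) (enc-dec₀ x)

    not-simplicial : ∀ u v v' → TreeAdj u v → TreeAdj u v' → v ≢ v' → ¬ Simplicial X (enc₀ u)
    not-simplicial u v v' h h' ne si =
      no-triangle u v v' h h' (subst₂ TreeAdj (dec-enc₀ v) (dec-enc₀ v')
        (to (adjX _ _) (si (enc₀ v) (enc₀ v') (adj-enc h) (adj-enc h') (λ e → ne (enc₀-injective _ _ e)))))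

    simplicial : ∀ u → (∀ v v' → TreeAdj u v → TreeAdj u v' → v ≡ v') → Simplicial X (enc₀ u)
    simplicial u un x y hx hy ne = ⊥-elim (ne (dec₀-injective x y
      (un _ _ (subst (λ z → TreeAdj z (dec₀ x)) (dec-enc₀ u) (to (adjX _ _) hx)) (subst (λ z → TreeAdj z (dec₀ y)) (dec-enc₀ u) (to (adjX _ _) hy)))))

  module IsLineGraph (H : Graph m) (adjH : ∀ i j → Adj H i j ⇔ LineAdj (dec i) (dec j)) where

    adj-enc : ∀ {u v} → LineAdj u v → Adj H (enc u) (enc v)
    adj-enc {u} {v} h = from (adjH _ _) (subst₂ LineAdj (sym (dec-enc u)) (sym (dec-enc v)) h)

    adj-dec : ∀ {u} {x} → Adj H (enc u) x → LineAdj u (dec x)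
    adj-dec {u} {x} h = subst (λ z → LineAdj z (dec x)) (dec-enc u) (to (adjH _ _) h)

    -- Vertex `i` of `H` is sent to the edge from the tree vertex `fsuc i` to its parent. With the
    -- edges so oriented, a coincidence with swapped ends would mean two vertices that are parents
    -- of each other, which the depth excludes.
    isLineGraphOf : IsLineGraphOf H treeGraph
    isLineGraphOf = a , b , (λ i → from (treeGraph-adj (a i) (b i)) (inj₁ (sym (dec-enc₀ _)))) , cover , inj ,
        (λ i j → mk⇔ (λ h → fwd i j (to (adjH i j) h)) (λ h → from (adjH i j) (bwd i j h)))
      where
        a b : Fin m → Fin (suc m)
        a i = fsuc i
        b i = enc₀ (par (dec i))
        b-dec : ∀ {i x} → par (dec i) ≡ dec₀ x → b i ≡ x
        b-dec {i} {x} e = trans (cong enc₀ e) (enc-dec₀ x)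
        up→ : ∀ x y → Up (dec₀ x) (dec₀ y) → ∃[ i ] (a i ≡ x × b i ≡ y)
        up→ (fsuc i) y e = i , refl , b-dec e
        cover : ∀ x y → Adj treeGraph x y → ∃[ i ] ((a i ≡ x × b i ≡ y) ⊎ (a i ≡ y × b i ≡ x))
        cover x y h with to (treeGraph-adj x y) h
        ... | inj₁ u = let (i , p) = up→ x y u in i , inj₁ p
        ... | inj₂ u = let (i , p) = up→ y x u in i , inj₂ p
        par-of : ∀ i j → fsuc i ≡ b j → just (dec i) ≡ par (dec j)
        par-of i j e = trans (cong dec₀ e) (dec-enc₀ _)
        asym : ∀ u v → just u ≡ par v → par u ≡ just v → ⊥
        asym u v e e' = ℕ.m≢1+m+n (depth (just u)) {1}
          (trans (Up-depth (just u) (just v) e') (cong suc (trans (Up-depth (just v) (just u) (sym e)) (sym (ℕ.+-comm _ 1)))))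
        inj : ∀ i j → ((a i ≡ a j × b i ≡ b j) ⊎ (a i ≡ b j × b i ≡ a j)) → i ≡ j
        inj i j (inj₁ (e , _)) = suc-injective e
        inj i j (inj₂ (e , e')) = ⊥-elim (asym _ _ (par-of i j e) (sym (par-of j i (sym e'))))
        fwd : ∀ i j → LineAdj (dec i) (dec j) → i ≢ j × (a i ≡ a j ⊎ a i ≡ b j ⊎ b i ≡ a j ⊎ b i ≡ b j)
        fwd i j (ne , inj₁ e) = (λ { refl → ne refl }) , inj₂ (inj₂ (inj₂ (cong enc₀ e)))
        fwd i j (ne , inj₂ (inj₁ e)) = (λ { refl → ne refl }) , inj₂ (inj₂ (inj₁ (b-dec e)))
        fwd i j (ne , inj₂ (inj₂ e)) = (λ { refl → ne refl }) , inj₂ (inj₁ (sym (b-dec (sym e))))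
        bwd : ∀ i j → i ≢ j × (a i ≡ a j ⊎ a i ≡ b j ⊎ b i ≡ a j ⊎ b i ≡ b j) → LineAdj (dec i) (dec j)
        bwd i j (ne , inj₁ e) = ⊥-elim (ne (suc-injective e))
        bwd i j (ne , inj₂ (inj₁ e)) = (λ e' → ne (dec-injective i j e')) , inj₂ (inj₂ (par-of i j e))
        bwd i j (ne , inj₂ (inj₂ (inj₁ e))) = (λ e' → ne (dec-injective i j e')) , inj₂ (inj₁ (sym (par-of j i (sym e))))
        bwd i j (ne , inj₂ (inj₂ (inj₂ e))) = (λ e' → ne (dec-injective i j e')) , inj₁ (enc₀-injective _ _ e)

    walk-to-top : ∀ d u → depth (just u) ≤ d → Σ[ v ∈ W ] (par v ≡ nothing × Walk H (enc u) (enc v))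
    walk-to-top zero u le with ≤-trans (≤-reflexive (sym (depth-par u))) le
    ... | ()
    walk-to-top (suc d) u le with par u in e
    ... | nothing = u , e , here
    ... | just w =
      let (v , p , wk) = walk-to-top d w (≤-pred (≤-trans (≤-reflexive (sym (trans (depth-par u) (cong (λ z → suc (depth z)) e)))) le))
      in v , p , step (adj-enc ((λ { refl → Up-irrefl (just u) e }) , inj₂ (inj₁ e))) wk

    connected : Connected H
    connected i j with walk-to-top _ (dec i) ≤-refl | walk-to-top _ (dec j) ≤-refl
    ... | u , pu , wu | v , pv , wv = subst₂ (Walk H) (enc-dec i) (enc-dec j) (walk-++ wu (walk-++ across (walk-reverse wv)))
      where
        -- The edges at the root form a clique, so the two top edges are equal or adjacent.
        across : Walk H (enc u) (enc v)
        across with enc u ≟ᶠ enc v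
        ... | yes e = subst (Walk H (enc u)) e here
        ... | no ne = step (adj-enc ((λ e → ne (cong enc e)) , inj₁ (trans pu (sym pv)))) here

    degree≤ : ∀ u {k} (g : Fin k → W) → (∀ v → LineAdj u v → ∃[ i ] g i ≡ v) → deg H (enc u) ≤ k
    degree≤ u g cov = deg≤ H (enc u) (λ i → enc (g i)) λ x hx →
      let (i , e) = cov (dec x) (adj-dec hx) in i , trans (cong enc e) (enc-dec x)

    -- Every edge that meets `u` then contains the upper end of `u`, so the neighbours meet one
    -- another there.
    childless-simplicial : ∀ u → (∀ w → par w ≢ just u) → Simplicial H (enc u)
    childless-simplicial u none x y hx hy x≢y = from (adjH x y) (ne , go (proj₂ (adj-dec hx)) (proj₂ (adj-dec hy)) ne)
      where
        ne : dec x ≢ dec y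
        ne e = x≢y (dec-injective x y e)
        go : ∀ {v w} → (par u ≡ par v ⊎ par u ≡ just v ⊎ just u ≡ par v) → (par u ≡ par w ⊎ par u ≡ just w ⊎ just u ≡ par w) → v ≢ w →
          par v ≡ par w ⊎ par v ≡ just w ⊎ just v ≡ par w
        go (inj₂ (inj₂ e)) _ _ = ⊥-elim (none _ (sym e))
        go (inj₁ _) (inj₂ (inj₂ e)) _ = ⊥-elim (none _ (sym e))
        go (inj₂ (inj₁ _)) (inj₂ (inj₂ e)) _ = ⊥-elim (none _ (sym e))
        go (inj₁ e) (inj₁ e') _ = inj₁ (trans (sym e) e')
        go (inj₁ e) (inj₂ (inj₁ e')) _ = inj₂ (inj₁ (trans (sym e) e'))
        go (inj₂ (inj₁ e)) (inj₁ e') _ = inj₂ (inj₂ (trans (sym e) e'))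
        go (inj₂ (inj₁ e)) (inj₂ (inj₁ e')) ne = ⊥-elim (ne (just-injective (trans (sym e) e')))

    -- The mirror case: nothing else is attached at the root end of `u`, so all neighbours share its
    -- lower end.
    sole-top-simplicial : ∀ u → par u ≡ nothing → (∀ w → par w ≡ nothing → w ≡ u) → Simplicial H (enc u)
    sole-top-simplicial u top sole x y hx hy x≢y =
        from (adjH x y) ((λ e → x≢y (dec-injective x y e)) , inj₁ (trans (child (adj-dec hx)) (sym (child (adj-dec hy)))))
      where
        child : ∀ {v} → LineAdj u v → par v ≡ just u
        child (ne , inj₁ e) = ⊥-elim (ne (sym (sole _ (trans (sym e) top))))
        child (ne , inj₂ (inj₁ e)) with trans (sym e) top
        ... | ()
        child (ne , inj₂ (inj₂ e)) = sym e

    -- The edges `w` and `v` are attached at opposite ends of `u`. As `v` is at most as deep as `u`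
    -- and `w` is deeper than `u`, they cannot meet.
    two-sided-not-simplicial : ∀ u w v → par w ≡ just u → u ≢ v → par u ≡ par v ⊎ par u ≡ just v → ¬ Simplicial H (enc u)
    two-sided-not-simplicial u w v c u≢v h si = not-adjacent (subst₂ LineAdj (dec-enc w) (dec-enc v) (to (adjH _ _)
        (si (enc w) (enc v) (adj-enc ((λ { refl → Up-irrefl (just u) c }) , inj₂ (inj₂ (sym c)))) (adj-enc (u≢v , side h))
            (λ e → w≢v (trans (sym (dec-enc w)) (trans (cong dec e) (dec-enc v)))))))
      where
        side : par u ≡ par v ⊎ par u ≡ just v → par u ≡ par v ⊎ par u ≡ just v ⊎ just u ≡ par v
        side (inj₁ e) = inj₁ e
        side (inj₂ e) = inj₂ (inj₁ e)
        depth-v : par u ≡ par v ⊎ par u ≡ just v → depth (just v) ≤ depth (just u)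
        depth-v (inj₁ e) = ≤-reflexive (trans (depth-par v) (trans (cong (suc ∘ depth) (sym e)) (sym (depth-par u))))
        depth-v (inj₂ e) = ≤-trans (n≤1+n _) (≤-reflexive (sym (Up-depth (just u) (just v) e)))
        depth-w : depth (just w) ≡ suc (depth (just u))
        depth-w = Up-depth (just w) (just u) c
        w≢v : w ≢ v
        w≢v refl = <⇒≱ (≤-reflexive (sym depth-w)) (depth-v h)
        not-adjacent : LineAdj w v → ⊥
        not-adjacent (_ , inj₁ e) = <⇒≱ (≤-reflexive (sym (Up-depth (just v) (just u) (trans (sym e) c)))) (depth-v h)
        not-adjacent (_ , inj₂ (inj₁ e)) = u≢v (just-injective (trans (sym c) e))
        not-adjacent (_ , inj₂ (inj₂ e)) = <⇒≱ (≤-trans (≤-reflexive (cong suc (sym depth-w))) (≤-trans (≤-reflexive (sym (Up-depth (just v) (just w) (sym e)))) (depth-v h))) (n≤1+n _)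

-- Combs: a core path with legs

-- Only the vertices other than the root: the first core vertex is the root and is added as
-- `nothing`, so `cr k` is core vertex number `k + 1`. Legs are never empty.
data Comb (K t : ℕ) (ℓ : Fin t → ℕ) : Set where
  cr : Fin K → Comb K t ℓ
  lg : (j : Fin t) → Fin (suc (ℓ j)) → Comb K t ℓ

legTotal : (t : ℕ) → (Fin t → ℕ) → ℕ
legTotal zero ℓ = 0
legTotal (suc t) ℓ = suc (ℓ fzero) + legTotal t (ℓ ∘ fsuc)

LegVertex : (t : ℕ) → (Fin t → ℕ) → Set
LegVertex t ℓ = Σ[ j ∈ Fin t ] Fin (suc (ℓ j))

encLeg : ∀ t ℓ → LegVertex t ℓ → Fin (legTotal t ℓ)
encLeg (suc t) ℓ (fzero , a) = join (suc (ℓ fzero)) (legTotal t (ℓ ∘ fsuc)) (inj₁ a)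
encLeg (suc t) ℓ (fsuc j , a) = join (suc (ℓ fzero)) (legTotal t (ℓ ∘ fsuc)) (inj₂ (encLeg t (ℓ ∘ fsuc) (j , a)))

shift : ∀ t ℓ → LegVertex t (ℓ ∘ fsuc) → LegVertex (suc t) ℓ
shift t ℓ (j , a) = fsuc j , a

decLeg : ∀ t ℓ → Fin (legTotal t ℓ) → LegVertex t ℓ
decLeg (suc t) ℓ i with splitAt (suc (ℓ fzero)) i
... | inj₁ a = fzero , a
... | inj₂ k = shift t ℓ (decLeg t (ℓ ∘ fsuc) k)

decLeg-encLeg : ∀ t ℓ x → decLeg t ℓ (encLeg t ℓ x) ≡ x
decLeg-encLeg (suc t) ℓ (fzero , a) rewrite splitAt-join (suc (ℓ fzero)) (legTotal t (ℓ ∘ fsuc)) (inj₁ a) = refl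
decLeg-encLeg (suc t) ℓ (fsuc j , a)
  rewrite splitAt-join (suc (ℓ fzero)) (legTotal t (ℓ ∘ fsuc)) (inj₂ (encLeg t (ℓ ∘ fsuc) (j , a)))
  = cong (shift t ℓ) (decLeg-encLeg t (ℓ ∘ fsuc) (j , a))

encLeg-decLeg : ∀ t ℓ i → encLeg t ℓ (decLeg t ℓ i) ≡ i
encLeg-decLeg (suc t) ℓ i with splitAt (suc (ℓ fzero)) i in e
... | inj₁ a = trans (cong (join (suc (ℓ fzero)) _) (sym e)) (join-splitAt (suc (ℓ fzero)) _ i)
... | inj₂ k = trans (cong (λ z → join (suc (ℓ fzero)) _ (inj₂ z)) (encLeg-decLeg t (ℓ ∘ fsuc) k))
                     (trans (cong (join (suc (ℓ fzero)) _) (sym e)) (join-splitAt (suc (ℓ fzero)) _ i))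

-- A tree made of a core path with K edges, rooted at its first vertex, and of t legs: the leg j has
-- ℓ j + 1 vertices and hangs at the core vertex number c j.
module CombTree (K t : ℕ) (ℓ : Fin t → ℕ) (c : Fin t → Fin (suc K)) where

  W : Set
  W = Comb K t ℓ

  size : ℕ
  size = K + legTotal t ℓ

  enc : W → Fin size
  enc (cr k) = join K (legTotal t ℓ) (inj₁ k)
  enc (lg j a) = join K (legTotal t ℓ) (inj₂ (encLeg t ℓ (j , a)))

  fromLeg : LegVertex t ℓ → W
  fromLeg (j , a) = lg j a

  dec : Fin size → W
  dec i with splitAt K i
  ... | inj₁ k = cr k
  ... | inj₂ x = fromLeg (decLeg t ℓ x)

  dec-enc : ∀ w → dec (enc w) ≡ w
  dec-enc (cr k) rewrite splitAt-join K (legTotal t ℓ) (inj₁ k) = refl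
  dec-enc (lg j a) rewrite splitAt-join K (legTotal t ℓ) (inj₂ (encLeg t ℓ (j , a))) = cong fromLeg (decLeg-encLeg t ℓ (j , a))

  enc-dec : ∀ i → enc (dec i) ≡ i
  enc-dec i with splitAt K i in e
  ... | inj₁ k = trans (cong (join K _) (sym e)) (join-splitAt K _ i)
  ... | inj₂ x = trans (cong (λ z → join K _ (inj₂ z)) (encLeg-decLeg t ℓ x)) (trans (cong (join K _) (sym e)) (join-splitAt K _ i))

  core : Fin (suc K) → Maybe W
  core fzero = nothing
  core (fsuc k) = just (cr k)

  leg : (j : Fin t) → Fin (suc (ℓ j)) → Maybe W
  leg j a = just (lg j a)

  par : W → Maybe W
  par (cr k) = core (inject₁ k)
  par (lg j fzero) = core (c j)
  par (lg j (fsuc a)) = leg j (inject₁ a)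

  depth : Maybe W → ℕ
  depth nothing = 0
  depth (just (cr k)) = suc (toℕ k)
  depth (just (lg j a)) = suc (toℕ (c j) + toℕ a)

  depth-core : ∀ k → depth (core k) ≡ toℕ k
  depth-core fzero = refl
  depth-core (fsuc k) = refl

  depth-par : ∀ w → depth (just w) ≡ suc (depth (par w))
  depth-par (cr k) = cong suc (sym (trans (depth-core (inject₁ k)) (toℕ-inject₁ k)))
  depth-par (lg j fzero) = cong suc (trans (ℕ.+-identityʳ _) (sym (depth-core (c j))))
  depth-par (lg j (fsuc a)) = cong suc (trans (ℕ.+-suc _ _) (cong (λ z → suc (toℕ (c j) + z)) (sym (toℕ-inject₁ a))))

  rootedTree : RootedTree W size
  rootedTree = record { enc = enc ; dec = dec ; dec-enc = dec-enc ; enc-dec = enc-dec ; par = par ; depth = depth ; depth-par = depth-par }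

  open RootedTree rootedTree public using (enc₀; dec₀; dec-enc₀; enc-dec₀; dec-injective; dec₀-injective; enc₀-injective; Up; TreeAdj; LineAdj; treeGraph; treeGraph-adj; module IsTreeGraph; module IsLineGraph; TreeAdj-sym; Up-functional)

  core-injective : ∀ k k' → core k ≡ core k' → k ≡ k'
  core-injective fzero fzero e = refl
  core-injective (fsuc k) (fsuc .k) refl = refl

  leg-injective : ∀ j {a a'} → leg j a ≡ leg j a' → a ≡ a'
  leg-injective j refl = refl

  lg-injective : ∀ {j j' a a'} → lg {K} {t} {ℓ} j a ≡ lg j' a' → j ≡ j'
  lg-injective refl = refl

  core≢leg : ∀ k {j a} → core k ≢ leg j a
  core≢leg fzero ()
  core≢leg (fsuc k) ()

  -- Merges the root with the elements `cr k`, so that core vertices need no separate case for the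
  -- root.
  data View : Maybe W → Set where
    is-core : ∀ k → View (core k)
    is-leg : ∀ j a → View (leg j a)

  view-vertex : ∀ u → View u
  view-vertex nothing = is-core fzero
  view-vertex (just (cr k)) = is-core (fsuc k)
  view-vertex (just (lg j a)) = is-leg j a

  Up-core-core : ∀ k k' → Up (core k) (core k') ⇔ (suc (toℕ k') ≡ toℕ k)
  Up-core-core fzero k' = mk⇔ (λ ()) (λ ())
  Up-core-core (fsuc k) k' = mk⇔ (λ e → cong suc (trans (sym (cong toℕ (core-injective _ _ e))) (toℕ-inject₁ k)))
    (λ e → cong core (toℕ-injective (trans (toℕ-inject₁ k) (sym (ℕ.suc-injective e)))))

  Up-core-leg : ∀ k {j a} → ¬ Up (core k) (leg j a)
  Up-core-leg (fsuc k) e = core≢leg (inject₁ k) e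

  Up-leg-core : ∀ k j a → Up (leg j a) (core k) ⇔ (toℕ a ≡ 0 × c j ≡ k)
  Up-leg-core k j fzero = mk⇔ (λ e → refl , core-injective _ _ e) (λ (_ , e) → cong core e)
  Up-leg-core k j (fsuc a) = mk⇔ (λ e → ⊥-elim (core≢leg k (sym e))) (λ ())

  Up-leg-leg : ∀ j a a' → Up (leg j a) (leg j a') ⇔ (suc (toℕ a') ≡ toℕ a)
  Up-leg-leg j fzero a' = mk⇔ (λ e → ⊥-elim (core≢leg (c j) e)) (λ ())
  Up-leg-leg j (fsuc a) a' = mk⇔ (λ e → cong suc (trans (sym (cong toℕ (leg-injective j e))) (toℕ-inject₁ a)))
    (λ e → cong (leg j) (toℕ-injective (trans (toℕ-inject₁ a) (sym (ℕ.suc-injective e)))))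

  Up-other-leg : ∀ j a j' a' → j ≢ j' → ¬ Up (leg j a) (leg j' a')
  Up-other-leg j fzero j' a' ne e = core≢leg (c j) e
  Up-other-leg j (fsuc a) j' a' ne refl = ne refl

  TreeAdj-core-core : ∀ k k' → TreeAdj (core k) (core k') ⇔ (suc (toℕ k) ≡ toℕ k' ⊎ suc (toℕ k') ≡ toℕ k)
  TreeAdj-core-core k k' = mk⇔
    (λ { (inj₁ x) → inj₂ (to (Up-core-core k k') x) ; (inj₂ x) → inj₁ (to (Up-core-core k' k) x) })
    (λ { (inj₁ x) → inj₂ (from (Up-core-core k' k) x) ; (inj₂ x) → inj₁ (from (Up-core-core k k') x) })

  TreeAdj-core-leg : ∀ k j a → TreeAdj (core k) (leg j a) ⇔ (toℕ a ≡ 0 × c j ≡ k)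
  TreeAdj-core-leg k j a = mk⇔
    (λ { (inj₁ x) → ⊥-elim (Up-core-leg k x) ; (inj₂ x) → to (Up-leg-core k j a) x })
    (λ x → inj₂ (from (Up-leg-core k j a) x))

  TreeAdj-leg-leg : ∀ j a a' → TreeAdj (leg j a) (leg j a') ⇔ (suc (toℕ a) ≡ toℕ a' ⊎ suc (toℕ a') ≡ toℕ a)
  TreeAdj-leg-leg j k k' = mk⇔
    (λ { (inj₁ x) → inj₂ (to (Up-leg-leg j k k') x) ; (inj₂ x) → inj₁ (to (Up-leg-leg j k' k) x) })
    (λ { (inj₁ x) → inj₂ (from (Up-leg-leg j k' k) x) ; (inj₂ x) → inj₁ (from (Up-leg-leg j k k') x) })

  TreeAdj-other-leg : ∀ j a j' a' → j ≢ j' → ¬ TreeAdj (leg j a) (leg j' a')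
  TreeAdj-other-leg j a j' a' ne (inj₁ x) = Up-other-leg j a j' a' ne x
  TreeAdj-other-leg j a j' a' ne (inj₂ x) = Up-other-leg j' a' j a (ne ∘ sym) x

  tip : (j : Fin t) → Fin (suc (ℓ j))
  tip j = fromℕ (ℓ j)

  tip-unique : ∀ j (a : Fin (suc (ℓ j))) → toℕ a ≡ ℓ j → a ≡ tip j
  tip-unique j a e = toℕ-injective (trans e (sym (toℕ-fromℕ _)))

  next-leg : ∀ j (a : Fin (suc (ℓ j))) → toℕ a ≢ ℓ j → Σ[ a' ∈ Fin (suc (ℓ j)) ] (toℕ a' ≡ suc (toℕ a))
  next-leg j a ne = fromℕ< lt , toℕ-fromℕ< lt
    where lt = s≤s (≤∧≢⇒< (≤-pred (toℕ<n a)) ne)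

  tip-childless : ∀ j v → ¬ Up v (leg j (tip j))
  tip-childless j v x with view-vertex v
  ... | is-core k = Up-core-leg k x
  ... | is-leg j' a with j' ≟ᶠ j
  ... | no ne = Up-other-leg j' a j (tip j) ne x
  ... | yes refl = <⇒≱ (toℕ<n a) (≤-reflexive (trans (cong suc (sym (toℕ-fromℕ (ℓ j)))) (to (Up-leg-leg j a (tip j)) x)))

  tip-neighbour : ∀ j v v' → TreeAdj (leg j (tip j)) v → TreeAdj (leg j (tip j)) v' → v ≡ v'
  tip-neighbour j v v' (inj₁ x) (inj₁ x') = Up-functional (leg j (tip j)) x x'
  tip-neighbour j v v' (inj₂ x) _ = ⊥-elim (tip-childless j v x)
  tip-neighbour j v v' _ (inj₂ x) = ⊥-elim (tip-childless j v' x)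

  leg-child-unique : ∀ {j a w w'} → par w ≡ leg j a → par w' ≡ leg j a → w ≡ w'
  leg-child-unique {w = cr k} e e' = ⊥-elim (core≢leg (inject₁ k) e)
  leg-child-unique {w = lg j fzero} e e' = ⊥-elim (core≢leg (c j) e)
  leg-child-unique {w = lg j (fsuc a)} {cr k} e e' = ⊥-elim (core≢leg (inject₁ k) e')
  leg-child-unique {w = lg j (fsuc a)} {lg j' fzero} e e' = ⊥-elim (core≢leg (c j') e')
  leg-child-unique {w = lg j (fsuc a)} {lg j' (fsuc a')} e e' with trans e (sym e')
  ... | f with just-injective f
  ... | g with lg-injective g
  ... | refl = cong (λ z → lg j z) (toℕ-injective (cong suc (trans (sym (toℕ-inject₁ a)) (trans (cong toℕ (leg-injective j f)) (toℕ-inject₁ a')))))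

  inner-leg-neighbours : ∀ j a → toℕ a ≢ ℓ j → Σ[ v ∈ Maybe W ] Σ[ v' ∈ Maybe W ] (TreeAdj (leg j a) v × TreeAdj (leg j a) v' × v ≢ v')
  inner-leg-neighbours j a ne = par (lg j a) , leg j a' , inj₁ refl , h , ne'
    where
      a' = proj₁ (next-leg j a ne)
      h : TreeAdj (leg j a) (leg j a')
      h = from (TreeAdj-leg-leg j a a') (inj₁ (sym (proj₂ (next-leg j a ne))))
      ne' : par (lg j a) ≢ leg j a'
      ne' e = ℕ.m≢1+m+n (toℕ a) {1} (trans (sym (to (Up-leg-leg j a a') e)) (cong suc (trans (proj₂ (next-leg j a ne)) (ℕ.+-comm 1 _))))

  module TreeOn (X : Graph (suc size)) (adjX : ∀ i j → Adj X i j ⇔ TreeAdj (dec₀ i) (dec₀ j)) where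

    open IsTreeGraph X adjX public

    not-branch-leg : ∀ j a → ¬ Branch X (enc₀ (leg j a))
    not-branch-leg j a br = <⇒≱ br (degree≤ (leg j a) {2} g cov)
      where
        -- At the tip the value `nothing` is a dummy: there is no child, and `child-is` refutes that
        -- case.
        child : Maybe W
        child with toℕ a ℕ.≟ ℓ j
        ... | yes _ = nothing
        ... | no ne = leg j (proj₁ (next-leg j a ne))
        child-is : ∀ a' → suc (toℕ a) ≡ toℕ a' → child ≡ leg j a'
        child-is a' e with toℕ a ℕ.≟ ℓ j
        ... | yes e' = ⊥-elim (<⇒≱ (toℕ<n a') (≤-reflexive (trans (cong suc (sym e')) e)))
        ... | no ne = cong (leg j) (toℕ-injective (trans (proj₂ (next-leg j a ne)) e))
        g : Fin 2 → Maybe W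
        g fzero = par (lg j a)
        g (fsuc _) = child
        cov : ∀ v → TreeAdj (leg j a) v → ∃[ i ] g i ≡ v
        cov v (inj₁ x) = fzero , x
        cov v (inj₂ x) with view-vertex v
        ... | is-core k = ⊥-elim (Up-core-leg k x)
        ... | is-leg j' a' with j' ≟ᶠ j
        ... | no ne = ⊥-elim (Up-other-leg j' a' j a ne x)
        ... | yes refl = fsuc fzero , child-is a' (to (Up-leg-leg j a' a) x)

-- Caterpillars

-- Discrete intermediate value theorem; the crossing is found at the first index where `f` equals
-- `y`.
ivt-up : ∀ {K} (f : Fin (suc K) → ℕ) → (∀ i → Consecutive (f (inject₁ i)) (f (fsuc i))) →
  ∀ y → f fzero ≤ y → y ≤ f (fromℕ K) → ∃[ i ] f i ≡ y
ivt-up {zero} f st y lo hi = fzero , ≤-antisym lo hi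
ivt-up {suc K} f st y lo hi with f fzero ℕ.≟ y
... | yes e = fzero , e
... | no ne with ivt-up (f ∘ fsuc) (st ∘ fsuc) y (next (st fzero)) hi
  where
    next : Consecutive (f fzero) (f (fsuc fzero)) → f (fsuc fzero) ≤ y
    next (inj₁ e) = ≤-trans (≤-reflexive (sym e)) (≤∧≢⇒< lo ne)
    next (inj₂ e) = ≤-trans (n≤1+n _) (≤-trans (≤-reflexive e) lo)
... | i , e = fsuc i , e

ivt-down : ∀ {K} (f : Fin (suc K) → ℕ) → (∀ i → Consecutive (f (inject₁ i)) (f (fsuc i))) →
  ∀ y → y ≤ f fzero → f (fromℕ K) ≤ y → ∃[ i ] f i ≡ y
ivt-down {zero} f st y hi lo = fzero , ≤-antisym lo hi
ivt-down {suc K} f st y hi lo with f fzero ℕ.≟ y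
... | yes e = fzero , e
... | no ne with ivt-down (f ∘ fsuc) (st ∘ fsuc) y (next (st fzero)) lo
  where
    next : Consecutive (f fzero) (f (fsuc fzero)) → y ≤ f (fsuc fzero)
    next (inj₁ e) = ≤-trans hi (≤-trans (n≤1+n _) (≤-reflexive e))
    next (inj₂ e) = ≤-pred (≤-trans (≤∧≢⇒< hi (ne ∘ sym)) (≤-reflexive (sym e)))
... | i , e = fsuc i , e

path-leaf-at-end : ∀ {n} (G : Graph n) {k} (q : Fin k → Fin n) → IsPathSeq G q → ∀ i → Leaf G (q i) → toℕ i ≡ 0 ⊎ suc (toℕ i) ≡ k
path-leaf-at-end G {suc k} q (inj , ad) fzero le = inj₁ refl
path-leaf-at-end G {suc k} q (inj , ad) (fsuc i) le with suc (suc (toℕ i)) ℕ.≟ suc k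
... | yes e = inj₂ e
... | no ne = ⊥-elim (<⇒≱ (deg≥2 G (q (fsuc i)) (q (inject₁ i)) (q i⁺)
    (from (ad _ _) (inj₂ (cong suc (toℕ-inject₁ i)))) (from (ad _ _) (inj₁ (sym (toℕ-fromℕ< lt))))
    (λ e → ℕ.m≢1+m+n (toℕ i) {1} (trans (sym (toℕ-inject₁ i)) (trans (cong toℕ (inj _ _ e)) (trans (toℕ-fromℕ< lt) (cong suc (ℕ.+-comm 1 _))))))) le)
  where
    lt : suc (suc (toℕ i)) < suc k
    lt = ≤∧≢⇒< (s≤s (toℕ<n i)) ne
    i⁺ = fromℕ< lt

-- Inside `q`, a leaf of `G` can only be an end, so the two distinct ends of `p` sit at the two ends
-- of `q`. Positions in `q` change by one along `p`, hence `p` passes through every position of `q`.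
leaf-ended-path-maximal : ∀ {n} (G : Graph n) {K} (p : Fin (suc (suc K)) → Fin n) → IsPathSeq G p →
  Leaf G (p fzero) → Leaf G (p (fromℕ (suc K))) →
  ∀ (k : ℕ) (q : Fin k → Fin n) → IsPathSeq G q → (∀ i → ∃[ j ] q j ≡ p i) → ∀ j → ∃[ i ] p i ≡ q j
leaf-ended-path-maximal {n} G {K} p (pinj , pad) leaf₀ leaf₁ k q (qinj , qad) sub j = result
  where
    α : Fin (suc (suc K)) → Fin k
    α i = proj₁ (sub i)
    qα : ∀ i → q (α i) ≡ p i
    qα i = proj₂ (sub i)
    f : Fin (suc (suc K)) → ℕ
    f i = toℕ (α i)
    steps : ∀ i → Consecutive (f (inject₁ i)) (f (fsuc i))
    steps i = to (qad _ _) (subst₂ (Adj G) (sym (qα _)) (sym (qα _)) (from (pad _ _) (inj₁ (cong suc (toℕ-inject₁ i)))))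
    at-end : ∀ i → Leaf G (p i) → f i ≡ 0 ⊎ suc (f i) ≡ k
    at-end i le = path-leaf-at-end G q (qinj , qad) (α i) (subst (Leaf G) (sym (qα i)) le)
    conclude : (∃[ i ] f i ≡ toℕ j) → ∃[ i ] p i ≡ q j
    conclude (i , e) = i , trans (sym (qα i)) (cong q (toℕ-injective e))
    last = fromℕ (suc K)
    ends-differ : f fzero ≢ f last
    ends-differ e with pinj fzero last (trans (sym (qα fzero)) (trans (cong q (toℕ-injective e)) (qα last)))
    ... | ()
    below : ∀ {x} → suc x ≡ k → toℕ j ≤ x
    below e = ≤-pred (≤-trans (toℕ<n j) (≤-reflexive (sym e)))
    result : ∃[ i ] p i ≡ q j
    result with at-end fzero leaf₀ | at-end last leaf₁
    ... | inj₁ e | inj₁ e' = ⊥-elim (ends-differ (trans e (sym e')))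
    ... | inj₂ e | inj₂ e' = ⊥-elim (ends-differ (ℕ.suc-injective (trans e (sym e'))))
    ... | inj₁ e | inj₂ e' = conclude (ivt-up f steps (toℕ j) (≤-trans (≤-reflexive e) z≤n) (below e'))
    ... | inj₂ e | inj₁ e' = conclude (ivt-down f steps (toℕ j) (below e) (≤-trans (≤-reflexive e') z≤n))

reverse-path : ∀ {n} (G : Graph n) {k} (q : Fin k → Fin n) → IsPathSeq G q → IsPathSeq G (q ∘ opposite)
reverse-path {n} G {k} q (inj , ad) = inj' , ad'
  where
    opp-inj : ∀ {i j : Fin k} → opposite i ≡ opposite j → i ≡ j
    opp-inj {i} {j} e = trans (sym (opposite-involutive i)) (trans (cong opposite e) (opposite-involutive j))
    inj' : ∀ i j → q (opposite i) ≡ q (opposite j) → i ≡ j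
    inj' i j e = opp-inj (inj _ _ e)
    flip : ∀ (i j : Fin k) → suc (toℕ i) ≡ toℕ j → suc (toℕ (opposite j)) ≡ toℕ (opposite i)
    flip i j e = trans (cong suc (opposite-prop j)) (trans (sym (ℕ.+-∸-assoc 1 (toℕ<n j))) (trans (cong (k ∸_) (sym e)) (sym (opposite-prop i))))
    unflip : ∀ (i j : Fin k) → suc (toℕ (opposite i)) ≡ toℕ (opposite j) → suc (toℕ j) ≡ toℕ i
    unflip i j e = subst₂ (λ x y → suc (toℕ x) ≡ toℕ y) (opposite-involutive j) (opposite-involutive i) (flip (opposite i) (opposite j) e)
    ad' : ∀ i j → Adj G (q (opposite i)) (q (opposite j)) ⇔ Consecutive (toℕ i) (toℕ j)
    ad' i j = mk⇔ (λ h → fwd (to (ad _ _) h)) (λ h → from (ad _ _) (bwd h))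
      where
        fwd : Consecutive (toℕ (opposite i)) (toℕ (opposite j)) → Consecutive (toℕ i) (toℕ j)
        fwd (inj₁ e) = inj₂ (unflip i j e)
        fwd (inj₂ e) = inj₁ (unflip j i e)
        bwd : Consecutive (toℕ i) (toℕ j) → Consecutive (toℕ (opposite i)) (toℕ (opposite j))
        bwd (inj₁ e) = inj₂ (flip i j e)
        bwd (inj₂ e) = inj₁ (flip j i e)

-- A total choice of the at most one index with property `P`. It lets a fixed `Fin k` enumerate a
-- neighbourhood from which some kinds of neighbour may be absent; the default is harmless, since a
-- degree bound only needs a cover.
pick : ∀ {k} {A : Set} {P : Fin k → Set} → (∀ x → Dec (P x)) → (Fin k → A) → A → A
pick P? f default with any? P?
... | yes (x , _) = f x
... | no _ = default

pick-unique : ∀ {k} {A : Set} {P : Fin k → Set} (P? : ∀ x → Dec (P x)) (f : Fin k → A) default →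
  (∀ x y → P x → P y → x ≡ y) → ∀ x → P x → pick P? f default ≡ f x
pick-unique P? f default un x px with any? P?
... | yes (y , py) = cong f (un y x py px)
... | no none = ⊥-elim (none (x , px))

-- Distinct legs hang at distinct inner core vertices: injectivity keeps the degrees at most three,
-- and the strict bounds keep both ends of the core leaves.
module CaterpillarTree (K t : ℕ) (ℓ : Fin t → ℕ) (c : Fin t → Fin (suc K))
  (c-mono : ∀ j j' → toℕ j < toℕ j' → toℕ (c j) < toℕ (c j'))
  (c-pos : ∀ j → 0 < toℕ (c j)) (c-top : ∀ j → toℕ (c j) < K) (t-pos : 0 < t) where

  open CombTree K t ℓ c public

  c-injective : ∀ j j' → c j ≡ c j' → j ≡ j'
  c-injective = strictly-monotone-injective c c-mono

  -- Together with `end` this is the 1-wide enumeration: the leaves are the start of the core, the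
  -- leg tips in the order of attachment and the end of the core, and `spineIndex` gives the
  -- position on the spine that belongs to each.
  spineIndex : Fin (suc (suc t)) → Fin (suc K)
  spineIndex fzero = fzero
  spineIndex (fsuc i) with view i
  ... | ‵fromℕ = fromℕ K
  ... | ‵inject₁ j = c j

  end : Fin (suc (suc t)) → Maybe W
  end fzero = nothing
  end (fsuc i) with view i
  ... | ‵fromℕ = core (fromℕ K)
  ... | ‵inject₁ j = leg j (tip j)

  K-pos : 0 < K
  K-pos = ≤-trans (s≤s z≤n) (c-top (fromℕ< t-pos))

  spineIndex-mono : ∀ a b → toℕ a < toℕ b → toℕ (spineIndex a) < toℕ (spineIndex b)
  spineIndex-mono fzero (fsuc b) lt with view b
  ... | ‵fromℕ = subst (0 <_) (sym (toℕ-fromℕ K)) K-pos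
  ... | ‵inject₁ j = c-pos j
  spineIndex-mono (fsuc a) (fsuc b) (s≤s lt) with view a | view b
  ... | ‵fromℕ | ‵fromℕ = ⊥-elim (ℕ.<-irrefl refl lt)
  ... | ‵fromℕ | ‵inject₁ j = ⊥-elim (<⇒≱ (ℕ.<-trans (subst₂ _<_ (toℕ-fromℕ t) (toℕ-inject₁ j) lt) (toℕ<n j)) ≤-refl)
  ... | ‵inject₁ j | ‵fromℕ = subst (toℕ (c j) <_) (sym (toℕ-fromℕ K)) (c-top j)
  ... | ‵inject₁ j | ‵inject₁ j' = c-mono j j' (subst₂ _<_ (toℕ-inject₁ j) (toℕ-inject₁ j') lt)

  end-injective : ∀ a b → end a ≡ end b → a ≡ b
  end-injective fzero fzero e = refl
  end-injective fzero (fsuc b) e with view b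
  end-injective fzero (fsuc .(fromℕ t)) e | ‵fromℕ = ⊥-elim (<⇒≢ K-pos (trans (cong toℕ (core-injective fzero (fromℕ K) e)) (toℕ-fromℕ K)))
  end-injective fzero (fsuc .(inject₁ j)) () | ‵inject₁ j
  end-injective (fsuc a) fzero e = sym (end-injective fzero (fsuc a) (sym e))
  end-injective (fsuc a) (fsuc b) e with view a | view b
  ... | ‵fromℕ | ‵fromℕ = refl
  ... | ‵fromℕ | ‵inject₁ j = ⊥-elim (core≢leg (fromℕ K) e)
  ... | ‵inject₁ j | ‵fromℕ = ⊥-elim (core≢leg (fromℕ K) (sym e))
  end-injective (fsuc a) (fsuc b) refl | ‵inject₁ j | ‵inject₁ .j = refl

  IsEnd : Maybe W → Set
  IsEnd u = u ≡ nothing ⊎ u ≡ core (fromℕ K) ⊎ (Σ[ j ∈ Fin t ] u ≡ leg j (tip j))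

  end-is-end : ∀ i → IsEnd (end i)
  end-is-end fzero = inj₁ refl
  end-is-end (fsuc i) with view i
  ... | ‵fromℕ = inj₂ (inj₁ refl)
  ... | ‵inject₁ j = inj₂ (inj₂ (j , refl))

  end-covers : ∀ u → IsEnd u → ∃[ i ] end i ≡ u
  end-covers u (inj₁ refl) = fzero , refl
  end-covers u (inj₂ (inj₁ refl)) = fsuc (fromℕ t) , e
    where
      e : end (fsuc (fromℕ t)) ≡ core (fromℕ K)
      e rewrite view-fromℕ t = refl
  end-covers u (inj₂ (inj₂ (j , refl))) = fsuc (inject₁ j) , e
    where
      e : end (fsuc (inject₁ j)) ≡ leg j (tip j)
      e rewrite view-inject₁ j = refl

  core-end-childless : ∀ v → ¬ Up v (core (fromℕ K))
  core-end-childless v x with view-vertex v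
  ... | is-core k = <⇒≱ (toℕ<n k) (≤-reflexive (trans (cong suc (sym (toℕ-fromℕ K))) (to (Up-core-core k (fromℕ K)) x)))
  ... | is-leg j a = <⇒≢ (c-top j) (trans (cong toℕ (proj₂ (to (Up-leg-core (fromℕ K) j a) x))) (toℕ-fromℕ K))

  end-neighbour : ∀ u → IsEnd u → ∀ v v' → TreeAdj u v → TreeAdj u v' → v ≡ v'
  end-neighbour u (inj₁ refl) v v' h h' = trans (first v h) (sym (first v' h'))
    where
      k₁ = fromℕ< (s≤s K-pos)
      first : ∀ v → TreeAdj nothing v → v ≡ core k₁
      first v h with view-vertex v
      ... | is-core k with to (TreeAdj-core-core fzero k) h
      ... | inj₁ e = cong core (toℕ-injective (trans (sym e) (sym (toℕ-fromℕ< (s≤s K-pos)))))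
      ... | inj₂ ()
      first v h | is-leg j a = ⊥-elim (<⇒≢ (c-pos j) (sym (cong toℕ (proj₂ (to (TreeAdj-core-leg fzero j a) h)))))
  end-neighbour u (inj₂ (inj₁ refl)) v v' (inj₁ x) (inj₁ x') = Up-functional (core (fromℕ K)) x x'
  end-neighbour u (inj₂ (inj₁ refl)) v v' (inj₂ x) _ = ⊥-elim (core-end-childless v x)
  end-neighbour u (inj₂ (inj₁ refl)) v v' _ (inj₂ x) = ⊥-elim (core-end-childless v' x)
  end-neighbour u (inj₂ (inj₂ (j , refl))) = tip-neighbour j

  core-neighbours : ∀ k → 0 < toℕ k → toℕ k < K → Σ[ a ∈ Fin (suc K) ] Σ[ b ∈ Fin (suc K) ]
    (TreeAdj (core k) (core a) × TreeAdj (core k) (core b) × core a ≢ core b)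
  core-neighbours (fsuc k) _ lt = inject₁ k , fromℕ< (s≤s lt) , from (TreeAdj-core-core _ _) (inj₂ (cong suc (toℕ-inject₁ k))) ,
    from (TreeAdj-core-core _ _) (inj₁ (sym (toℕ-fromℕ< (s≤s lt)))) ,
    λ e → ℕ.m≢1+m+n (toℕ k) {1} (trans (sym (toℕ-inject₁ k)) (trans (cong toℕ (core-injective _ _ e)) (trans (toℕ-fromℕ< (s≤s lt)) (cong suc (ℕ.+-comm 1 _)))))

  inner-neighbours : ∀ u → IsEnd u ⊎ (Σ[ v ∈ Maybe W ] Σ[ v' ∈ Maybe W ] (TreeAdj u v × TreeAdj u v' × v ≢ v'))
  inner-neighbours u with view-vertex u
  inner-neighbours _ | is-core fzero = inj₁ (inj₁ refl)
  inner-neighbours _ | is-core (fsuc k) with suc (toℕ k) ℕ.≟ K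
  ... | yes e = inj₁ (inj₂ (inj₁ (cong core (toℕ-injective (trans e (sym (toℕ-fromℕ K)))))))
  ... | no ne with core-neighbours (fsuc k) (s≤s z≤n) (≤∧≢⇒< (toℕ<n k) ne)
  ... | a , b , h , h' , a≢b = inj₂ (core a , core b , h , h' , a≢b)
  inner-neighbours _ | is-leg j a with toℕ a ℕ.≟ ℓ j
  ... | yes e = inj₁ (inj₂ (inj₂ (j , cong (leg j) (tip-unique j a e))))
  ... | no ne = inj₂ (inner-leg-neighbours j a ne)

  module CaterpillarOn (X : Graph (suc size)) (adjX : ∀ i j → Adj X i j ⇔ TreeAdj (dec₀ i) (dec₀ j)) where

    open TreeOn X adjX public

    adj-enc⇔ : ∀ u v → Adj X (enc₀ u) (enc₀ v) ⇔ TreeAdj u v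
    adj-enc⇔ u v = mk⇔ (λ h → subst₂ TreeAdj (dec-enc₀ u) (dec-enc₀ v) (to (adjX _ _) h)) adj-enc

    spine : Fin (suc K) → Fin (suc size)
    spine k = enc₀ (core k)

    spine-path : IsPathSeq X spine
    spine-path = (λ i j e → core-injective i j (enc₀-injective _ _ e)) ,
      λ i j → mk⇔ (λ h → to (TreeAdj-core-core i j) (to (adj-enc⇔ _ _) h)) (λ h → adj-enc (from (TreeAdj-core-core i j) h))

    spine-branches : ContainsBranches X spine
    spine-branches v br with dec₀ v in e
    ... | u with view-vertex u
    ... | is-core k = k , trans (cong enc₀ (sym e)) (enc-dec₀ v)
    ... | is-leg j a = ⊥-elim (not-branch-leg j a (subst (Branch X) (trans (sym (enc-dec₀ v)) (cong enc₀ e)) br))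

    end-leaf : ∀ u → IsEnd u → Leaf X (enc₀ u)
    end-leaf u h = leaf u (end-neighbour u h)

    end-simplicial : ∀ u → IsEnd u → Simplicial X (enc₀ u)
    end-simplicial u h = simplicial u (end-neighbour u h)

    leaf-end : ∀ u → Leaf X (enc₀ u) → IsEnd u
    leaf-end u le with inner-neighbours u
    ... | inj₁ h = h
    ... | inj₂ (v , v' , h , h' , ne) = ⊥-elim (not-leaf u v v' h h' ne le)

    simplicial-end : ∀ u → Simplicial X (enc₀ u) → IsEnd u
    simplicial-end u si with inner-neighbours u
    ... | inj₁ h = h
    ... | inj₂ (v , v' , h , h' , ne) = ⊥-elim (not-simplicial u v v' h h' ne si)

    core-degree : ∀ k → deg X (enc₀ (core k)) ≤ 3
    core-degree k = degree≤ (core k) g cov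
      where
        before? : ∀ k' → Dec (suc (toℕ k') ≡ toℕ k)
        before? k' = suc (toℕ k') ℕ.≟ toℕ k
        after? : ∀ k' → Dec (suc (toℕ k) ≡ toℕ k')
        after? k' = suc (toℕ k) ℕ.≟ toℕ k'
        hanging? : ∀ j → Dec (c j ≡ k)
        hanging? j = c j ≟ᶠ k
        g : Fin 3 → Maybe W
        g fzero = pick before? core nothing
        g (fsuc fzero) = pick after? core nothing
        g (fsuc (fsuc _)) = pick hanging? (λ j → leg j fzero) nothing
        cov : ∀ v → TreeAdj (core k) v → ∃[ i ] g i ≡ v
        cov v h with view-vertex v
        cov _ h | is-core k' with to (TreeAdj-core-core k k') h
        ... | inj₁ e = fsuc fzero , pick-unique after? core nothing (λ x y e e' → toℕ-injective (trans (sym e) e')) k' e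
        ... | inj₂ e = fzero , pick-unique before? core nothing (λ x y e e' → toℕ-injective (ℕ.suc-injective (trans e (sym e')))) k' e
        cov _ h | is-leg j a with to (TreeAdj-core-leg k j a) h
        ... | a≡0 , cj≡k = fsuc (fsuc fzero) ,
          trans (pick-unique hanging? (λ j → leg j fzero) nothing (λ x y e e' → c-injective x y (trans e (sym e'))) j cj≡k)
                (cong (leg j) (toℕ-injective (sym a≡0)))

    degree≤3 : ∀ v → deg X v ≤ 3
    degree≤3 v = subst (λ z → deg X z ≤ 3) (enc-dec₀ v) (go (view-vertex (dec₀ v)))
      where
        go : ∀ {u} → View u → deg X (enc₀ u) ≤ 3
        go (is-core k) = core-degree k
        go (is-leg j a) = ≤-trans (ℕ.≮⇒≥ (not-branch-leg j a)) (n≤1+n 2)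

    branch-at-leg : ∀ j → Branch X (enc₀ (core (c j)))
    branch-at-leg j with core-neighbours (c j) (c-pos j) (c-top j)
    ... | a , b , ha , hb , a≢b = branch (core (c j)) (core a) (core b) (leg j fzero) ha hb (from (TreeAdj-core-leg (c j) j fzero) (refl , refl)) a≢b (core≢leg a) (core≢leg b)

    leg-attachment : ∀ j → IsVl X (enc₀ (leg j (tip j))) (enc₀ (core (c j)))
    -- `IsVl` asks for a path that starts at the leaf, while a leg is numbered from the core
    -- outwards; hence the reversal by `opposite`.
    leg-attachment j = branch-at-leg j , suc (ℓ j) , q ∘ opposite , reverse-path X q (q-inj , q-adj) , refl ,
        cong q opposite-last , (λ i → only-branch (opposite i))
      where
        q : Fin (suc (suc (ℓ j))) → Fin (suc size)
        q fzero = enc₀ (core (c j))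
        q (fsuc a) = enc₀ (leg j a)
        opposite-last : opposite (fromℕ (suc (ℓ j))) ≡ fzero
        opposite-last = toℕ-injective (trans (opposite-prop (fromℕ (suc (ℓ j)))) (trans (cong (suc (ℓ j) ∸_) (toℕ-fromℕ (suc (ℓ j)))) (ℕ.n∸n≡0 (suc (ℓ j)))))
        q-inj : ∀ a b → q a ≡ q b → a ≡ b
        q-inj fzero fzero e = refl
        q-inj fzero (fsuc b) e = ⊥-elim (core≢leg (c j) (enc₀-injective _ _ e))
        q-inj (fsuc a) fzero e = ⊥-elim (core≢leg (c j) (sym (enc₀-injective _ _ e)))
        q-inj (fsuc a) (fsuc b) e = cong fsuc (leg-injective j (enc₀-injective _ _ e))
        core-to-leg : ∀ a → Adj X (enc₀ (core (c j))) (enc₀ (leg j a)) ⇔ (toℕ a ≡ 0)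
        core-to-leg a = mk⇔ (λ h → proj₁ (to (TreeAdj-core-leg (c j) j a) (to (adj-enc⇔ _ _) h)))
          (λ e → adj-enc (from (TreeAdj-core-leg (c j) j a) (e , refl)))
        q-adj : ∀ a b → Adj X (q a) (q b) ⇔ (suc (toℕ a) ≡ toℕ b ⊎ suc (toℕ b) ≡ toℕ a)
        q-adj fzero fzero = mk⇔ (λ h → ⊥-elim (Adj-irrefl X h refl)) λ { (inj₁ ()) ; (inj₂ ()) }
        q-adj fzero (fsuc b) = mk⇔ (λ h → inj₁ (cong suc (sym (to (core-to-leg b) h)))) λ { (inj₁ e) → from (core-to-leg b) (sym (ℕ.suc-injective e)) ; (inj₂ ()) }
        q-adj (fsuc a) fzero = mk⇔ (λ h → inj₂ (cong suc (sym (to (core-to-leg a) (Adj-sym X h))))) λ { (inj₁ ()) ; (inj₂ e) → Adj-sym X (from (core-to-leg a) (sym (ℕ.suc-injective e))) }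
        q-adj (fsuc a) (fsuc b) = mk⇔ (λ h → to Consecutive-suc (to (TreeAdj-leg-leg j a b) (to (adj-enc⇔ _ _) h))) (λ h → adj-enc (from (TreeAdj-leg-leg j a b) (from Consecutive-suc h)))
        only-branch : ∀ a → Branch X (q a) → q a ≡ enc₀ (core (c j))
        only-branch fzero _ = refl
        only-branch (fsuc a) br = ⊥-elim (not-branch-leg j a br)

    oneCaterpillar : OneCaterpillar X
    oneCaterpillar = (tree , degree≤3 , suc K , spine , spine-path , spine-branches) ,
        suc (suc t) , (λ i → enc₀ (end i)) , s≤s (s≤s t-pos) ,
        (λ i j e → end-injective i j (enc₀-injective _ _ e)) ,
        (λ i → end-leaf (end i) (end-is-end i)) ,
        (λ v le → let (i , e) = end-covers (dec₀ v) (leaf-end (dec₀ v) (subst (Leaf X) (sym (enc-dec₀ v)) le)) in i , trans (cong enc₀ e) (enc-dec₀ v)) ,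
        suc K , spine , (λ i → spine (spineIndex i)) , (spine-path , spine-branches , maximal) ,
        first , last , middle ,
        s≤s z≤n , spineIndex , spineIndex-mono , (λ _ → refl) , (λ { fzero _ → refl }) , last-index
      where
        -- The maximality lemma speaks of paths with at least two vertices, so `K` is exchanged for
        -- an equal successor.
        maximal : ∀ (k' : ℕ) (q : Fin k' → Fin (suc size)) → IsPathSeq X q → (∀ i → ∃[ j ] q j ≡ spine i) → ∀ j → ∃[ i ] spine i ≡ q j
        maximal = maximal-of K refl K-pos
          where
            maximal-of : ∀ K' → K' ≡ K → 0 < K' → ∀ (k' : ℕ) (q : Fin k' → Fin (suc size)) → IsPathSeq X q → (∀ i → ∃[ j ] q j ≡ spine i) → ∀ j → ∃[ i ] spine i ≡ q j
            maximal-of (suc K') refl _ = leaf-ended-path-maximal X spine spine-path (end-leaf nothing (inj₁ refl)) (end-leaf (core (fromℕ K)) (inj₂ (inj₁ refl)))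
        first : ∀ i → toℕ i ≡ 0 → spine (spineIndex i) ≡ enc₀ (end i)
        first fzero _ = refl
        last : ∀ i → suc (toℕ i) ≡ suc (suc t) → spine (spineIndex i) ≡ enc₀ (end i)
        last (fsuc i) e with view i
        ... | ‵fromℕ = refl
        ... | ‵inject₁ j = ⊥-elim (<⇒≢ (toℕ<n j) (trans (sym (toℕ-inject₁ j)) (ℕ.suc-injective (ℕ.suc-injective e))))
        middle : ∀ i → 0 < toℕ i → suc (toℕ i) < suc (suc t) → IsVl X (enc₀ (end i)) (spine (spineIndex i))
        middle (fsuc i) _ lt with view i
        ... | ‵fromℕ = ⊥-elim (ℕ.<-irrefl (toℕ-fromℕ t) (≤-pred (≤-pred lt)))
        ... | ‵inject₁ j = leg-attachment j
        last-index : ∀ i → suc (toℕ i) ≡ suc (suc t) → suc (toℕ (spineIndex i)) ≡ suc K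
        last-index (fsuc i) e with view i
        ... | ‵fromℕ = cong suc (toℕ-fromℕ K)
        ... | ‵inject₁ j = ⊥-elim (<⇒≢ (toℕ<n j) (trans (sym (toℕ-inject₁ j)) (ℕ.suc-injective (ℕ.suc-injective e))))

-- Induced combs and line graphs of combs

induced : ∀ {m n} → Graph n → (Fin m → Fin n) → Graph m
induced G f = record { adj = λ i j → adj G (f i) (f j) ; sym = λ i j → Graph.sym G (f i) (f j) ; irrefl = λ i → Graph.irrefl G (f i) }

_inS_ : ∀ {n} → Fin n → Subset n → Set
x inS S = Vec.lookup S x ≡ true

lookup-pullback : ∀ {m n} (f : Fin m → Fin n) (S : Subset n) v → Vec.lookup (pullback f S) v ≡ Vec.lookup S (f v)
lookup-pullback f S v = lookup∘tabulate (λ i → Vec.lookup S (f i)) v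

∈-pullback : ∀ {m n} (f : Fin m → Fin n) (S : Subset n) v → (v ∈ pullback f S) ⇔ (f v inS S)
∈-pullback f S v = mk⇔ (λ h → trans (sym (lookup-pullback f S v)) ([]=⇒lookup h))
                       (λ h → lookup⇒[]= v (pullback f S) (trans (lookup-pullback f S v) h))

pullback-card : ∀ {m n} (f : Fin m → Fin n) (S : Subset n) {η} (s : Fin η → Fin m) → (∀ i j → s i ≡ s j → i ≡ j) →
  (∀ v → f v inS S ⇔ (∃[ i ] s i ≡ v)) → ∣ pullback f S ∣ ≡ η
pullback-card f S s inj h = ≤-antisym
  (card≤ (pullback f S) s (λ v hv → to (h v) (trans (sym (lookup-pullback f S v)) hv)))
  (card≥ (pullback f S) s inj (λ i → trans (lookup-pullback f S (s i)) (from (h (s i)) (i , refl))))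

ConnectifierIn : ∀ {n} → Graph n → Subset n → ℕ → Set
ConnectifierIn {n} G S η = Σ[ m ∈ ℕ ] Σ[ H ∈ Graph m ] Σ[ f ∈ (Fin m → Fin n) ]
  (InducedEmbedding H G f × Connectifier H (pullback f S) η × Connected H × ∣ pullback f S ∣ ≡ η
  × (∀ v → v ∈ pullback f S → deg H v ≤ η))

record InducedComb {n} (G : Graph n) (K t : ℕ) (ℓ : Fin t → ℕ) (c : Fin t → Fin (suc K)) : Set where
  field
    p      : Fin (suc K) → Fin n
    q      : (j : Fin t) → Fin (suc (ℓ j)) → Fin n
    p-path : IsPathSeq G p
    q-path : ∀ j → IsPathSeq G (q j)
    p≢q    : ∀ k j a → p k ≢ q j a
    p-q    : ∀ k j a → Adj G (p k) (q j a) ⇔ (toℕ a ≡ 0 × c j ≡ k)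
    q≢q    : ∀ j j' a a' → j ≢ j' → q j a ≢ q j' a'
    q-q    : ∀ j j' a a' → j ≢ j' → ¬ Adj G (q j a) (q j' a')

  open CombTree K t ℓ c

  φ : Maybe W → Fin n
  φ nothing = p fzero
  φ (just (cr k)) = p (fsuc k)
  φ (just (lg j a)) = q j a

  φ-core : ∀ k → φ (core k) ≡ p k
  φ-core fzero = refl
  φ-core (fsuc k) = refl

  φ-injective : ∀ u v → φ u ≡ φ v → u ≡ v
  φ-injective u v e with view-vertex u | view-vertex v
  ... | is-core k | is-core k' = cong core (proj₁ p-path k k' (trans (sym (φ-core k)) (trans e (φ-core k'))))
  ... | is-core k | is-leg j a = ⊥-elim (p≢q k j a (trans (sym (φ-core k)) e))
  ... | is-leg j a | is-core k = ⊥-elim (p≢q k j a (trans (sym (φ-core k)) (sym e)))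
  ... | is-leg j a | is-leg j' a' with j ≟ᶠ j'
  ... | yes refl = cong (leg j) (proj₁ (q-path j) a a' e)
  ... | no ne = ⊥-elim (q≢q j j' a a' ne e)

  φ-adj : ∀ u v → Adj G (φ u) (φ v) ⇔ TreeAdj u v
  φ-adj u v with view-vertex u | view-vertex v
  ... | is-core k | is-core k' = mk⇔
    (λ h → from (TreeAdj-core-core k k') (to (proj₂ p-path k k') (subst₂ (Adj G) (φ-core k) (φ-core k') h)))
    (λ h → subst₂ (Adj G) (sym (φ-core k)) (sym (φ-core k')) (from (proj₂ p-path k k') (to (TreeAdj-core-core k k') h)))
  ... | is-core k | is-leg j a = mk⇔
    (λ h → from (TreeAdj-core-leg k j a) (to (p-q k j a) (subst (λ z → Adj G z (q j a)) (φ-core k) h)))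
    (λ h → subst (λ z → Adj G z (q j a)) (sym (φ-core k)) (from (p-q k j a) (to (TreeAdj-core-leg k j a) h)))
  ... | is-leg j a | is-core k = mk⇔
    (λ h → TreeAdj-sym {core k} {leg j a} (from (TreeAdj-core-leg k j a) (to (p-q k j a) (subst (λ z → Adj G z (q j a)) (φ-core k) (Adj-sym G h)))))
    (λ h → Adj-sym G (subst (λ z → Adj G z (q j a)) (sym (φ-core k)) (from (p-q k j a) (to (TreeAdj-core-leg k j a) (TreeAdj-sym {leg j a} {core k} h)))))
  ... | is-leg j a | is-leg j' a' with j ≟ᶠ j'
  ... | yes refl = mk⇔ (λ h → from (TreeAdj-leg-leg j a a') (to (proj₂ (q-path j) a a') h))
                       (λ h → from (proj₂ (q-path j) a a') (to (TreeAdj-leg-leg j a a') h))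
  ... | no ne = mk⇔ (λ h → ⊥-elim (q-q j j' a a' ne h)) (λ h → ⊥-elim (TreeAdj-other-leg j a j' a' ne h))

  f : Fin (suc size) → Fin n
  f i = φ (dec₀ i)

  f-injective : ∀ i j → f i ≡ f j → i ≡ j
  f-injective i j e = dec₀-injective i j (φ-injective _ _ e)

  H : Graph (suc size)
  H = induced G f

  H-adj : ∀ i j → Adj H i j ⇔ TreeAdj (dec₀ i) (dec₀ j)
  H-adj i j = φ-adj (dec₀ i) (dec₀ j)

-- Here vertices of `G` play the part of tree edges. The vertex `p k` is the core edge between core
-- vertices `inject₁ k` and `fsuc k`, so a leg hanging at `c j` touches the core edges on both sides
-- of `c j`. First edges of two legs meet exactly when the legs hang at the same core vertex, as at
-- the centre of a star.
record InducedLineComb {n} (G : Graph n) (K t : ℕ) (ℓ : Fin t → ℕ) (c : Fin t → Fin (suc K)) : Set where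
  field
    p      : Fin K → Fin n
    q      : (j : Fin t) → Fin (suc (ℓ j)) → Fin n
    p-path : IsPathSeq G p
    q-path : ∀ j → IsPathSeq G (q j)
    p≢q    : ∀ k j a → p k ≢ q j a
    p-q    : ∀ k j a → Adj G (p k) (q j a) ⇔ (toℕ a ≡ 0 × (c j ≡ inject₁ k ⊎ c j ≡ fsuc k))
    q≢q    : ∀ j j' a a' → j ≢ j' → q j a ≢ q j' a'
    q-q    : ∀ j j' a a' → j ≢ j' → Adj G (q j a) (q j' a') ⇔ (toℕ a ≡ 0 × toℕ a' ≡ 0 × c j ≡ c j')

  open CombTree K t ℓ c

  φ : W → Fin n
  φ (cr k) = p k
  φ (lg j a) = q j a

  φ-injective : ∀ u v → φ u ≡ φ v → u ≡ v
  φ-injective (cr k) (cr k') e = cong cr (proj₁ p-path k k' e)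
  φ-injective (cr k) (lg j a) e = ⊥-elim (p≢q k j a e)
  φ-injective (lg j a) (cr k) e = ⊥-elim (p≢q k j a (sym e))
  φ-injective (lg j a) (lg j' a') e with j ≟ᶠ j'
  ... | yes refl = cong (lg j) (proj₁ (q-path j) a a' e)
  ... | no ne = ⊥-elim (q≢q j j' a a' ne e)

  LineAdj-sym : ∀ {u v} → LineAdj u v → LineAdj v u
  LineAdj-sym (ne , inj₁ e) = ne ∘ sym , inj₁ (sym e)
  LineAdj-sym (ne , inj₂ (inj₁ e)) = ne ∘ sym , inj₂ (inj₂ (sym e))
  LineAdj-sym (ne , inj₂ (inj₂ e)) = ne ∘ sym , inj₂ (inj₁ (sym e))

  LineAdj-core-core : ∀ k k' → LineAdj (cr k) (cr k') ⇔ Consecutive (toℕ k) (toℕ k')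
  LineAdj-core-core k k' = mk⇔ fwd bwd
    where
      inject₁-suc : ∀ {k k' : Fin K} → inject₁ k ≡ fsuc k' → suc (toℕ k') ≡ toℕ k
      inject₁-suc {k} e = trans (sym (cong toℕ e)) (toℕ-inject₁ k)
      suc-inject₁ : ∀ {k k' : Fin K} → suc (toℕ k') ≡ toℕ k → inject₁ k ≡ fsuc k'
      suc-inject₁ {k} e = toℕ-injective (trans (toℕ-inject₁ k) (sym e))
      fwd : LineAdj (cr k) (cr k') → Consecutive (toℕ k) (toℕ k')
      fwd (ne , inj₁ e) = ⊥-elim (ne (cong cr (toℕ-injective (trans (sym (toℕ-inject₁ k)) (trans (cong toℕ (core-injective _ _ e)) (toℕ-inject₁ k'))))))
      fwd (ne , inj₂ (inj₁ e)) = inj₂ (inject₁-suc (core-injective (inject₁ k) (fsuc k') e))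
      fwd (ne , inj₂ (inj₂ e)) = inj₁ (inject₁-suc (core-injective (inject₁ k') (fsuc k) (sym e)))
      bwd : Consecutive (toℕ k) (toℕ k') → LineAdj (cr k) (cr k')
      bwd (inj₁ e) = (λ { refl → 1+n≢n e }) , inj₂ (inj₂ (sym (cong core (suc-inject₁ e))))
      bwd (inj₂ e) = (λ { refl → 1+n≢n e }) , inj₂ (inj₁ (cong core (suc-inject₁ e)))

  LineAdj-core-leg : ∀ k j a → LineAdj (cr k) (lg j a) ⇔ (toℕ a ≡ 0 × (c j ≡ inject₁ k ⊎ c j ≡ fsuc k))
  LineAdj-core-leg k j fzero = mk⇔
    (λ { (ne , inj₁ e) → refl , inj₁ (sym (core-injective _ _ e))
       ; (ne , inj₂ (inj₁ e)) → ⊥-elim (core≢leg (inject₁ k) e)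
       ; (ne , inj₂ (inj₂ e)) → refl , inj₂ (sym (core-injective (fsuc k) (c j) e)) })
    (λ { (_ , inj₁ e) → (λ ()) , inj₁ (cong core (sym e)) ; (_ , inj₂ e) → (λ ()) , inj₂ (inj₂ (cong core (sym e))) })
  LineAdj-core-leg k j (fsuc a) = mk⇔
    (λ { (ne , inj₁ e) → ⊥-elim (core≢leg (inject₁ k) e)
       ; (ne , inj₂ (inj₁ e)) → ⊥-elim (core≢leg (inject₁ k) e)
       ; (ne , inj₂ (inj₂ e)) → ⊥-elim (core≢leg (fsuc k) e) })
    (λ ())

  LineAdj-leg-leg : ∀ j a a' → LineAdj (lg j a) (lg j a') ⇔ Consecutive (toℕ a) (toℕ a')
  LineAdj-leg-leg j a a' = mk⇔ fwd bwd
    where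
      same : ∀ a a' → par (lg j a) ≡ par (lg j a') → a ≡ a'
      same fzero fzero e = refl
      same fzero (fsuc a') e = ⊥-elim (core≢leg (c j) e)
      same (fsuc a) fzero e = ⊥-elim (core≢leg (c j) (sym e))
      same (fsuc a) (fsuc a') e = cong fsuc (toℕ-injective (trans (sym (toℕ-inject₁ a)) (trans (cong toℕ (leg-injective j e)) (toℕ-inject₁ a'))))
      fwd : LineAdj (lg j a) (lg j a') → Consecutive (toℕ a) (toℕ a')
      fwd (ne , inj₁ e) = ⊥-elim (ne (cong (lg j) (same a a' e)))
      fwd (ne , inj₂ (inj₁ e)) = inj₂ (to (Up-leg-leg j a a') e)
      fwd (ne , inj₂ (inj₂ e)) = inj₁ (to (Up-leg-leg j a' a) (sym e))
      bwd : Consecutive (toℕ a) (toℕ a') → LineAdj (lg j a) (lg j a')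
      bwd (inj₁ e) = (λ { refl → 1+n≢n e }) , inj₂ (inj₂ (sym (from (Up-leg-leg j a' a) e)))
      bwd (inj₂ e) = (λ { refl → 1+n≢n e }) , inj₂ (inj₁ (from (Up-leg-leg j a a') e))

  LineAdj-other-leg : ∀ j j' a a' → j ≢ j' → LineAdj (lg j a) (lg j' a') ⇔ (toℕ a ≡ 0 × toℕ a' ≡ 0 × c j ≡ c j')
  LineAdj-other-leg j j' a a' ne = mk⇔ (λ (_ , h) → fwd a a' h) (bwd a a')
    where
      fwd : ∀ a a' → par (lg j a) ≡ par (lg j' a') ⊎ par (lg j a) ≡ leg j' a' ⊎ leg j a ≡ par (lg j' a') → toℕ a ≡ 0 × toℕ a' ≡ 0 × c j ≡ c j'
      fwd a a' (inj₂ (inj₁ e)) = ⊥-elim (Up-other-leg j a j' a' ne e)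
      fwd a a' (inj₂ (inj₂ e)) = ⊥-elim (Up-other-leg j' a' j a (ne ∘ sym) (sym e))
      fwd fzero fzero (inj₁ e) = refl , refl , core-injective _ _ e
      fwd fzero (fsuc a') (inj₁ e) = ⊥-elim (core≢leg (c j) e)
      fwd (fsuc a) fzero (inj₁ e) = ⊥-elim (core≢leg (c j') (sym e))
      fwd (fsuc a) (fsuc a') (inj₁ e) = ⊥-elim (Up-other-leg j (fsuc a) j' (inject₁ a') ne e)
      bwd : ∀ a a' → toℕ a ≡ 0 × toℕ a' ≡ 0 × c j ≡ c j' → LineAdj (lg j a) (lg j' a')
      bwd fzero fzero (_ , _ , e) = (λ { refl → ne refl }) , inj₁ (cong core e)

  φ-adj : ∀ u v → Adj G (φ u) (φ v) ⇔ LineAdj u v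
  φ-adj (cr k) (cr k') = mk⇔ (λ h → from (LineAdj-core-core k k') (to (proj₂ p-path k k') h)) (λ h → from (proj₂ p-path k k') (to (LineAdj-core-core k k') h))
  φ-adj (cr k) (lg j a) = mk⇔ (λ h → from (LineAdj-core-leg k j a) (to (p-q k j a) h)) (λ h → from (p-q k j a) (to (LineAdj-core-leg k j a) h))
  φ-adj (lg j a) (cr k) = mk⇔ (λ h → LineAdj-sym (from (LineAdj-core-leg k j a) (to (p-q k j a) (Adj-sym G h)))) (λ h → Adj-sym G (from (p-q k j a) (to (LineAdj-core-leg k j a) (LineAdj-sym h))))
  φ-adj (lg j a) (lg j' a') with j ≟ᶠ j'
  ... | yes refl = mk⇔ (λ h → from (LineAdj-leg-leg j a a') (to (proj₂ (q-path j) a a') h)) (λ h → from (proj₂ (q-path j) a a') (to (LineAdj-leg-leg j a a') h))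
  ... | no ne = mk⇔ (λ h → from (LineAdj-other-leg j j' a a' ne) (to (q-q j j' a a' ne) h)) (λ h → from (q-q j j' a a' ne) (to (LineAdj-other-leg j j' a a' ne) h))

  f : Fin size → Fin n
  f i = φ (dec i)

  f-injective : ∀ i j → f i ≡ f j → i ≡ j
  f-injective i j e = dec-injective i j (φ-injective _ _ e)

  H : Graph size
  H = induced G f

  H-adj : ∀ i j → Adj H i j ⇔ LineAdj (dec i) (dec j)
  H-adj i j = φ-adj (dec i) (dec j)

-- Connectifiers from paths, caterpillars and stars

module PathConnectifier {n} (G : Graph n) (S : Subset n) {k η : ℕ} (p : Fin (suc k) → Fin n) (p-path : IsPathSeq G p)
  (s : Fin η → Fin (suc k)) (η-pos : 1 ≤ η) (s-mono : ∀ a b → toℕ a < toℕ b → toℕ (s a) < toℕ (s b))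
  (s-first : ∀ a → toℕ a ≡ 0 → toℕ (s a) ≡ 0) (s-last : ∀ a → suc (toℕ a) ≡ η → suc (toℕ (s a)) ≡ suc k)
  (p-S : ∀ i → p i inS S ⇔ (∃[ a ] s a ≡ i)) where

  H : Graph (suc k)
  H = induced G p

  H-adj : ∀ i j → Adj H i j ⇔ Consecutive (toℕ i) (toℕ j)
  H-adj i j = proj₂ p-path i j

  s-injective : ∀ a b → s a ≡ s b → a ≡ b
  s-injective = strictly-monotone-injective s s-mono

  walk-to-first : ∀ d i → toℕ i ≤ d → Walk H i fzero
  walk-to-first d fzero _ = here
  walk-to-first (suc d) (fsuc i) (s≤s le) = step (from (H-adj (fsuc i) (inject₁ i)) (inj₂ (cong suc (toℕ-inject₁ i))))
    (walk-to-first d (inject₁ i) (subst (_≤ d) (sym (toℕ-inject₁ i)) le))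

  connected : Connected H
  connected i j = walk-++ (walk-to-first _ i ≤-refl) (walk-reverse (walk-to-first _ j ≤-refl))

  simplicial-in-S : ∀ i → Simplicial H i → p i inS S
  simplicial-in-S fzero si = from (p-S fzero) (fromℕ< η-pos , toℕ-injective (s-first _ (toℕ-fromℕ< η-pos)))
  simplicial-in-S (fsuc i) si with suc (toℕ i) ℕ.≟ k
  ... | yes e = from (p-S (fsuc i)) (a , toℕ-injective (ℕ.suc-injective (trans (s-last a a-last) (cong suc (sym e)))))
    where
      top : ∀ η → 1 ≤ η → Σ[ a ∈ Fin η ] suc (toℕ a) ≡ η
      top (suc η) _ = fromℕ η , cong suc (toℕ-fromℕ η)
      a = proj₁ (top η η-pos)
      a-last = proj₂ (top η η-pos)
  ... | no ne = ⊥-elim (not-adj (to (H-adj _ _) (si (inject₁ i) i⁺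
      (from (H-adj _ _) (inj₂ (cong suc (toℕ-inject₁ i)))) (from (H-adj _ _) (inj₁ (sym i⁺-val)))
      (λ e → ℕ.m≢1+m+n (toℕ i) {1} (trans (sym (toℕ-inject₁ i)) (trans (cong toℕ e) (trans i⁺-val (cong suc (ℕ.+-comm 1 _)))))))))
    where
      lt : suc (suc (toℕ i)) < suc k
      lt = s≤s (≤∧≢⇒< (toℕ<n i) ne)
      i⁺ = fromℕ< lt
      i⁺-val : toℕ i⁺ ≡ suc (suc (toℕ i))
      i⁺-val = toℕ-fromℕ< lt
      not-adj : Consecutive (toℕ (inject₁ i)) (toℕ i⁺) → ⊥
      not-adj (inj₁ e) = 1+n≢n (sym (ℕ.suc-injective (trans (cong suc (sym (toℕ-inject₁ i))) (trans e i⁺-val))))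
      not-adj (inj₂ e) = ℕ.m≢1+m+n (toℕ i) {2} (trans (sym (toℕ-inject₁ i)) (trans (sym e) (trans (cong suc i⁺-val) (cong suc (ℕ.+-comm 2 _)))))

  degree≤2 : ∀ i → deg H i ≤ 2
  degree≤2 i = deg≤ H i g cov
    where
      before? : ∀ j → Dec (suc (toℕ j) ≡ toℕ i)
      before? j = suc (toℕ j) ℕ.≟ toℕ i
      after? : ∀ j → Dec (suc (toℕ i) ≡ toℕ j)
      after? j = suc (toℕ i) ℕ.≟ toℕ j
      g : Fin 2 → Fin (suc k)
      g fzero = pick before? id fzero
      g (fsuc _) = pick after? id fzero
      cov : ∀ j → Adj H i j → ∃[ a ] g a ≡ j
      cov j h with to (H-adj i j) h
      ... | inj₁ e = fsuc fzero , pick-unique after? id fzero (λ x y e e' → toℕ-injective (trans (sym e) e')) j e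
      ... | inj₂ e = fzero , pick-unique before? id fzero (λ x y e e' → toℕ-injective (ℕ.suc-injective (trans e (sym e')))) j e

  -- The bound two fails to suffice only for `η = 1`. Then the single marked position is both first
  -- and last, and the path is one vertex.
  degree≤η : ∀ i → deg H i ≤ η
  degree≤η i with 2 ≤? η
  ... | yes le = ≤-trans (degree≤2 i) le
  ... | no nle = ≤-trans (deg≤1 H i (λ x y _ _ → trans (only x) (sym (only y)))) η-pos
    where
      η≡1 : η ≡ 1
      η≡1 = ≤-antisym (≤-pred (≰⇒> nle)) η-pos
      a = fromℕ< η-pos
      k≡0 : suc k ≡ 1
      k≡0 = trans (sym (s-last a (trans (cong suc (toℕ-fromℕ< η-pos)) (sym η≡1)))) (cong suc (s-first a (toℕ-fromℕ< η-pos)))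
      only : ∀ (x : Fin (suc k)) → x ≡ fzero
      only x = toℕ-injective (ℕ.n≤0⇒n≡0 (≤-pred (≤-trans (toℕ<n x) (≤-reflexive k≡0))))

  card : ∣ pullback p S ∣ ≡ η
  card = pullback-card p S s s-injective p-S

  connectifier : ConnectifierIn G S η
  connectifier = suc k , H , p , (proj₁ p-path , λ _ _ → refl) ,
    inj₂ (inj₂ (inj₁ (((λ v si → from (∈-pullback p S v) (simplicial-in-S v si)) , card) ,
      suc k , id , s , (((λ _ _ e → e) , H-adj) , λ v → v , refl) ,
      (λ v → mk⇔ (λ h → to (p-S v) (to (∈-pullback p S v) h)) (λ h → from (∈-pullback p S v) (from (p-S v) h))) ,
      η-pos , s , s-mono , (λ _ → refl) , s-first , s-last))) ,
    connected , card , λ v _ → degree≤η v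

module CaterpillarConnectifier {n} (G : Graph n) (S : Subset n) (K t : ℕ) (ℓ : Fin t → ℕ) (c : Fin t → Fin (suc K))
  (c-mono : ∀ j j' → toℕ j < toℕ j' → toℕ (c j) < toℕ (c j'))
  (c-pos : ∀ j → 0 < toℕ (c j)) (c-top : ∀ j → toℕ (c j) < K) (t-pos : 0 < t) (comb : InducedComb G K t ℓ c)
  (p-S : ∀ k → InducedComb.p comb k inS S ⇔ (toℕ k ≡ 0 ⊎ toℕ k ≡ K))
  (q-S : ∀ j a → InducedComb.q comb j a inS S ⇔ (toℕ a ≡ ℓ j)) where

  open InducedComb comb
  open CaterpillarTree K t ℓ c c-mono c-pos c-top t-pos
  open CaterpillarOn H H-adj

  φ-S : ∀ u → φ u inS S ⇔ IsEnd u
  φ-S u with view-vertex u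
  φ-S _ | is-core k = mk⇔ (λ h → fwd (to (p-S k) (subst (_inS S) (φ-core k) h))) (λ h → subst (_inS S) (sym (φ-core k)) (from (p-S k) (bwd h)))
    where
      fwd : toℕ k ≡ 0 ⊎ toℕ k ≡ K → IsEnd (core k)
      fwd (inj₁ e) = inj₁ (cong core (toℕ-injective {i = k} {j = fzero} e))
      fwd (inj₂ e) = inj₂ (inj₁ (cong core (toℕ-injective (trans e (sym (toℕ-fromℕ K))))))
      bwd : IsEnd (core k) → toℕ k ≡ 0 ⊎ toℕ k ≡ K
      bwd (inj₁ e) = inj₁ (cong toℕ (core-injective k fzero e))
      bwd (inj₂ (inj₁ e)) = inj₂ (trans (cong toℕ (core-injective k _ e)) (toℕ-fromℕ K))
      bwd (inj₂ (inj₂ (j , e))) = ⊥-elim (core≢leg k e)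
  φ-S _ | is-leg j a = mk⇔ (λ h → inj₂ (inj₂ (j , cong (leg j) (tip-unique j a (to (q-S j a) h))))) (λ h → from (q-S j a) (bwd h))
    where
      bwd : IsEnd (leg j a) → toℕ a ≡ ℓ j
      bwd (inj₂ (inj₁ e)) = ⊥-elim (core≢leg _ (sym e))
      bwd (inj₂ (inj₂ (j , refl))) = toℕ-fromℕ (ℓ j)

  enc-end : ∀ v → IsEnd (dec₀ v) ⇔ (∃[ i ] enc₀ (end i) ≡ v)
  enc-end v = mk⇔ (λ h → let (i , e) = end-covers (dec₀ v) h in i , trans (cong enc₀ e) (enc-dec₀ v))
    (λ { (i , refl) → subst IsEnd (sym (dec-enc₀ (end i))) (end-is-end i) })

  card : ∣ pullback f S ∣ ≡ suc (suc t)
  card = pullback-card f S (λ i → enc₀ (end i)) (λ i j e → end-injective i j (enc₀-injective _ _ e))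
    (λ v → mk⇔ (λ h → to (enc-end v) (to (φ-S (dec₀ v)) h)) (λ h → from (φ-S (dec₀ v)) (from (enc-end v) h)))

  connectifier : ConnectifierIn G S (suc (suc t))
  connectifier = suc size , H , f , (f-injective , λ _ _ → refl) ,
    inj₂ (inj₂ (inj₂ (inj₁ (((λ v → mk⇔
      (λ si → from (∈-pullback f S v) (from (φ-S (dec₀ v)) (simplicial-end (dec₀ v) (subst (Simplicial H) (sym (enc-dec₀ v)) si))))
      (λ h → subst (Simplicial H) (enc-dec₀ v) (end-simplicial (dec₀ v) (to (φ-S (dec₀ v)) (to (∈-pullback f S v) h))))) , card) ,
      oneCaterpillar)))) ,
    connected , card ,
    λ v h → ≤-trans (subst (Leaf H) (enc-dec₀ v) (end-leaf (dec₀ v) (to (φ-S (dec₀ v)) (to (∈-pullback f S v) h)))) (s≤s z≤n)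

-- A star is a comb whose core is the root alone. Two legs prevent the root from being a leaf, which
-- makes all stems positive, and from being simplicial.
module StarTree (t : ℕ) (ℓ : Fin t → ℕ) (t≥2 : 2 ≤ t) where

  open CombTree 0 t ℓ (λ _ → fzero) public

  leg₀ leg₁ : Fin t
  leg₀ = fromℕ< (≤-trans (s≤s z≤n) t≥2)
  leg₁ = fromℕ< t≥2

  leg₀≢leg₁ : leg₀ ≢ leg₁
  leg₀≢leg₁ e with trans (sym (toℕ-fromℕ< (≤-trans (s≤s z≤n) t≥2))) (trans (cong toℕ e) (toℕ-fromℕ< t≥2))
  ... | ()

  leg-top≢ : ∀ {j j'} → j ≢ j' → leg j fzero ≢ leg j' fzero
  leg-top≢ ne refl = ne refl

  root-adj : ∀ j → TreeAdj nothing (leg j fzero)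
  root-adj j = from (TreeAdj-core-leg fzero j fzero) (refl , refl)

  inner-neighbours : ∀ u → (Σ[ j ∈ Fin t ] u ≡ leg j (tip j)) ⊎ (Σ[ v ∈ Maybe W ] Σ[ v' ∈ Maybe W ] (TreeAdj u v × TreeAdj u v' × v ≢ v'))
  inner-neighbours u with view-vertex u
  inner-neighbours _ | is-core fzero = inj₂ (leg leg₀ fzero , leg leg₁ fzero , root-adj leg₀ , root-adj leg₁ , leg-top≢ leg₀≢leg₁)
  inner-neighbours _ | is-leg j a with toℕ a ℕ.≟ ℓ j
  ... | yes e = inj₁ (j , cong (leg j) (tip-unique j a e))
  ... | no ne = inj₂ (inner-leg-neighbours j a ne)

  module StarOn (X : Graph (suc size)) (adjX : ∀ i j → Adj X i j ⇔ TreeAdj (dec₀ i) (dec₀ j)) where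

    open TreeOn X adjX public

    tip-leaf : ∀ j → Leaf X (enc₀ (leg j (tip j)))
    tip-leaf j = leaf (leg j (tip j)) (tip-neighbour j)

    branch-root : ∀ v → Branch X v → v ≡ fzero
    branch-root v br = trans (sym (enc-dec₀ v)) (go (view-vertex (dec₀ v)) (subst (Branch X) (sym (enc-dec₀ v)) br))
      where
        go : ∀ {u} → View u → Branch X (enc₀ u) → enc₀ u ≡ fzero
        go (is-core fzero) _ = refl
        go (is-leg j a) br = ⊥-elim (not-branch-leg j a br)

    stems-positive : StemsPositive X fzero
    stems-positive l le refl = not-leaf nothing (leg leg₀ fzero) (leg leg₁ fzero) (root-adj leg₀) (root-adj leg₁) (leg-top≢ leg₀≢leg₁) le

    root-degree : deg X fzero ≤ t
    root-degree = degree≤ nothing (λ j → leg j fzero) cov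
      where
        cov : ∀ v → TreeAdj nothing v → ∃[ j ] leg j fzero ≡ v
        cov v h with view-vertex v
        cov _ h | is-core fzero with to (TreeAdj-core-core fzero fzero) h
        ... | inj₁ ()
        ... | inj₂ ()
        cov _ h | is-leg j a = j , cong (leg j) (toℕ-injective (sym (proj₁ (to (TreeAdj-core-leg fzero j a) h))))

module StarConnectifier {n} (G : Graph n) (S : Subset n) (t : ℕ) (ℓ : Fin t → ℕ) (t≥2 : 2 ≤ t)
  (comb : InducedComb G 0 t ℓ (λ _ → fzero))
  (q-S : ∀ j a → InducedComb.q comb j a inS S ⇔ (toℕ a ≡ ℓ j)) where

  open InducedComb comb
  open StarTree t ℓ t≥2
  open StarOn H H-adj

  φ-S-tip : ∀ u → (Σ[ j ∈ Fin t ] u ≡ leg j (tip j)) → φ u inS S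
  φ-S-tip u (j , refl) = from (q-S j (tip j)) (toℕ-fromℕ (ℓ j))

  simplicial-in-S : ∀ v → Simplicial H v → v ∈ pullback f S
  simplicial-in-S v si with inner-neighbours (dec₀ v)
  ... | inj₁ tp = from (∈-pullback f S v) (φ-S-tip (dec₀ v) tp)
  ... | inj₂ (x , y , hx , hy , ne) = ⊥-elim (not-simplicial (dec₀ v) x y hx hy ne (subst (Simplicial H) (sym (enc-dec₀ v)) si))

  S-tip-or-root : ∀ u → φ u inS S → (Σ[ j ∈ Fin t ] u ≡ leg j (tip j)) ⊎ u ≡ nothing
  S-tip-or-root u h with view-vertex u
  S-tip-or-root _ h | is-core fzero = inj₂ refl
  S-tip-or-root _ h | is-leg j a = inj₁ (j , cong (leg j) (tip-unique j a (to (q-S j a) h)))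

  S-leaf-or-root : ∀ v → v ∈ pullback f S → Leaf H v ⊎ v ≡ fzero
  S-leaf-or-root v h with S-tip-or-root (dec₀ v) (to (∈-pullback f S v) h)
  ... | inj₁ (j , e) = inj₁ (subst (Leaf H) (trans (cong enc₀ (sym e)) (enc-dec₀ v)) (tip-leaf j))
  ... | inj₂ e = inj₂ (trans (sym (enc-dec₀ v)) (cong enc₀ e))

  -- Type 1 tolerates a vertex of `S` at the root, so the number of vertices in `S` is `t` or
  -- `t + 1`, according to the root.
  from-card : ∀ η → t ≤ η → ∣ pullback f S ∣ ≡ η → ConnectifierIn G S η
  from-card η t≤η card = suc size , H , f , (f-injective , λ _ _ → refl) ,
      inj₂ (inj₁ ((simplicial-in-S , card) , fzero , (tree , branch-root) , stems-positive , S-leaf-or-root)) ,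
      connected , card , bound
    where
      bound : ∀ v → v ∈ pullback f S → deg H v ≤ η
      bound v h with S-leaf-or-root v h
      ... | inj₁ le = ≤-trans le (≤-trans (≤-trans (s≤s z≤n) t≥2) t≤η)
      ... | inj₂ refl = ≤-trans root-degree t≤η

  tip-vertex : Fin t → Fin (suc size)
  tip-vertex j = enc₀ (leg j (tip j))

  tip-vertex-injective : ∀ j j' → tip-vertex j ≡ tip-vertex j' → j ≡ j'
  tip-vertex-injective j j' e = lg-injective (just-injective (enc₀-injective (leg j (tip j)) (leg j' (tip j')) e))

  tip-vertex-S : ∀ j → f (tip-vertex j) inS S
  tip-vertex-S j = subst (λ z → φ z inS S) (sym (dec-enc₀ (leg j (tip j)))) (φ-S-tip _ (j , refl))

  connectifier : ¬ (p fzero inS S) → ConnectifierIn G S t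
  connectifier root∉S = from-card t ≤-refl (pullback-card f S tip-vertex tip-vertex-injective (λ v → mk⇔ (fwd v) (λ { (j , refl) → tip-vertex-S j })))
    where
      fwd : ∀ v → f v inS S → ∃[ j ] tip-vertex j ≡ v
      fwd v h with S-tip-or-root (dec₀ v) h
      ... | inj₁ (j , e) = j , trans (cong enc₀ (sym e)) (enc-dec₀ v)
      ... | inj₂ e = ⊥-elim (root∉S (subst (λ z → φ z inS S) e h))

  connectifier-root : p fzero inS S → ConnectifierIn G S (suc t)
  connectifier-root root∈S = from-card (suc t) (n≤1+n t) (pullback-card f S s s-inj (λ v → mk⇔ (fwd v) (bwd v)))
    where
      s : Fin (suc t) → Fin (suc size)
      s fzero = fzero
      s (fsuc j) = tip-vertex j
      s-inj : ∀ i j → s i ≡ s j → i ≡ j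
      s-inj fzero fzero e = refl
      s-inj (fsuc i) (fsuc j) e = cong fsuc (tip-vertex-injective i j e)
      fwd : ∀ v → f v inS S → ∃[ j ] s j ≡ v
      fwd v h with S-tip-or-root (dec₀ v) h
      ... | inj₁ (j , e) = fsuc j , trans (cong enc₀ (sym e)) (enc-dec₀ v)
      ... | inj₂ e = fzero , sym (trans (sym (enc-dec₀ v)) (cong enc₀ e))
      bwd : ∀ v → ∃[ j ] s j ≡ v → f v inS S
      bwd v (fzero , refl) = root∈S
      bwd v (fsuc j , refl) = tip-vertex-S j

-- Connectifiers from line graphs

module LineStarConnectifier {n} (G : Graph n) (S : Subset n) (t : ℕ) (ℓ : Fin t → ℕ) (t≥2 : 2 ≤ t)
  (comb : InducedLineComb G 0 t ℓ (λ _ → fzero))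
  (q-S : ∀ j a → InducedLineComb.q comb j a inS S ⇔ (toℕ a ≡ ℓ j)) where

  open InducedLineComb comb
  open StarTree t ℓ t≥2
  open IsLineGraph H H-adj
  private module T = StarOn treeGraph treeGraph-adj

  IsTip : W → Set
  IsTip u = Σ[ j ∈ Fin t ] u ≡ lg j (tip j)

  φ-S : ∀ u → φ u inS S ⇔ IsTip u
  φ-S (lg j a) = mk⇔ (λ h → j , cong (lg j) (tip-unique j a (to (q-S j a) h))) (λ { (j , refl) → from (q-S j (tip j)) (toℕ-fromℕ (ℓ j)) })

  tip-simplicial : ∀ u → IsTip u → Simplicial H (enc u)
  tip-simplicial u (j , refl) = childless-simplicial u (λ w → tip-childless j (just w))

  -- For a leg with at least two edges, the first edge of another leg is the neighbour at the root
  -- end that shows that its first edge is not simplicial.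
  other-leg : ∀ j → Σ[ j' ∈ Fin t ] j ≢ j'
  other-leg j with j ≟ᶠ leg₀
  ... | yes refl = leg₁ , leg₀≢leg₁
  ... | no ne = leg₀ , ne

  simplicial-tip : ∀ u → Simplicial H (enc u) → IsTip u
  simplicial-tip (lg j a) si with toℕ a ℕ.≟ ℓ j
  ... | yes e = j , cong (lg j) (tip-unique j a e)
  ... | no ne = ⊥-elim (not-simplicial a (from (Up-leg-leg j a' a) (sym (proj₂ (next-leg j a ne)))) si)
    where
      a' = proj₁ (next-leg j a ne)
      not-simplicial : ∀ a → par (lg j a') ≡ leg j a → ¬ Simplicial H (enc (lg j a))
      not-simplicial fzero child = two-sided-not-simplicial (lg j fzero) (lg j a') (lg (proj₁ (other-leg j)) fzero) child
        (λ e → proj₂ (other-leg j) (lg-injective e)) (inj₁ refl)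
      not-simplicial (fsuc a) child = two-sided-not-simplicial (lg j (fsuc a)) (lg j a') (lg j (inject₁ a)) child
        (λ e → 1+n≢n (trans (cong toℕ (leg-injective j (cong just e))) (toℕ-inject₁ a))) (inj₂ refl)

  tip-degree : ∀ u → IsTip u → deg H (enc u) ≤ t
  tip-degree u (j , refl) = go (tip j) (λ w → tip-childless j (just w))
    where
      go : ∀ a → (∀ w → par w ≢ leg j a) → deg H (enc (lg j a)) ≤ t
      go fzero none = degree≤ (lg j fzero) (λ j' → lg j' fzero) cov
        where
          cov : ∀ v → LineAdj (lg j fzero) v → ∃[ j' ] lg j' fzero ≡ v
          cov v (_ , inj₂ (inj₂ e)) = ⊥-elim (none v (sym e))
          cov (lg j' fzero) (_ , inj₁ e) = j' , refl
      go (fsuc a) none = ≤-trans (degree≤ (lg j (fsuc a)) {1} (λ _ → lg j (inject₁ a)) cov) (≤-trans (s≤s z≤n) t≥2)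
        where
          cov : ∀ v → LineAdj (lg j (fsuc a)) v → ∃[ _ ] lg j (inject₁ a) ≡ v
          cov v (ne , inj₁ e) = ⊥-elim (ne (leg-child-unique refl (sym e)))
          cov v (_ , inj₂ (inj₁ e)) = fzero , just-injective e
          cov v (_ , inj₂ (inj₂ e)) = ⊥-elim (none v (sym e))

  enc-tip : ∀ v → IsTip (dec v) ⇔ (∃[ j ] enc (lg j (tip j)) ≡ v)
  enc-tip v = mk⇔ (λ (j , e) → j , trans (cong enc (sym e)) (enc-dec v)) (λ { (j , refl) → j , dec-enc _ })

  card : ∣ pullback f S ∣ ≡ t
  card = pullback-card f S (λ j → enc (lg j (tip j))) (λ i j e → lg-injective (trans (sym (dec-enc _)) (trans (cong dec e) (dec-enc _))))
      (λ v → mk⇔ (λ h → to (enc-tip v) (to (φ-S (dec v)) h)) (λ h → from (φ-S (dec v)) (from (enc-tip v) h)))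

  connectifier : ConnectifierIn G S t
  connectifier = size , H , f , (f-injective , λ _ _ → refl) ,
    inj₁ (((λ v → mk⇔
      (λ si → from (∈-pullback f S v) (from (φ-S (dec v)) (simplicial-tip (dec v) (subst (Simplicial H) (sym (enc-dec v)) si))))
      (λ h → subst (Simplicial H) (enc-dec v) (tip-simplicial (dec v) (to (φ-S (dec v)) (to (∈-pullback f S v) h))))) , card) ,
      suc size , treeGraph , fzero , (T.tree , T.branch-root) , T.stems-positive , isLineGraphOf) ,
    connected , card ,
    λ v h → subst (λ z → deg H z ≤ t) (enc-dec v) (tip-degree (dec v) (to (φ-S (dec v)) (to (∈-pullback f S v) h)))

-- A path with `K + 1` vertices in `G` is read as `K + 1` core edges, so the core of the tree has
-- `K + 2` vertices and the legs hang at the inner ones.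
module LineCaterpillarConnectifier {n} (G : Graph n) (S : Subset n) (K t : ℕ) (ℓ : Fin t → ℕ) (c : Fin t → Fin (suc (suc K)))
  (c-mono : ∀ j j' → toℕ j < toℕ j' → toℕ (c j) < toℕ (c j'))
  (c-pos : ∀ j → 0 < toℕ (c j)) (c-top : ∀ j → toℕ (c j) < suc K) (t-pos : 0 < t) (comb : InducedLineComb G (suc K) t ℓ c)
  (p-S : ∀ k → InducedLineComb.p comb k inS S ⇔ (toℕ k ≡ 0 ⊎ toℕ k ≡ K))
  (q-S : ∀ j a → InducedLineComb.q comb j a inS S ⇔ (toℕ a ≡ ℓ j)) where

  open InducedLineComb comb
  open CaterpillarTree (suc K) t ℓ c c-mono c-pos c-top t-pos
  open IsLineGraph H H-adj
  private module T = CaterpillarOn treeGraph treeGraph-adj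

  IsEndEdge : W → Set
  IsEndEdge u = u ≡ cr fzero ⊎ u ≡ cr (fromℕ K) ⊎ (Σ[ j ∈ Fin t ] u ≡ lg j (tip j))

  φ-S : ∀ u → φ u inS S ⇔ IsEndEdge u
  φ-S (cr k) = mk⇔ (λ h → fwd (to (p-S k) h)) (λ h → from (p-S k) (bwd h))
    where
      fwd : toℕ k ≡ 0 ⊎ toℕ k ≡ K → IsEndEdge (cr k)
      fwd (inj₁ e) = inj₁ (cong cr (toℕ-injective e))
      fwd (inj₂ e) = inj₂ (inj₁ (cong cr (toℕ-injective (trans e (sym (toℕ-fromℕ K))))))
      bwd : IsEndEdge (cr k) → toℕ k ≡ 0 ⊎ toℕ k ≡ K
      bwd (inj₁ refl) = inj₁ refl
      bwd (inj₂ (inj₁ refl)) = inj₂ (toℕ-fromℕ K)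
  φ-S (lg j a) = mk⇔ (λ h → inj₂ (inj₂ (j , cong (lg j) (tip-unique j a (to (q-S j a) h))))) (λ h → from (q-S j a) (bwd h))
    where
      bwd : IsEndEdge (lg j a) → toℕ a ≡ ℓ j
      bwd (inj₂ (inj₂ (j , refl))) = toℕ-fromℕ (ℓ j)

  first-sole : ∀ w → par w ≡ nothing → w ≡ cr fzero
  first-sole (cr fzero) e = refl
  first-sole (lg j fzero) e = ⊥-elim (<⇒≢ (c-pos j) (sym (cong toℕ (core-injective (c j) fzero e))))

  end-simplicial : ∀ u → IsEndEdge u → Simplicial H (enc u)
  end-simplicial u (inj₁ refl) = sole-top-simplicial u refl first-sole
  end-simplicial u (inj₂ (inj₁ refl)) = childless-simplicial u (λ w → core-end-childless (just w))
  end-simplicial u (inj₂ (inj₂ (j , refl))) = childless-simplicial u (λ w → tip-childless j (just w))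

  -- As `c j` is not the root, there is a core edge above it. That edge meets the first edge of the
  -- leg at the end opposite to the rest of the leg, so the first edge of a longer leg is not
  -- simplicial.
  core-pos : ∀ k → 0 < toℕ k → Σ[ k' ∈ Fin (suc K) ] core k ≡ just (cr k')
  core-pos (fsuc k) _ = k , refl

  simplicial-end : ∀ u → Simplicial H (enc u) → IsEndEdge u
  simplicial-end (cr fzero) si = inj₁ refl
  simplicial-end (cr (fsuc k)) si with suc (toℕ k) ℕ.≟ K
  ... | yes e = inj₂ (inj₁ (cong cr (toℕ-injective (trans e (sym (toℕ-fromℕ K))))))
  ... | no ne = ⊥-elim (two-sided-not-simplicial (cr (fsuc k)) (cr k⁺) (cr (inject₁ k))
      (cong core (toℕ-injective (trans (toℕ-inject₁ k⁺) (toℕ-fromℕ< lt))))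
      (λ e → 1+n≢n (trans (cong toℕ (core-injective (fsuc (fsuc k)) (fsuc (inject₁ k)) (cong just e))) (cong suc (toℕ-inject₁ k)))) (inj₂ refl) si)
    where
      lt : suc (suc (toℕ k)) < suc K
      lt = s≤s (≤∧≢⇒< (toℕ<n k) ne)
      k⁺ = fromℕ< lt
  simplicial-end (lg j a) si with toℕ a ℕ.≟ ℓ j
  ... | yes e = inj₂ (inj₂ (j , cong (lg j) (tip-unique j a e)))
  ... | no ne = ⊥-elim (not-simplicial a (from (Up-leg-leg j a' a) (sym (proj₂ (next-leg j a ne)))) si)
    where
      a' = proj₁ (next-leg j a ne)
      not-simplicial : ∀ a → par (lg j a') ≡ leg j a → ¬ Simplicial H (enc (lg j a))
      not-simplicial fzero child with core-pos (c j) (c-pos j)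
      ... | k , e = two-sided-not-simplicial (lg j fzero) (lg j a') (cr k) child (λ ()) (inj₂ e)
      not-simplicial (fsuc a) child = two-sided-not-simplicial (lg j (fsuc a)) (lg j a') (lg j (inject₁ a)) child
        (λ e → 1+n≢n (trans (cong toℕ (leg-injective j (cong just e))) (toℕ-inject₁ a))) (inj₂ refl)

  core-child? : ∀ k (k' : Fin (suc K)) → Dec (inject₁ k' ≡ k)
  core-child? k k' = inject₁ k' ≟ᶠ k

  hanging? : ∀ k j → Dec (c j ≡ k)
  hanging? k j = c j ≟ᶠ k

  children : Fin (suc (suc K)) → Fin 2 → W
  children k fzero = pick (core-child? k) cr (cr fzero)
  children k (fsuc _) = pick (hanging? k) (λ j → lg j fzero) (cr fzero)

  children-cover : ∀ k w → par w ≡ core k → ∃[ i ] children k i ≡ w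
  children-cover k (cr k') e = fzero , pick-unique (core-child? k) cr (cr fzero)
    (λ x y e e' → toℕ-injective (trans (sym (toℕ-inject₁ x)) (trans (cong toℕ (trans e (sym e'))) (toℕ-inject₁ y)))) k' (core-injective _ _ e)
  children-cover k (lg j fzero) e = fsuc fzero , pick-unique (hanging? k) (λ j → lg j fzero) (cr fzero)
    (λ x y e e' → c-injective x y (trans e (sym e'))) j (core-injective _ _ e)
  children-cover k (lg j (fsuc a)) e = ⊥-elim (core≢leg k (sym e))

  -- All neighbours of a childless edge lie at its upper end. At a core vertex, the edge above it,
  -- the next core edge and the leg edge fill the three slots, one of them being `u` itself; three
  -- is at most `t + 2`.
  childless-degree : ∀ u → (∀ w → par w ≢ just u) → deg H (enc u) ≤ 3
  childless-degree u none with par u in pu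
  ... | nothing = ≤-trans (degree≤ u (children fzero) cov) (n≤1+n 2)
    where
      cov : ∀ v → LineAdj u v → ∃[ i ] children fzero i ≡ v
      cov v (_ , inj₁ e) = children-cover fzero v (trans (sym e) pu)
      cov v (_ , inj₂ (inj₁ e)) with trans (sym e) pu
      ... | ()
      cov v (_ , inj₂ (inj₂ e)) = ⊥-elim (none v (sym e))
  ... | just (cr k) = degree≤ u g cov
    where
      g : Fin 3 → W
      g fzero = cr k
      g (fsuc i) = children (fsuc k) i
      cov : ∀ v → LineAdj u v → ∃[ i ] g i ≡ v
      cov v (_ , inj₁ e) = let (i , e') = children-cover (fsuc k) v (trans (sym e) pu) in fsuc i , e'
      cov v (_ , inj₂ (inj₁ e)) = fzero , just-injective (trans (sym pu) e)
      cov v (_ , inj₂ (inj₂ e)) = ⊥-elim (none v (sym e))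
  ... | just (lg j a) = ≤-trans (degree≤ u {1} (λ _ → lg j a) cov) (s≤s z≤n)
    where
      cov : ∀ v → LineAdj u v → ∃[ _ ] lg j a ≡ v
      cov v (ne , inj₁ e) = ⊥-elim (ne (leg-child-unique pu (trans (sym e) pu)))
      cov v (_ , inj₂ (inj₁ e)) = fzero , just-injective (trans (sym pu) e)
      cov v (_ , inj₂ (inj₂ e)) = ⊥-elim (none v (sym e))

  end-degree : ∀ u → IsEndEdge u → deg H (enc u) ≤ 3
  end-degree u (inj₁ refl) = ≤-trans (degree≤ u (children (fsuc fzero)) cov) (n≤1+n 2)
    where
      cov : ∀ v → LineAdj (cr fzero) v → ∃[ i ] children (fsuc fzero) i ≡ v
      cov v (ne , inj₁ e) = ⊥-elim (ne (sym (first-sole v (sym e))))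
      cov v (_ , inj₂ (inj₂ e)) = children-cover (fsuc fzero) v (sym e)
  end-degree u (inj₂ (inj₁ refl)) = childless-degree u (λ w → core-end-childless (just w))
  end-degree u (inj₂ (inj₂ (j , refl))) = childless-degree u (λ w → tip-childless j (just w))

  endEdge : Fin (suc (suc t)) → W
  endEdge fzero = cr fzero
  endEdge (fsuc i) with view i
  ... | ‵fromℕ = cr (fromℕ K)
  ... | ‵inject₁ j = lg j (tip j)

  endEdge-end : ∀ i → just (endEdge (fsuc i)) ≡ end (fsuc i)
  endEdge-end i with view i
  ... | ‵fromℕ = refl
  ... | ‵inject₁ j = refl

  K-pos' : 0 < K
  K-pos' = ≤-pred (≤-trans (s≤s (c-pos j)) (c-top j))
    where j = fromℕ< t-pos

  endEdge-first : ∀ i → endEdge (fsuc i) ≢ cr fzero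
  endEdge-first i e with view i
  endEdge-first i e | ‵fromℕ = <⇒≢ K-pos' (trans (sym (ℕ.suc-injective (cong toℕ (core-injective (fsuc (fromℕ K)) (fsuc fzero) (cong just e))))) (toℕ-fromℕ K))
  endEdge-first i () | ‵inject₁ j

  endEdge-injective : ∀ i j → endEdge i ≡ endEdge j → i ≡ j
  endEdge-injective fzero fzero e = refl
  endEdge-injective fzero (fsuc j) e = ⊥-elim (endEdge-first j (sym e))
  endEdge-injective (fsuc i) fzero e = ⊥-elim (endEdge-first i e)
  endEdge-injective (fsuc i) (fsuc j) e = end-injective (fsuc i) (fsuc j) (trans (sym (endEdge-end i)) (trans (cong just e) (endEdge-end j)))

  endEdge-covers : ∀ u → IsEndEdge u ⇔ (∃[ i ] endEdge i ≡ u)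
  endEdge-covers u = mk⇔ fwd (λ { (i , refl) → bwd i })
    where
      fwd : IsEndEdge u → ∃[ i ] endEdge i ≡ u
      fwd (inj₁ refl) = fzero , refl
      fwd (inj₂ (inj₁ refl)) = fsuc (fromℕ t) , e
        where
          e : endEdge (fsuc (fromℕ t)) ≡ cr (fromℕ K)
          e rewrite view-fromℕ t = refl
      fwd (inj₂ (inj₂ (j , refl))) = fsuc (inject₁ j) , e
        where
          e : endEdge (fsuc (inject₁ j)) ≡ lg j (tip j)
          e rewrite view-inject₁ j = refl
      bwd : ∀ i → IsEndEdge (endEdge i)
      bwd fzero = inj₁ refl
      bwd (fsuc i) with view i
      ... | ‵fromℕ = inj₂ (inj₁ refl)
      ... | ‵inject₁ j = inj₂ (inj₂ (j , refl))

  enc-end : ∀ v → IsEndEdge (dec v) ⇔ (∃[ i ] enc (endEdge i) ≡ v)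
  enc-end v = mk⇔ (λ h → let (i , e) = to (endEdge-covers (dec v)) h in i , trans (cong enc e) (enc-dec v))
    (λ { (i , refl) → from (endEdge-covers _) (i , sym (dec-enc _)) })

  card : ∣ pullback f S ∣ ≡ suc (suc t)
  card = pullback-card f S (λ i → enc (endEdge i))
    (λ i j e → endEdge-injective i j (trans (sym (dec-enc _)) (trans (cong dec e) (dec-enc _))))
    (λ v → mk⇔ (λ h → to (enc-end v) (to (φ-S (dec v)) h)) (λ h → from (φ-S (dec v)) (from (enc-end v) h)))

  connectifier : ConnectifierIn G S (suc (suc t))
  connectifier = size , H , f , (f-injective , λ _ _ → refl) ,
    inj₂ (inj₂ (inj₂ (inj₂ (((λ v → mk⇔
      (λ si → from (∈-pullback f S v) (from (φ-S (dec v)) (simplicial-end (dec v) (subst (Simplicial H) (sym (enc-dec v)) si))))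
      (λ h → subst (Simplicial H) (enc-dec v) (end-simplicial (dec v) (to (φ-S (dec v)) (to (∈-pullback f S v) h))))) , card) ,
      suc size , treeGraph , T.oneCaterpillar , isLineGraphOf)))) ,
    connected , card ,
    λ v h → ≤-trans (subst (λ z → deg H z ≤ 3) (enc-dec v) (end-degree (dec v) (to (φ-S (dec v)) (to (∈-pullback f S v) h)))) (s≤s (s≤s t-pos))

-- Minimal connected sets

does-false⇒¬ : ∀ {A : Set} (a : Dec A) → does a ≡ false → ¬ A
does-false⇒¬ (no ¬a) _ = ¬a

true≢false : ∀ {b} → b ≡ true → b ≡ false → ⊥
true≢false refl ()

≢true⇒false : ∀ {b} → b ≢ true → b ≡ false
≢true⇒false {true} h = ⊥-elim (h refl)
≢true⇒false {false} h = refl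

∧-true : ∀ {a b} → a ≡ true → b ≡ true → a ∧ b ≡ true
∧-true refl refl = refl

∧-true⁻ : ∀ a {b} → a ∧ b ≡ true → a ≡ true × b ≡ true
∧-true⁻ true h = refl , h

module _ {n : ℕ} where

  VSet : Set
  VSet = Fin n → Bool

  ∣_∣ᵛ : VSet → ℕ
  ∣ A ∣ᵛ = ∣ Vec.tabulate A ∣

  insert : VSet → Fin n → VSet
  insert A v u = does (u ≟ᶠ v) ∨ A u

  remove : VSet → Fin n → VSet
  remove A v u = A u ∧ not (does (u ≟ᶠ v))

  insert-new : ∀ A v → insert A v v ≡ true
  insert-new A v rewrite dec-true (v ≟ᶠ v) refl = refl

  insert-old : ∀ A v {u} → A u ≡ true → insert A v u ≡ true
  insert-old A v {u} h with does (u ≟ᶠ v)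
  ... | true = refl
  ... | false = h

  insert⁻ : ∀ A v {u} → insert A v u ≡ true → u ≡ v ⊎ A u ≡ true
  insert⁻ A v {u} h with u ≟ᶠ v
  ... | yes e = inj₁ e
  ... | no _ = inj₂ h

  remove⁺ : ∀ A v {u} → A u ≡ true → u ≢ v → remove A v u ≡ true
  remove⁺ A v {u} h ne rewrite h | dec-false (u ≟ᶠ v) ne = refl

  remove⁻ : ∀ A v {u} → remove A v u ≡ true → A u ≡ true × u ≢ v
  remove⁻ A v {u} h with u ≟ᶠ v
  ... | yes e = ⊥-elim (true≢false (proj₂ (∧-true⁻ (A u) h)) refl)
  ... | no ne = proj₁ (∧-true⁻ (A u) h) , ne

  _∖_ : VSet → VSet → VSet
  (A ∖ B) u = A u ∧ not (B u)

  ∖⁺ : ∀ A B {u} → A u ≡ true → B u ≡ false → (A ∖ B) u ≡ true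
  ∖⁺ A B h h' rewrite h | h' = refl

  ∖⁻ : ∀ A B {u} → (A ∖ B) u ≡ true → A u ≡ true × B u ≡ false
  ∖⁻ A B {u} h with B u
  ... | true = ⊥-elim (true≢false (proj₂ (∧-true⁻ (A u) h)) refl)
  ... | false = proj₁ (∧-true⁻ (A u) h) , refl

  card-< : ∀ (A B : VSet) v → (∀ u → A u ≡ true → B u ≡ true) → B v ≡ true → A v ≡ false → ∣ A ∣ᵛ < ∣ B ∣ᵛ
  card-< A B v sub vB vA = subst (λ z → suc z ≤ ∣ B ∣ᵛ) (length-elements (Vec.tabulate A)) (card≥ (Vec.tabulate B) g inj g-B)
    where
      E = elements (Vec.tabulate A)
      E-A : ∀ i → A (lookup E i) ≡ true
      E-A i = trans (sym (lookup∘tabulate A (lookup E i))) (all-lookup (elements-⊆ (Vec.tabulate A)) i)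
      g : Fin (suc (length E)) → Fin n
      g fzero = v
      g (fsuc i) = lookup E i
      v∉E : ∀ i → v ≢ lookup E i
      v∉E i e = true≢false (E-A i) (trans (cong A (sym e)) vA)
      inj : ∀ i j → g i ≡ g j → i ≡ j
      inj fzero fzero e = refl
      inj fzero (fsuc j) e = ⊥-elim (v∉E j e)
      inj (fsuc i) fzero e = ⊥-elim (v∉E i (sym e))
      inj (fsuc i) (fsuc j) e = cong fsuc (unique-lookup (elements-unique (Vec.tabulate A)) i j e)
      g-B : ∀ i → Vec.lookup (Vec.tabulate B) (g i) ≡ true
      g-B fzero = trans (lookup∘tabulate B v) vB
      g-B (fsuc i) = trans (lookup∘tabulate B _) (sub _ (E-A i))

module _ {n : ℕ} (G : Graph n) where

  data WalkIn (X : Fin n → Bool) : Fin n → Fin n → Set where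
    here : ∀ {u} → X u ≡ true → WalkIn X u u
    step : ∀ {u v w} → X u ≡ true → Adj G u v → WalkIn X v w → WalkIn X u w

  walkIn-start : ∀ {X u v} → WalkIn X u v → X u ≡ true
  walkIn-start (here h) = h
  walkIn-start (step h _ _) = h

  walkIn-++ : ∀ {X u v w} → WalkIn X u v → WalkIn X v w → WalkIn X u w
  walkIn-++ (here _) q = q
  walkIn-++ (step h a p) q = step h a (walkIn-++ p q)

  walkIn-reverse : ∀ {X u v} → WalkIn X u v → WalkIn X v u
  walkIn-reverse (here h) = here h
  walkIn-reverse (step h a p) = walkIn-++ (walkIn-reverse p) (step (walkIn-start p) (Adj-sym G a) (here h))

  walkIn-mono : ∀ {X Y u v} → (∀ x → X x ≡ true → Y x ≡ true) → WalkIn X u v → WalkIn Y u v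
  walkIn-mono sub (here h) = here (sub _ h)
  walkIn-mono sub (step h a p) = step (sub _ h) a (walkIn-mono sub p)

  record Component (X : Fin n → Bool) (b : Fin n) : Set where
    field
      C      : Fin n → Bool
      base   : C b ≡ true
      inside : ∀ {u} → C u ≡ true → u ≡ b ⊎ X u ≡ true
      closed : ∀ {u v} → C u ≡ true → X v ≡ true → Adj G u v → C v ≡ true
      reach  : ∀ {u} → C u ≡ true → WalkIn C b u

  component : ∀ X b → Component X b
  component X b = grow ∣ X ∖ start ∣ᵛ start base₀ (λ h → inj₁ (start⁻ h)) (λ h → reach₀ (start⁻ h)) ≤-refl
    where
      start : Fin n → Bool
      start u = does (u ≟ᶠ b)
      start⁻ : ∀ {u} → start u ≡ true → u ≡ b
      start⁻ {u} h = to (does-true (u ≟ᶠ b)) h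
      base₀ : start b ≡ true
      base₀ = dec-true (b ≟ᶠ b) refl
      reach₀ : ∀ {u} → u ≡ b → WalkIn start b u
      reach₀ refl = here base₀
      -- The fuel bounds the number of vertices of `X` still outside `C`; every round moves one of
      -- them into `C`.
      grow : ∀ fuel (C : Fin n → Bool) → C b ≡ true → (∀ {u} → C u ≡ true → u ≡ b ⊎ X u ≡ true) →
        (∀ {u} → C u ≡ true → WalkIn C b u) → ∣ X ∖ C ∣ᵛ ≤ fuel → Component X b
      grow fuel C bC ins rch le with any? (λ u → any? (λ v → (C u ≟ᵇ true) ×-dec (((X ∖ C) v ≟ᵇ true) ×-dec (adj G u v ≟ᵇ true))))
      ... | no none = record { C = C ; base = bC ; inside = ins ; closed = cl ; reach = rch }
        where
          cl : ∀ {u v} → C u ≡ true → X v ≡ true → Adj G u v → C v ≡ true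
          cl {u} {v} hu hv a with C v in e
          ... | true = refl
          ... | false = ⊥-elim (none (u , v , hu , ∖⁺ X C hv e , a))
      ... | yes (u , v , hu , hv , a) = go fuel le
        where
          C' = insert C v
          Xv = proj₁ (∖⁻ X C hv)
          smaller : ∣ X ∖ C' ∣ᵛ < ∣ X ∖ C ∣ᵛ
          smaller = card-< (X ∖ C') (X ∖ C) v sub hv missing
            where
              missing : (X ∖ C') v ≡ false
              missing rewrite insert-new C v | Xv = refl
              sub : ∀ w → (X ∖ C') w ≡ true → (X ∖ C) w ≡ true
              sub w h with ∖⁻ X C' h
              ... | hX , hC' = ∖⁺ X C hX (≢true⇒false (λ e → true≢false (insert-old C v e) hC'))
          ins' : ∀ {w} → C' w ≡ true → w ≡ b ⊎ X w ≡ true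
          ins' {w} h with insert⁻ C v h
          ... | inj₁ refl = inj₂ Xv
          ... | inj₂ h' = ins h'
          mono : ∀ w → C w ≡ true → C' w ≡ true
          mono w h = insert-old C v h
          rch' : ∀ {w} → C' w ≡ true → WalkIn C' b w
          rch' {w} h with insert⁻ C v h
          ... | inj₁ refl = walkIn-++ (walkIn-mono mono (rch hu)) (step (mono _ hu) a (here (insert-new C v)))
          ... | inj₂ h' = walkIn-mono mono (rch h')
          go : ∀ fuel → ∣ X ∖ C ∣ᵛ ≤ fuel → Component X b
          go zero le = ⊥-elim (ℕ.n≮0 (≤-trans smaller le))
          go (suc fuel) le = grow fuel C' (mono b bC) ins' rch' (≤-pred (≤-trans smaller le))

  -- An induced path that stays in `X` and meets `S` only in its last vertex. The start is an index
  -- and the list holds the later vertices; the `All` condition in `cons` excludes repetitions and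
  -- chords at the new front vertex.
  data SPath (S : Subset n) (X : Fin n → Bool) : Fin n → List (Fin n) → Set where
    end  : ∀ {u} → X u ≡ true → u inS S → SPath S X u []
    cons : ∀ {u v vs} → X u ≡ true → ¬ (u inS S) → Adj G u v → All (λ w → ¬ (u ≡ w ⊎ Adj G u w)) vs → SPath S X v vs → SPath S X u (v ∷ vs)

  -- The recursion drops front vertices as long as a later vertex is touched, so `u` is joined at
  -- the last contact. That cuts off all chords. If the last contact is `u` itself, the rest of the
  -- path is the answer.
  attach : ∀ {S X u v vs} → X u ≡ true → ¬ (u inS S) → SPath S X v vs → Any (λ w → u ≡ w ⊎ Adj G u w) (v ∷ vs) → Σ[ ws ∈ List (Fin n) ] SPath S X u ws
  attach {u = u} {v} {vs} hX hS P touch with Any.any? (λ w → (u ≟ᶠ w) ⊎-dec (adj G u w ≟ᵇ true)) vs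
  attach hX hS (cons _ _ _ _ P) touch | yes t = attach hX hS P t
  attach {vs = vs} hX hS P (here (inj₁ refl)) | no nt = vs , P
  attach {v = v} {vs} hX hS P (here (inj₂ a)) | no nt = v ∷ vs , cons hX hS a (Allₚ.¬Any⇒All¬ vs nt) P
  attach hX hS P (there t) | no nt = ⊥-elim (nt t)

  -- Whenever a vertex of `S` turns up on the walk, everything after it is discarded; this keeps `S`
  -- away from all vertices but the last.
  shortcut : ∀ {S X u s} → WalkIn X u s → s inS S → Σ[ vs ∈ List (Fin n) ] SPath S X u vs
  shortcut (here h) hs = [] , end h hs
  shortcut {S} {u = u} (step h a w) hs with Vec.lookup S u ≟ᵇ true
  ... | yes hu = [] , end h hu
  ... | no hu = attach h hu (proj₂ (shortcut w hs)) (here (inj₂ a))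

  spath-X : ∀ {S X u vs} → SPath S X u vs → ∀ i → X (lookup (u ∷ vs) i) ≡ true
  spath-X (end h _) fzero = h
  spath-X (cons h _ _ _ P) fzero = h
  spath-X (cons h _ _ _ P) (fsuc i) = spath-X P i

  spath-S : ∀ {S X u vs} → SPath S X u vs → ∀ i → (lookup (u ∷ vs) i inS S) ⇔ (toℕ i ≡ length vs)
  spath-S (end _ h) fzero = mk⇔ (λ _ → refl) (λ _ → h)
  spath-S (cons _ h _ _ P) fzero = mk⇔ (λ h' → ⊥-elim (h h')) (λ ())
  spath-S (cons _ h _ _ P) (fsuc i) = mk⇔ (λ h' → cong suc (to (spath-S P i) h')) (λ e → from (spath-S P i) (ℕ.suc-injective e))

  spath-path : ∀ {S X u vs} → SPath S X u vs → IsPathSeq G (lookup (u ∷ vs))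
  spath-path (end _ _) = (λ { fzero fzero _ → refl }) , λ { fzero fzero → mk⇔ (λ h → ⊥-elim (Adj-irrefl G h refl)) (λ { (inj₁ ()) ; (inj₂ ()) }) }
  spath-path {u = u} {v ∷ vs} (cons _ _ a far P) = inj , ad
    where
      l = u ∷ v ∷ vs
      u≢ : ∀ i → u ≢ lookup (v ∷ vs) i
      u≢ fzero e = Adj-irrefl G a e
      u≢ (fsuc i) e = all-lookup far i (inj₁ e)
      inj : ∀ i j → lookup l i ≡ lookup l j → i ≡ j
      inj fzero fzero e = refl
      inj fzero (fsuc j) e = ⊥-elim (u≢ j e)
      inj (fsuc i) fzero e = ⊥-elim (u≢ i (sym e))
      inj (fsuc i) (fsuc j) e = cong fsuc (proj₁ (spath-path P) i j e)
      ad₀ : ∀ j → Adj G u (lookup (v ∷ vs) j) ⇔ (toℕ j ≡ 0)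
      ad₀ fzero = mk⇔ (λ _ → refl) (λ _ → a)
      ad₀ (fsuc j) = mk⇔ (λ h → ⊥-elim (all-lookup far j (inj₂ h))) (λ ())
      ad : ∀ i j → Adj G (lookup l i) (lookup l j) ⇔ Consecutive (toℕ i) (toℕ j)
      ad fzero fzero = mk⇔ (λ h → ⊥-elim (Adj-irrefl G h refl)) (λ { (inj₁ ()) ; (inj₂ ()) })
      ad fzero (fsuc j) = mk⇔ (λ h → inj₁ (cong suc (sym (to (ad₀ j) h)))) (λ { (inj₁ e) → from (ad₀ j) (sym (ℕ.suc-injective e)) ; (inj₂ ()) })
      ad (fsuc i) fzero = mk⇔ (λ h → inj₂ (cong suc (sym (to (ad₀ i) (Adj-sym G h))))) (λ { (inj₂ e) → Adj-sym G (from (ad₀ i) (sym (ℕ.suc-injective e))) ; (inj₁ ()) })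
      ad (fsuc i) (fsuc j) = mk⇔ (λ h → to Consecutive-suc (to (proj₂ (spath-path P) i j) h)) (λ h → from (proj₂ (spath-path P) i j) (from Consecutive-suc h))

  -- `separates` is minimality of `M` in one-step form: discarding `x` and all that it cuts off from
  -- `b` would lose a vertex of `S`.
  record Pruned (S : Subset n) (r : Fin n) : Set where
    field
      M         : Fin n → Bool
      M-S       : ∀ {s} → s inS S → M s ≡ true
      connected : ∀ {u} → M u ≡ true → WalkIn M r u
      separates : ∀ {x b} → M x ≡ true → ¬ (x inS S) → M b ≡ true → b ≢ x →
                  Σ[ s ∈ Fin n ] (s inS S × Component.C (component (remove M x) b) s ≡ false)

  -- As long as `separates` fails at some x and b, the component of b in M − x can replace M.
  prune : ∀ S r → r inS S → (∀ s → s inS S → Walk G r s) → Pruned S r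
  prune S r rS conn = go ∣ C ∣ᵛ C (λ {s} h → follow (conn s h) base) reach ≤-refl
    where
      open Component (component (λ _ → true) r)
      follow : ∀ {u v} → Walk G u v → C u ≡ true → C v ≡ true
      follow here h = h
      follow (step a w) h = follow w (closed h refl a)
      go : ∀ fuel (M : Fin n → Bool) → (∀ {s} → s inS S → M s ≡ true) → (∀ {u} → M u ≡ true → WalkIn M r u) → ∣ M ∣ᵛ ≤ fuel → Pruned S r
      go fuel M M-S M-conn le with any? (λ x → any? (λ b → (M x ≟ᵇ true) ×-dec (¬? (Vec.lookup S x ≟ᵇ true) ×-dec ((M b ≟ᵇ true) ×-dec (¬? (b ≟ᶠ x) ×-dec
                    all? (λ s → ¬? (Vec.lookup S s ≟ᵇ true) ⊎-dec (Component.C (component (remove M x) b) s ≟ᵇ true)))))))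
      ... | no none = record { M = M ; M-S = M-S ; connected = M-conn ; separates = sep }
        where
          sep : ∀ {x b} → M x ≡ true → ¬ (x inS S) → M b ≡ true → b ≢ x →
                  Σ[ s ∈ Fin n ] (s inS S × Component.C (component (remove M x) b) s ≡ false)
          sep {x} {b} hx xS hb b≢x with any? (λ s → (Vec.lookup S s ≟ᵇ true) ×-dec (Component.C (component (remove M x) b) s ≟ᵇ false))
          ... | yes (s , h) = s , h
          ... | no none' = ⊥-elim (none (x , b , hx , xS , hb , b≢x , all))
            where
              all : ∀ s → ¬ (s inS S) ⊎ Component.C (component (remove M x) b) s ≡ true
              all s with Vec.lookup S s ≟ᵇ true | Component.C (component (remove M x) b) s in e
              ... | no h | _ = inj₁ h
              ... | yes h | true = inj₂ refl
              ... | yes h | false = ⊥-elim (none' (s , h , e))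
      ... | yes (x , b , hx , xS , hb , b≢x , all) = shrink fuel le
        where
          module D = Component (component (remove M x) b)
          D-S : ∀ {s} → s inS S → D.C s ≡ true
          D-S {s} h with all s
          ... | inj₁ h' = ⊥-elim (h' h)
          ... | inj₂ h' = h'
          -- The component is connected from `b`; since it contains all of `S`, it contains `r`,
          -- which can take over as the origin.
          D-conn : ∀ {u} → D.C u ≡ true → WalkIn D.C r u
          D-conn h = walkIn-++ (walkIn-reverse (D.reach (D-S rS))) (D.reach h)
          D⊆ : ∀ {u} → D.C u ≡ true → M u ≡ true × u ≢ x
          D⊆ h with D.inside h
          ... | inj₁ refl = hb , b≢x
          ... | inj₂ h' = remove⁻ M x h'
          x∉D : D.C x ≡ false
          x∉D = ≢true⇒false (λ e → proj₂ (D⊆ e) refl)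
          smaller : ∣ D.C ∣ᵛ < ∣ M ∣ᵛ
          smaller = card-< D.C M x (λ u h → proj₁ (D⊆ h)) hx x∉D
          shrink : ∀ fuel → ∣ M ∣ᵛ ≤ fuel → Pruned S r
          shrink zero le = ⊥-elim (ℕ.n≮0 (≤-trans smaller le))
          shrink (suc fuel) le = go fuel D.C D-S D-conn (≤-pred (≤-trans smaller le))

-- Pendant paths

module InPruned {n : ℕ} (G : Graph n) (S : Subset n) (r : Fin n) (P : Pruned G S r) where

  open Pruned P

  -- The vertices that x does not separate from b within M.
  Side : Fin n → Fin n → Fin n → Bool
  Side x b = Component.C (component G (remove M x) b)

  side-base : ∀ x b → Side x b b ≡ true
  side-base x b = Component.base (component G (remove M x) b)

  side-closed : ∀ x b {u v} → Side x b u ≡ true → M v ≡ true → v ≢ x → Adj G u v → Side x b v ≡ true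
  side-closed x b hu hv ne a = Component.closed (component G (remove M x) b) hu (remove⁺ M x hv ne) a

  record Pendant (x b : Fin n) : Set where
    field
      k       : ℕ
      q       : Fin (suc k) → Fin n
      q-path  : IsPathSeq G q
      q-start : q fzero ≡ x
      q-M     : ∀ i → M (q i) ≡ true
      q-out   : ∀ i → Side x b (q i) ≡ false
      q-S     : ∀ i → q i inS S ⇔ (toℕ i ≡ k)

    q≢x : ∀ i → toℕ i ≢ 0 → q i ≢ x
    q≢x i ne e = ne (cong toℕ (proj₁ q-path i fzero (trans e (sym q-start))))

    q-avoid : ∀ i {w} → Side x b w ≡ true → q i ≢ w
    q-avoid i h refl = true≢false h (q-out i)

    -- A pendant vertex other than `x` that is adjacent to the side would belong to it, because the
    -- side is closed in `M` without `x`.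
    q-side : ∀ i {w} → Side x b w ≡ true → Adj G (q i) w → toℕ i ≡ 0
    q-side i {w} h a with toℕ i ℕ.≟ 0
    ... | yes e = e
    ... | no ne = ⊥-elim (true≢false (side-closed x b h (q-M i) (q≢x i ne) (Adj-sym G a)) (q-out i))

  -- If `x` is in `S`, it is its own pendant. Otherwise `separates` supplies a vertex of `S` beyond
  -- `x`; a walk from it to `x` can be kept off the side, and its reverse is shortened to an induced
  -- path that stops in `S`.
  pendant : ∀ x b → M x ≡ true → M b ≡ true → b ≢ x → Pendant x b
  pendant x b hx hb b≢x = record
      { k = length (proj₁ path) ; q = lookup (x ∷ proj₁ path) ; q-path = spath-path G (proj₂ path) ; q-start = refl
      ; q-M = λ i → proj₁ (∖⁻ M D (spath-X G (proj₂ path) i)) ; q-out = λ i → proj₂ (∖⁻ M D (spath-X G (proj₂ path) i)) ; q-S = spath-S G (proj₂ path) }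
    where
      D = Side x b
      x∉D : D x ≡ false
      x∉D = ≢true⇒false (λ e → x-not (Component.inside (component G (remove M x) b) e))
        where
          x-not : ¬ (x ≡ b ⊎ remove M x x ≡ true)
          x-not (inj₁ e) = b≢x (sym e)
          x-not (inj₂ e) = proj₂ (remove⁻ M x e) refl
      -- Walking from the far side of x, the first vertex outside of it is x itself.
      far : ∀ {u} → WalkIn G M u x → D u ≡ false → WalkIn G (M ∖ D) u x
      far (here h) hD = here (∖⁺ M D h hD)
      far {u} (step {v = v} h a w) hD with u ≟ᶠ x
      ... | yes refl = here (∖⁺ M D h hD)
      ... | no ne = step (∖⁺ M D h hD) a (far w (≢true⇒false λ hv → true≢false (side-closed x b hv h ne (Adj-sym G a)) hD))
      path : Σ[ vs ∈ List (Fin n) ] SPath G S (M ∖ D) x vs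
      path with Vec.lookup S x ≟ᵇ true
      ... | yes xS = [] , end (∖⁺ M D hx x∉D) xS
      ... | no xS with separates hx xS hb b≢x
      ... | s , sS , s∉D = shortcut G (walkIn-reverse G (far (walkIn-++ G (walkIn-reverse G (connected (M-S sS))) (connected hx)) s∉D)) sS

  -- The pendant of `x` starts on the base side of `x'` and never visits `x'`, which lies on the
  -- side that this pendant avoids. So it stays on the base side of `x'`, and the pendant of `x'` is
  -- disjoint from that side and borders it only in `x'`.
  module TwoPendants {x b x' b'} (A : Pendant x b) (B : Pendant x' b') (x'∈ : Side x b x' ≡ true) (x∈ : Side x' b' x ≡ true) where
    private
      module A = Pendant A
      module B = Pendant B

    in-side : ∀ d i → toℕ i ≤ d → Side x' b' (A.q i) ≡ true
    in-side d fzero _ = subst (λ z → Side x' b' z ≡ true) (sym A.q-start) x∈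
    in-side (suc d) (fsuc i) (s≤s le) = side-closed x' b' (in-side d (inject₁ i) (subst (_≤ d) (sym (toℕ-inject₁ i)) le))
      (A.q-M (fsuc i)) (A.q-avoid (fsuc i) x'∈) (from (proj₂ A.q-path (inject₁ i) (fsuc i)) (inj₁ (cong suc (toℕ-inject₁ i))))

    apart : ∀ i j → A.q i ≢ B.q j
    apart i j e = B.q-avoid j (in-side _ i ≤-refl) (sym e)

    adj-start : ∀ i j → Adj G (A.q i) (B.q j) → toℕ j ≡ 0
    adj-start i j a = B.q-side j (in-side _ i ≤-refl) (Adj-sym G a)

-- Vertices of large degree

allpairs-lookup-≢ : ∀ {A : Set} {R : A → A → Set} {xs : List A} → (∀ {x y} → R x y → R y x) → AllPairs R xs →
  ∀ i j → i ≢ j → R (lookup xs i) (lookup xs j)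
allpairs-lookup-≢ R-sym ps i j ne with <-cmp (toℕ i) (toℕ j)
... | tri< lt _ _ = allpairs-lookup ps i j lt
... | tri≈ _ eq _ = ⊥-elim (ne (toℕ-injective eq))
... | tri> _ _ gt = R-sym (allpairs-lookup ps j i gt)

length-filter-split : ∀ {A : Set} (f : A → Bool) (xs : List A) →
  length xs ≡ length (filter (λ y → f y ≟ᵇ true) xs) + length (filter (λ y → f y ≟ᵇ false) xs)
length-filter-split f [] = refl
length-filter-split f (x ∷ xs) with f x
... | true = cong suc (length-filter-split f xs)
... | false = trans (cong suc (length-filter-split f xs)) (sym (ℕ.+-suc _ _))

-- The usual recursive upper bound for Ramsey numbers; the added one is the vertex whose neighbours
-- and non-neighbours are separated.
R : ℕ → ℕ → ℕ
R zero b = 0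
R (suc a) zero = 0
R (suc a) (suc b) = suc (R a (suc b) + R (suc a) b)

Homogeneous : {A : Set} → (A → A → Bool) → Bool → (A → Set) → ℕ → Set
Homogeneous {A} E v P k = Σ[ ys ∈ List A ] (length ys ≡ k × AllPairs (λ x y → x ≢ y × E x y ≡ v) ys × All P ys)

-- `P` is a parameter because the recursion strengthens it: the elements kept have to remember how
-- they are related to the chosen vertex.
ramsey : ∀ {A : Set} (E : A → A → Bool) (P : A → Set) a b (xs : List A) → R a b ≤ length xs → AllPairs _≢_ xs → All P xs →
  Homogeneous E true P a ⊎ Homogeneous E false P b
ramsey E P zero b xs le un all = inj₁ ([] , refl , [] , [])
ramsey E P (suc a) zero xs le un all = inj₂ ([] , refl , [] , [])
ramsey {A} E P (suc a) (suc b) (x ∷ xs) (s≤s le) (x∉ ∷ un) (px ∷ all) with R a (suc b) ≤? length (filter (λ y → E x y ≟ᵇ true) xs)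
... | yes le' = extend (ramsey E (λ y → P y × x ≢ y × E x y ≡ true) a (suc b) (filter (λ y → E x y ≟ᵇ true) xs) le' (AllPairsₚ.filter⁺ _ un)
        (All.zip (Allₚ.filter⁺ _ all , All.zip (Allₚ.filter⁺ _ x∉ , Allₚ.all-filter _ xs))))
  where
    extend : Homogeneous E true (λ y → P y × x ≢ y × E x y ≡ true) a ⊎ Homogeneous E false (λ y → P y × x ≢ y × E x y ≡ true) (suc b) →
      Homogeneous E true P (suc a) ⊎ Homogeneous E false P (suc b)
    extend (inj₁ (ys , l , ps , al)) = inj₁ (x ∷ ys , cong suc l , All.map proj₂ al ∷ ps , px ∷ All.map proj₁ al)
    extend (inj₂ (ys , l , ps , al)) = inj₂ (ys , l , ps , All.map proj₁ al)
... | no nle = extend (ramsey E (λ y → P y × x ≢ y × E x y ≡ false) (suc a) b (filter (λ y → E x y ≟ᵇ false) xs) le' (AllPairsₚ.filter⁺ _ un)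
        (All.zip (Allₚ.filter⁺ _ all , All.zip (Allₚ.filter⁺ _ x∉ , Allₚ.all-filter _ xs))))
  where
    le' : R (suc a) b ≤ length (filter (λ y → E x y ≟ᵇ false) xs)
    le' = ℕ.+-cancelˡ-≤ (R a (suc b)) _ _ (≤-trans le (≤-trans (≤-reflexive (length-filter-split (E x) xs)) (ℕ.+-monoˡ-≤ _ (<⇒≤ (≰⇒> nle)))))
    extend : Homogeneous E true (λ y → P y × x ≢ y × E x y ≡ false) (suc a) ⊎ Homogeneous E false (λ y → P y × x ≢ y × E x y ≡ false) b →
      Homogeneous E true P (suc a) ⊎ Homogeneous E false P (suc b)
    extend (inj₁ (ys , l , ps , al)) = inj₁ (ys , l , ps , All.map proj₁ al)
    extend (inj₂ (ys , l , ps , al)) = inj₂ (x ∷ ys , cong suc l , All.map proj₂ al ∷ ps , px ∷ All.map proj₁ al)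

singleton-path : ∀ {n} (G : Graph n) x → IsPathSeq G {1} (λ _ → x)
singleton-path G x = (λ { fzero fzero _ → refl }) , λ { fzero fzero → mk⇔ (λ h → ⊥-elim (Adj-irrefl G h refl)) (λ { (inj₁ ()) ; (inj₂ ()) }) }

module WideVertex {n : ℕ} (G : Graph n) (S : Subset n) (r : Fin n) (P : Pruned G S r) (x : Fin n) (x∈M : Pruned.M P x ≡ true) where

  open Pruned P
  open InPruned G S r P

  Nbr : Fin n → Set
  Nbr y = M y ≡ true × Adj G x y

  module Legs {v} (ys : List (Fin n)) (homogeneous : AllPairs (λ y y' → y ≢ y' × adj G y y' ≡ v) ys) (nbrs : All Nbr ys) where

    t : ℕ
    t = length ys

    y : Fin t → Fin n
    y = lookup ys

    y-M : ∀ j → M (y j) ≡ true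
    y-M j = proj₁ (all-lookup nbrs j)

    y-adj : ∀ j → Adj G x (y j)
    y-adj j = proj₂ (all-lookup nbrs j)

    y-pair : ∀ j j' → j ≢ j' → y j ≢ y j' × adj G (y j) (y j') ≡ v
    y-pair = allpairs-lookup-≢ (λ {a} {b} (ne , e) → ne ∘ sym , trans (Graph.sym G b a) e) homogeneous

    pend : ∀ j → Pendant (y j) x
    pend j = pendant (y j) x (y-M j) x∈M (Adj-irrefl G (y-adj j))

    ℓ : Fin t → ℕ
    ℓ j = Pendant.k (pend j)

    q : ∀ j → Fin (suc (ℓ j)) → Fin n
    q j = Pendant.q (pend j)

    q-S : ∀ j a → q j a inS S ⇔ (toℕ a ≡ ℓ j)
    q-S j = Pendant.q-S (pend j)

    q-start : ∀ j a → toℕ a ≡ 0 → q j a ≡ y j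
    q-start j fzero _ = Pendant.q-start (pend j)

    -- The common neighbour `x` is the base of all pendants. A single edge at `x` leads to `y j'`,
    -- so `y j` does not cut it off.
    other-side : ∀ j j' → j ≢ j' → Side (y j) x (y j') ≡ true
    other-side j j' ne = side-closed (y j) x (side-base (y j) x) (y-M j') (λ e → proj₁ (y-pair j j' ne) (sym e)) (y-adj j')

    q≢q : ∀ j j' a a' → j ≢ j' → q j a ≢ q j' a'
    q≢q j j' a a' ne = TwoPendants.apart (pend j) (pend j') (other-side j j' ne) (other-side j' j (ne ∘ sym)) a a'

    q-q-start : ∀ j j' a a' → j ≢ j' → Adj G (q j a) (q j' a') → toℕ a ≡ 0 × toℕ a' ≡ 0
    q-q-start j j' a a' ne h =
      TwoPendants.adj-start (pend j') (pend j) (other-side j' j (ne ∘ sym)) (other-side j j' ne) a' a (Adj-sym G h) ,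
      TwoPendants.adj-start (pend j) (pend j') (other-side j j' ne) (other-side j' j (ne ∘ sym)) a a' h

    q-q-starts : ∀ j j' a a' → j ≢ j' → toℕ a ≡ 0 → toℕ a' ≡ 0 → adj G (q j a) (q j' a') ≡ v
    q-q-starts j j' a a' ne e e' = trans (cong₂ (adj G) (q-start j a e) (q-start j' a' e')) (proj₂ (y-pair j j' ne))

  clique-case : ∀ η → 2 ≤ η → Homogeneous (adj G) true Nbr η → ConnectifierIn G S η
  clique-case .(length ys) η≥2 (ys , refl , hom , nbrs) = LineStarConnectifier.connectifier G S (length ys) ℓ η≥2 comb q-S
    where
      open Legs ys hom nbrs
      -- The core has no edges and `x` is left out: the clique of the `y j` is formed by the edges
      -- at the centre of the star.
      comb : InducedLineComb G 0 (length ys) ℓ (λ _ → fzero)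
      comb = record { p = λ () ; q = q ; p-path = (λ ()) , (λ ()) ; q-path = λ j → Pendant.q-path (pend j) ; p≢q = λ () ; p-q = λ () ; q≢q = q≢q
        ; q-q = λ j j' a a' ne → mk⇔ (λ h → proj₁ (q-q-start j j' a a' ne h) , proj₂ (q-q-start j j' a a' ne h) , refl) (λ (e , e' , _) → q-q-starts j j' a a' ne e e') }

  module StableLegs (ys : List (Fin n)) (hom : AllPairs (λ y y' → y ≢ y' × adj G y y' ≡ false) ys) (nbrs : All Nbr ys) where
    open Legs ys hom nbrs public
    comb : InducedComb G 0 (length ys) ℓ (λ _ → fzero)
    comb = record
      { p = λ _ → x ; q = q ; p-path = singleton-path G x ; q-path = λ j → Pendant.q-path (pend j)
      ; p≢q = λ k j a e → Pendant.q-avoid (pend j) a (side-base (y j) x) (sym e)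
      ; p-q = λ { fzero j a → mk⇔ (λ h → Pendant.q-side (pend j) a (side-base (y j) x) (Adj-sym G h) , refl)
                                   (λ (e , _) → subst (Adj G x) (sym (q-start j a e)) (y-adj j)) }
      ; q≢q = q≢q
      ; q-q = λ j j' a a' ne h → let (e , e') = q-q-start j j' a a' ne h in true≢false h (q-q-starts j j' a a' ne e e') }

  -- If the centre lies in `S`, it counts as one of the `η` vertices and one neighbour is dropped.
  -- The bound three ensures that two legs remain.
  stable-case : ∀ η → 3 ≤ η → Homogeneous (adj G) false Nbr η → ConnectifierIn G S η
  stable-case η η≥3 (ys , e , hom , nbrs) with Vec.lookup S x ≟ᵇ true
  stable-case .(length ys) η≥3 (ys , refl , hom , nbrs) | no x∉S = StarConnectifier.connectifier G S (length ys) ℓ (≤-trans (n≤1+n 2) η≥3) comb q-S x∉S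
    where open StableLegs ys hom nbrs
  stable-case .(suc (length ys)) η≥3 (y ∷ ys , refl , (_ ∷ hom) , (_ ∷ nbrs)) | yes x∈S = StarConnectifier.connectifier-root G S (length ys) ℓ (≤-pred η≥3) comb q-S x∈S
    where open StableLegs ys hom nbrs

  wide : ∀ η → 3 ≤ η → (ys : List (Fin n)) → R η η ≤ length ys → AllPairs _≢_ ys → All Nbr ys → ConnectifierIn G S η
  wide η η≥3 ys le un nbrs with ramsey (adj G) Nbr η η ys le un nbrs
  ... | inj₁ h = clique-case η (≤-trans (n≤1+n 2) η≥3) h
  ... | inj₂ h = stable-case η η≥3 h

-- Breadth-first search in bounded degree

least : ∀ (f : ℕ → Bool) k → f k ≡ true → Σ[ j ∈ ℕ ] (f j ≡ true × (∀ i → f i ≡ true → j ≤ i))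
least f k h with f 0 in e
... | true = 0 , e , λ _ _ → z≤n
least f zero h | false = ⊥-elim (true≢false h e)
least f (suc k) h | false with least (f ∘ suc) k h
... | j , hj , mn = suc j , hj , λ { zero hi → ⊥-elim (true≢false hi e) ; (suc i) hi → s≤s (mn i hi) }

∨-true : ∀ a {b} → a ∨ b ≡ true → a ≡ true ⊎ b ≡ true
∨-true true _ = inj₁ refl
∨-true false h = inj₂ h

∨-trueʳ : ∀ a {b} → b ≡ true → a ∨ b ≡ true
∨-trueʳ true _ = refl
∨-trueʳ false h = h

-- Induction over the holes: either the first one receives more than `k` elements, or removing its
-- at most `k` elements leaves enough for the other holes.
pigeonhole-list : ∀ {n} {A : Set} (ch : A → Fin n) k (ys : List (Fin n)) (xs : List A) → All (λ x → Any (ch x ≡_) ys) xs →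
  k * length ys < length xs → Σ[ y ∈ Fin n ] k < length (filter (λ x → does (ch x ≟ᶠ y) ≟ᵇ true) xs)
pigeonhole-list ch k [] (x ∷ xs) (() ∷ _) lt
pigeonhole-list ch k [] [] _ lt = ⊥-elim (ℕ.n≮0 lt)
pigeonhole-list ch k (y ∷ ys) xs mem lt with k <? length (filter (λ x → does (ch x ≟ᶠ y) ≟ᵇ true) xs)
... | yes h = y , h
... | no nh with pigeonhole-list ch k ys (filter (λ x → does (ch x ≟ᶠ y) ≟ᵇ false) xs)
      (All.map (λ (m , e) → drop m e) (All.zip (Allₚ.filter⁺ _ mem , Allₚ.all-filter _ xs)))
      (ℕ.+-cancelˡ-< k _ _ (<-≤-trans (subst (_< length xs) (ℕ.*-suc k (length ys)) lt)
        (≤-trans (≤-reflexive (length-filter-split _ xs)) (ℕ.+-monoˡ-≤ _ (ℕ.≮⇒≥ nh)))))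
  where
    drop : ∀ {x} → Any (ch x ≡_) (y ∷ ys) → does (ch x ≟ᶠ y) ≡ false → Any (ch x ≡_) ys
    drop (here e) ne = ⊥-elim (does-false⇒¬ (ch _ ≟ᶠ y) ne e)
    drop (there m) _ = m
... | z , h = z , ≤-trans h (length-filter-filter xs)
  where
    length-filter-filter : ∀ xs → length (filter (λ x → does (ch x ≟ᶠ z) ≟ᵇ true) (filter (λ x → does (ch x ≟ᶠ y) ≟ᵇ false) xs))
                                   ≤ length (filter (λ x → does (ch x ≟ᶠ z) ≟ᵇ true) xs)
    length-filter-filter [] = z≤n
    length-filter-filter (x ∷ xs) with does (ch x ≟ᶠ y)
    ... | true with does (ch x ≟ᶠ z)
    ... | true = ≤-trans (length-filter-filter xs) (n≤1+n _)
    ... | false = length-filter-filter xs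
    length-filter-filter (x ∷ xs) | false with does (ch x ≟ᶠ z)
    ... | true = s≤s (length-filter-filter xs)
    ... | false = length-filter-filter xs

unique-constant : ∀ {A : Set} {v : A} {xs : List A} → AllPairs _≢_ xs → All (_≡ v) xs → length xs ≤ 1
unique-constant [] _ = z≤n
unique-constant ([] ∷ _) _ = s≤s z≤n
unique-constant ((ne ∷ _) ∷ _) (refl ∷ refl ∷ _) = ⊥-elim (ne refl)

-- The number of targets that guarantees `L` useful levels when every vertex has at most `B`
-- neighbours. Of the two spare units, one pays for a target that ends at the current vertex and the
-- other makes the pigeonhole inequality strict.
threshold : ℕ → ℕ → ℕ
threshold B zero = 1
threshold B (suc L) = suc (suc (threshold B L * B))

module BFS {n : ℕ} (G : Graph n) (M : Fin n → Bool) (r : Fin n) (r∈M : M r ≡ true) (conn : ∀ {u} → M u ≡ true → WalkIn G M r u) where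

  Ball : ℕ → Fin n → Bool
  Ball zero x = does (x ≟ᶠ r)
  Ball (suc k) x = Ball k x ∨ (M x ∧ does (any? (λ y → (Ball k y ≟ᵇ true) ×-dec (adj G y x ≟ᵇ true))))

  ball-M : ∀ k {x} → Ball k x ≡ true → M x ≡ true
  ball-M zero {x} h = subst (λ z → M z ≡ true) (sym (to (does-true (x ≟ᶠ r)) h)) r∈M
  ball-M (suc k) {x} h with ∨-true (Ball k x) h
  ... | inj₁ h' = ball-M k h'
  ... | inj₂ h' = proj₁ (∧-true⁻ (M x) h')

  ball-step : ∀ k {y x} → Ball k y ≡ true → Adj G y x → M x ≡ true → Ball (suc k) x ≡ true
  ball-step k {y} {x} hy a hx = ∨-trueʳ (Ball k x) (∧-true hx (dec-true (any? _) (y , hy , a)))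

  ball-step⁻ : ∀ k {x} → Ball (suc k) x ≡ true → Ball k x ≡ true ⊎ (Σ[ y ∈ Fin n ] (Ball k y ≡ true × Adj G y x))
  ball-step⁻ k {x} h with ∨-true (Ball k x) h
  ... | inj₁ h' = inj₁ h'
  ... | inj₂ h' = inj₂ (to (does-true (any? (λ y → (Ball k y ≟ᵇ true) ×-dec (adj G y x ≟ᵇ true)))) (proj₂ (∧-true⁻ (M x) h')))

  ball-walk : ∀ {u x} k → Ball k u ≡ true → WalkIn G M u x → Σ[ k' ∈ ℕ ] Ball k' x ≡ true
  ball-walk k h (here _) = k , h
  ball-walk k h (step _ a w) = ball-walk (suc k) (ball-step k h a (walkIn-start G w)) w

  abstract
    -- The distance from `r` inside `M`; outside `M` the value 0 is a placeholder.
    distance : ∀ x → Σ[ k ∈ ℕ ] (M x ≡ true → Ball k x ≡ true × (∀ i → Ball i x ≡ true → k ≤ i))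
    distance x with M x ≟ᵇ true
    ... | no h = 0 , λ h' → ⊥-elim (h h')
    ... | yes h with ball-walk 0 (dec-true (r ≟ᶠ r) refl) (conn h)
    ... | k , hk with least (λ i → Ball i x) k hk
    ... | j , hj , mn = j , λ _ → hj , mn

  d : Fin n → ℕ
  d x = proj₁ (distance x)

  d-adj : ∀ {x y} → M x ≡ true → M y ≡ true → Adj G x y → d y ≤ suc (d x)
  d-adj {x} {y} hx hy a = proj₂ (proj₂ (distance y) hy) _ (ball-step (d x) (proj₁ (proj₂ (distance x) hx)) a hy)

  parent-exists : ∀ {x} k → M x ≡ true → d x ≡ suc k → Σ[ y ∈ Fin n ] (M y ≡ true × Adj G y x × suc (d y) ≡ d x)
  parent-exists {x} k h e with ball-step⁻ k (subst (λ z → Ball z x ≡ true) e (proj₁ (proj₂ (distance x) h)))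
  ... | inj₁ h' = ⊥-elim (ℕ.1+n≰n (≤-trans (≤-reflexive (sym e)) (proj₂ (proj₂ (distance x) h) k h')))
  ... | inj₂ (y , hy , a) = y , ball-M k hy , a ,
        ≤-antisym (≤-trans (s≤s (proj₂ (proj₂ (distance y) (ball-M k hy)) k hy)) (≤-reflexive (sym e))) (d-adj (ball-M k hy) h a)

  abstract
    parent : ∀ x → Σ[ y ∈ Fin n ] (∀ k → M x ≡ true → d x ≡ suc k → M y ≡ true × Adj G y x × d y ≡ k)
    parent x with any? (λ y → (M y ≟ᵇ true) ×-dec ((adj G y x ≟ᵇ true) ×-dec (suc (d y) ℕ.≟ d x)))
    ... | yes (y , hM , a , e) = y , λ k _ e' → hM , a , ℕ.suc-injective (trans e e')
    ... | no none = x , λ k h e → ⊥-elim (none (parent-exists k h e))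

  ancestor : ℕ → Fin n → Fin n
  ancestor zero s = s
  ancestor (suc k) s = proj₁ (parent (ancestor k s))

  ancestor-level : ∀ k i {s} → M s ≡ true → d s ≡ k + i → M (ancestor k s) ≡ true × d (ancestor k s) ≡ i
  ancestor-level zero i h e = h , e
  ancestor-level (suc k) i {s} h e with ancestor-level k (suc i) h (trans e (sym (ℕ.+-suc k i)))
  ... | hM , hd with proj₂ (parent (ancestor k s)) i hM hd
  ... | hM' , _ , hd' = hM' , hd'

  -- The path is indexed by the level, from the root to `s`; past level `d s` the truncated
  -- subtraction repeats `s`.
  p : Fin n → ℕ → Fin n
  p s i = ancestor (d s ∸ i) s

  p-level : ∀ {s} → M s ≡ true → ∀ i → i ≤ d s → M (p s i) ≡ true × d (p s i) ≡ i
  p-level {s} h i le = ancestor-level (d s ∸ i) i h (sym (ℕ.m∸n+n≡m le))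

  p-end : ∀ s → p s (d s) ≡ s
  p-end s = cong (λ z → ancestor z s) (ℕ.n∸n≡0 (d s))

  d-zero : ∀ {x} → M x ≡ true → d x ≡ 0 → x ≡ r
  d-zero {x} h e = to (does-true (x ≟ᶠ r)) (subst (λ z → Ball z x ≡ true) e (proj₁ (proj₂ (distance x) h)))

  p-start : ∀ {s} → M s ≡ true → p s 0 ≡ r
  p-start h = let (hM , hd) = p-level h 0 z≤n in d-zero hM hd

  p-adj : ∀ {s} → M s ≡ true → ∀ i → i < d s → Adj G (p s i) (p s (suc i))
  p-adj {s} h i lt = subst (λ z → Adj G z (p s (suc i))) (cong (λ z → ancestor z s) (sym (ℕ.+-∸-assoc 1 lt)))
    (proj₁ (proj₂ (proj₂ (parent (p s (suc i))) i (proj₁ lv) (proj₂ lv))))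
    where lv = p-level h (suc i) lt

  -- Levels of adjacent vertices differ by at most one, and the path has one vertex per level; hence
  -- it has no chords.
  p-consecutive : ∀ {s} → M s ≡ true → ∀ i j → i ≤ d s → j ≤ d s → Adj G (p s i) (p s j) ⇔ Consecutive i j
  p-consecutive {s} h i j hi hj = mk⇔ fwd bwd
    where
      Mi = proj₁ (p-level h i hi)
      Mj = proj₁ (p-level h j hj)
      di = proj₂ (p-level h i hi)
      dj = proj₂ (p-level h j hj)
      fwd : Adj G (p s i) (p s j) → Consecutive i j
      fwd a with <-cmp i j
      ... | tri< lt _ _ = inj₁ (≤-antisym lt (subst₂ (λ x y → y ≤ suc x) di dj (d-adj Mi Mj a)))
      ... | tri≈ _ refl _ = ⊥-elim (Adj-irrefl G a refl)
      ... | tri> _ _ gt = inj₂ (≤-antisym gt (subst₂ (λ x y → y ≤ suc x) dj di (d-adj Mj Mi (Adj-sym G a))))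
      bwd : Consecutive i j → Adj G (p s i) (p s j)
      bwd (inj₁ refl) = p-adj h i hj
      bwd (inj₂ refl) = Adj-sym G (p-adj h j hi)

  p-injective : ∀ {s} → M s ≡ true → ∀ i j → i ≤ d s → j ≤ d s → p s i ≡ p s j → i ≡ j
  p-injective h i j hi hj e = trans (sym (proj₂ (p-level h i hi))) (trans (cong d e) (proj₂ (p-level h j hj)))

  Fork : Fin n → ℕ → Set
  Fork s i = i < d s × (Σ[ y ∈ Fin n ] (M y ≡ true × Adj G (p s i) y × d y ≡ suc i × y ≢ p s (suc i)))

  neighbours : Fin n → List (Fin n)
  neighbours v = filter (λ y → (M y ≟ᵇ true) ×-dec (adj G v y ≟ᵇ true)) (allFin n)

  module Chain (S : Subset n) (M-S : ∀ {s} → s inS S → M s ≡ true) (B : ℕ) (bounded : ∀ v → M v ≡ true → length (neighbours v) ≤ B) where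

    Useful : Fin n → ℕ → Set
    Useful s i = p s i inS S ⊎ Fork s i

    -- The targets `s` in `S` whose root path passes `v` at level `i`; `fuel` bounds the number of
    -- levels still to go.
    Below : ℕ → ℕ → Fin n → Fin n → Set
    Below fuel i v s = s inS S × i ≤ d s × p s i ≡ v × d s ≤ i + fuel

    UsefulPath : ℕ → ℕ → List (Fin n) → Set
    UsefulPath L i Ls = Σ[ s ∈ Fin n ] (Any (s ≡_) Ls × (Σ[ U ∈ List ℕ ] (length U ≡ L × AllPairs _<_ U × All (λ u → i ≤ u × u ≤ d s × Useful s u) U)))

    child-or-end : ∀ {fuel i v s} → Below fuel i v s → ¬ (i < d s) → s ≡ v
    child-or-end {s = s} (_ , le , e , _) nlt = trans (sym (p-end s)) (trans (cong (p s) (≤-antisym (ℕ.≮⇒≥ nlt) le)) e)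

    -- All root paths to the targets pass `v`. The group that continues through the most popular
    -- child `y` is large enough for `L` further levels. Level `i` is useful for this group if `v`
    -- is in `S`, or if some other target leaves `v` by a different child, which is then the fork
    -- vertex. Otherwise all targets continue to `y`, and the descent goes on with the same list and
    -- the same `L`.
    chain : ∀ fuel L i v (Ls : List (Fin n)) → All (Below fuel i v) Ls → AllPairs _≢_ Ls → threshold B L ≤ length Ls → UsefulPath L i Ls
    chain fuel zero i v (s ∷ Ls) bs un le = s , here refl , [] , refl , [] , []
    chain fuel (suc L) i v Ls bs un le = result fuel bs
      where
        deeper : Fin n → Bool
        deeper s = does (i <? d s)
        Ls' = filter (λ s → deeper s ≟ᵇ true) Ls
        ch : Fin n → Fin n
        ch s = p s (suc i)
        at-v : length (filter (λ s → deeper s ≟ᵇ false) Ls) ≤ 1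
        at-v = unique-constant (AllPairsₚ.filter⁺ _ un)
          (All.map (λ {s} (b , e) → child-or-end b (does-false⇒¬ (i <? d s) e)) (All.zip (Allₚ.filter⁺ _ bs , Allₚ.all-filter _ Ls)))
        many : threshold B L * B < length Ls'
        many = ℕ.+-cancelʳ-≤ 1 _ _ (≤-trans (≤-reflexive (ℕ.+-comm _ 1)) (≤-trans le (≤-trans (≤-reflexive (length-filter-split deeper Ls)) (ℕ.+-monoʳ-≤ (length Ls') at-v))))
        Ls'-below : All (λ s → Below fuel i v s × i < d s) Ls'
        Ls'-below = All.zip (Allₚ.filter⁺ _ bs , All.map (λ {s} e → to (does-true (i <? d s)) e) (Allₚ.all-filter _ Ls))
        v∈M : M v ≡ true
        v∈M with Ls' | Ls'-below | many
        ... | [] | _ | ()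
        ... | s ∷ _ | ((sS , le , e , _) , _) ∷ _ | _ = subst (λ z → M z ≡ true) e (proj₁ (p-level (M-S sS) i le))
        ch-M : ∀ {s} → Below fuel i v s → i < d s → M (ch s) ≡ true × Adj G v (ch s) × d (ch s) ≡ suc i
        ch-M {s} (sS , _ , e , _) lt = proj₁ (p-level (M-S sS) (suc i) lt) , subst (λ z → Adj G z (ch s)) e (p-adj (M-S sS) i lt) , proj₂ (p-level (M-S sS) (suc i) lt)
        children : All (λ s → Any (ch s ≡_) (neighbours v)) Ls'
        children = All.map (λ (b , lt) → let (hM , a , _) = ch-M b lt in ∈-filter⁺ _ (∈-allFin _) (hM , a)) Ls'-below
        popular : Σ[ y ∈ Fin n ] threshold B L < length (filter (λ s → does (ch s ≟ᶠ y) ≟ᵇ true) Ls')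
        popular = pigeonhole-list ch (threshold B L) (neighbours v) Ls' children (≤-<-trans (ℕ.*-monoʳ-≤ (threshold B L) (bounded v v∈M)) many)
        y = proj₁ popular
        group = filter (λ s → does (ch s ≟ᶠ y) ≟ᵇ true) Ls'
        group-below : All (λ s → Below fuel i v s × i < d s × ch s ≡ y) group
        group-below = All.map (λ {s} ((b , lt) , e) → b , lt , to (does-true (ch s ≟ᶠ y)) e) (All.zip (Allₚ.filter⁺ _ Ls'-below , Allₚ.all-filter _ Ls'))
        group-⊆ : ∀ {s} → Any (s ≡_) group → Any (s ≡_) Ls
        group-⊆ m = proj₁ (∈-filter⁻ (λ s → deeper s ≟ᵇ true) {xs = Ls} (proj₁ (∈-filter⁻ (λ s → does (ch s ≟ᶠ y) ≟ᵇ true) {xs = Ls'} m)))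
        lower : ∀ {fuel' s} → Below (suc fuel') i v s → i < d s → ch s ≡ y → Below fuel' (suc i) y s
        lower {fuel'} (sS , _ , _ , le) lt e = sS , lt , e , ≤-trans le (≤-reflexive (ℕ.+-suc i fuel'))
        result : ∀ fuel₀ → All (Below fuel₀ i v) Ls → UsefulPath (suc L) i Ls
        result zero bs₀ = none-deeper (All.zip (Allₚ.filter⁺ (λ s → deeper s ≟ᵇ true) bs₀ , Ls'-below)) (≤-<-trans z≤n many)
          where
            none-deeper : ∀ {xs} → All (λ s → Below 0 i v s × Below fuel i v s × i < d s) xs → 0 < length xs → UsefulPath (suc L) i Ls
            none-deeper (((_ , _ , _ , le₀) , _ , lt) ∷ _) _ = ⊥-elim (<⇒≱ lt (≤-trans le₀ (≤-reflexive (ℕ.+-identityʳ i))))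
        result (suc fuel') bs₀ = decide (Vec.lookup S v ≟ᵇ true) (Any.any? (λ s → (i <? d s) ×-dec ¬? (ch s ≟ᶠ y)) Ls)
          where
            group-lower : All (Below fuel' (suc i) y) group
            group-lower = All.zipWith (λ (b , _ , lt , e) → lower b lt e) (Allₚ.filter⁺ _ (Allₚ.filter⁺ _ bs₀) , group-below)
            gain : (∀ {s} → Below fuel i v s × i < d s × ch s ≡ y → Useful s i) → UsefulPath (suc L) i Ls
            gain useful = extend (chain fuel' L (suc i) y group group-lower (AllPairsₚ.filter⁺ _ (AllPairsₚ.filter⁺ _ un)) (<⇒≤ (proj₂ popular)))
              where
                extend : UsefulPath L (suc i) group → UsefulPath (suc L) i Ls
                extend (s , m , U , len , inc , all) = s , group-⊆ m , i ∷ U , cong suc len , All.map proj₁ all ∷ inc ,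
                    (≤-refl , <⇒≤ (proj₁ (proj₂ b)) , useful b) ∷ All.map (λ (l , rest) → <⇒≤ l , rest) all
                  where b = All.lookup group-below m
            decide : Dec (v inS S) → Dec (Any (λ s → i < d s × ch s ≢ y) Ls) → UsefulPath (suc L) i Ls
            decide (yes vS) _ = gain (λ ((_ , _ , e , _) , _) → inj₁ (subst (_inS S) (sym e) vS))
            decide (no _) (yes other) with find other
            ... | s' , m' , lt' , ne' = gain (λ ((_ , _ , e , _) , lt , e') → inj₂ (lt , ch s' , proj₁ cs' , subst (λ z → Adj G z (ch s')) (sym e) (proj₁ (proj₂ cs')) , proj₂ (proj₂ cs') , λ e'' → ne' (trans e'' e')))
              where cs' = ch-M (All.lookup bs m') lt'
            decide (no v∉S) (no same) = weaken (chain fuel' (suc L) (suc i) y Ls all-lower un le)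
              where
                weaken : UsefulPath (suc L) (suc i) Ls → UsefulPath (suc L) i Ls
                weaken (s , m , U , len , inc , all) = s , m , U , len , inc , All.map (λ (l , rest) → <⇒≤ l , rest) all
                -- A target that ends here would be `v` itself and put `v` into `S`; so no target is
                -- lost in this step.
                step-down : ∀ {s} → Below (suc fuel') i v s → ¬ (i < d s × ch s ≢ y) → Dec (i < d s) → Dec (ch s ≡ y) → Below fuel' (suc i) y s
                step-down b nb (no nlt) _ = ⊥-elim (v∉S (subst (_inS S) (child-or-end b nlt) (proj₁ b)))
                step-down b nb (yes lt) (yes e) = lower b lt e
                step-down b nb (yes lt) (no ne) = ⊥-elim (nb (lt , ne))
                all-lower : All (Below fuel' (suc i) y) Ls
                all-lower = All.zipWith (λ {s} (b , nb) → step-down b nb (i <? d s) (ch s ≟ᶠ y)) (bs₀ , Allₚ.¬Any⇒All¬ Ls same)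

-- Marked positions on a path

module Marks (flag : ℕ → Set) (flag? : ∀ i → Dec (flag i)) where

  Gap : ℕ → ℕ → Set
  Gap a b = ∀ k → a < k → k < b → ¬ flag k

  next : ∀ {a D} → a < D → flag D → Σ[ b ∈ ℕ ] (a < b × b ≤ D × flag b × Gap a b)
  next {a} {D} lt hD = suc a + j , ℕ.m≤m+n (suc a) j , below , to (does-true (flag? (suc a + j))) hj , gap
    where
      f : ℕ → Bool
      f i = does (flag? (suc a + i))
      D≡ : suc a + (D ∸ suc a) ≡ D
      D≡ = ℕ.m+[n∸m]≡n lt
      found = least f (D ∸ suc a) (from (does-true (flag? _)) (subst flag (sym D≡) hD))
      j = proj₁ found
      hj = proj₁ (proj₂ found)
      below : suc a + j ≤ D
      below = ≤-trans (ℕ.+-monoʳ-≤ (suc a) (proj₂ (proj₂ found) _ (from (does-true (flag? _)) (subst flag (sym D≡) hD)))) (≤-reflexive D≡)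
      gap : Gap a (suc a + j)
      gap k a<k k<b hk = <⇒≱ k<b (≤-trans (ℕ.+-monoʳ-≤ (suc a) (proj₂ (proj₂ found) (k ∸ suc a) (from (does-true (flag? _)) (subst flag (sym k≡) hk)))) (≤-reflexive k≡))
        where
          k≡ : suc a + (k ∸ suc a) ≡ k
          k≡ = ℕ.m+[n∸m]≡n a<k

  -- The gaps make the listed flags consecutive, so `k` is the exact number of flagged positions
  -- from `a` to `e`. Exactness is what a path connectifier needs.
  data Run : ℕ → ℕ → ℕ → Set where
    one  : ∀ {a} → flag a → Run a a 1
    cons : ∀ {a b e k} → flag a → a < b → Gap a b → Run b e k → Run a e (suc k)

  position : ∀ {a e k} → Run a e k → Fin k → ℕ
  position {a} (one _) fzero = a
  position {a} (cons _ _ _ R) fzero = a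
  position (cons _ _ _ R) (fsuc i) = position R i

  run-≤ : ∀ {a e k} → Run a e k → a ≤ e
  run-≤ (one _) = ≤-refl
  run-≤ (cons _ lt _ R) = ≤-trans (<⇒≤ lt) (run-≤ R)

  position-≤ : ∀ {a e k} (R : Run a e k) i → position R i ≤ e
  position-≤ (one _) fzero = ≤-refl
  position-≤ R@(cons _ _ _ _) fzero = run-≤ R
  position-≤ (cons _ _ _ R) (fsuc i) = position-≤ R i

  position-≥ : ∀ {a e k} (R : Run a e k) i → a ≤ position R i
  position-≥ (one _) fzero = ≤-refl
  position-≥ (cons _ _ _ _) fzero = ≤-refl
  position-≥ (cons _ lt _ R) (fsuc i) = ≤-trans (<⇒≤ lt) (position-≥ R i)

  position-mono : ∀ {a e k} (R : Run a e k) i j → toℕ i < toℕ j → position R i < position R j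
  position-mono (one _) fzero fzero ()
  position-mono (cons _ lt _ R) fzero (fsuc j) _ = <-≤-trans lt (position-≥ R j)
  position-mono (cons _ _ _ R) (fsuc i) (fsuc j) (s≤s lt) = position-mono R i j lt

  position-first : ∀ {a e k} (R : Run a e k) i → toℕ i ≡ 0 → position R i ≡ a
  position-first (one _) fzero _ = refl
  position-first (cons _ _ _ _) fzero _ = refl

  run-pos : ∀ {a e k} → Run a e k → 1 ≤ k
  run-pos (one _) = s≤s z≤n
  run-pos (cons _ _ _ _) = s≤s z≤n

  position-last : ∀ {a e k} (R : Run a e k) i → suc (toℕ i) ≡ k → position R i ≡ e
  position-last (one _) fzero _ = refl
  position-last (cons _ _ _ R) fzero refl with run-pos R
  ... | ()
  position-last (cons _ _ _ R) (fsuc i) e = position-last R i (ℕ.suc-injective e)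

  position-flag : ∀ {a e k} (R : Run a e k) i → flag (position R i)
  position-flag (one h) fzero = h
  position-flag (cons h _ _ _) fzero = h
  position-flag (cons _ _ _ R) (fsuc i) = position-flag R i

  position-covers : ∀ {a e k} (R : Run a e k) m → a ≤ m → m ≤ e → flag m → ∃[ i ] position R i ≡ m
  position-covers (one _) m lo hi _ = fzero , ≤-antisym lo hi
  position-covers {a} (cons {b = b} _ lt gap R) m lo hi h with a ℕ.≟ m
  ... | yes e = fzero , e
  ... | no ne with b ≤? m
  ... | yes le = let (i , e) = position-covers R m le hi h in fsuc i , e
  ... | no nle = ⊥-elim (gap m (≤∧≢⇒< lo ne) (≰⇒> nle) h)

  record Segment (D : ℕ) (Q : ℕ → Set) (g : ℕ) : Set where
    field
      a b    : ℕ
      a<b    : a < b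
      b≤D    : b ≤ D
      flag-a : flag a
      flag-b : flag b
      gap    : Gap a b
      U      : List ℕ
      long   : g ≤ length U
      sorted : AllPairs _<_ U
      inside : All (λ u → a < u × u < b × Q u) U

  room : ∀ {a D k} {Q : ℕ → Set} U → All (λ u → a < u × u ≤ D × Q u) U → suc k ≤ length U → a < D
  room _ ((lt , le , _) ∷ _) _ = <-≤-trans lt le

  -- Passing from one flag to the next either finds `g` listed positions strictly between them or
  -- uses up at most `g + 1`: those before the next flag and the flag itself. So `e * suc g`
  -- positions pay for `e` passages, which visit `e + 1` flags. The flag at `D` guarantees that a
  -- next one exists.
  run-or-segment : ∀ {D} (Q : ℕ → Set) g → flag D → ∀ e a U → flag a → a ≤ D → AllPairs _<_ U → All (λ u → a < u × u ≤ D × Q u) U →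
    e * suc g ≤ length U → (Σ[ stop ∈ ℕ ] stop ≤ D × Run a stop (suc e)) ⊎ Segment D Q g
  run-or-segment Q g hD zero a U ha a≤D inc all le = inj₁ (a , a≤D , one ha)
  run-or-segment {D} Q g hD (suc e) a U ha a≤D inc all le with next {a} {D} (room U all le) hD
  ... | b , a<b , b≤D , hb , gap with g ≤? length (filter (λ u → does (u <? b) ≟ᵇ true) U)
  ... | yes long = inj₂ (record { a = a ; b = b ; a<b = a<b ; b≤D = b≤D ; flag-a = ha ; flag-b = hb ; gap = gap ; U = filter (λ u → does (u <? b) ≟ᵇ true) U ; long = long
      ; sorted = AllPairsₚ.filter⁺ _ inc
      ; inside = All.map (λ {u} ((lt , _ , q) , h) → lt , to (does-true (u <? b)) h , q) (All.zip (Allₚ.filter⁺ _ all , Allₚ.all-filter _ U)) })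
  ... | no short = continue (run-or-segment Q g hD e b U₃ hb b≤D (AllPairsₚ.filter⁺ _ (AllPairsₚ.filter⁺ _ inc)) all₃ enough)
    where
      f₁ f₂ : ℕ → Bool
      f₁ u = does (u <? b)
      f₂ u = does (b <? u)
      U₁ = filter (λ u → f₁ u ≟ᵇ true) U
      U₂ = filter (λ u → f₁ u ≟ᵇ false) U
      U₃ = filter (λ u → f₂ u ≟ᵇ true) U₂
      U₄ = filter (λ u → f₂ u ≟ᵇ false) U₂
      all₃ : All (λ u → b < u × u ≤ D × Q u) U₃
      all₃ = All.map (λ {u} ((_ , rest) , h) → to (does-true (b <? u)) h , rest) (All.zip (Allₚ.filter⁺ _ (Allₚ.filter⁺ _ all) , Allₚ.all-filter _ U₂))
      at-b : length U₄ ≤ 1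
      at-b = unique-constant (AllPairs.map <⇒≢ (AllPairsₚ.filter⁺ _ (AllPairsₚ.filter⁺ _ inc)))
        (All.map (λ {u} (h , h') → ≤-antisym (ℕ.≮⇒≥ (does-false⇒¬ (b <? u) h')) (ℕ.≮⇒≥ (does-false⇒¬ (u <? b) h)))
          (All.zip (Allₚ.filter⁺ _ (Allₚ.all-filter (λ u → f₁ u ≟ᵇ false) U) , Allₚ.all-filter (λ u → f₂ u ≟ᵇ false) U₂)))
      enough : e * suc g ≤ length U₃
      enough = ℕ.+-cancelˡ-≤ (suc g) _ _ (≤-trans le (≤-trans (≤-reflexive (length-filter-split f₁ U))
        (≤-trans (ℕ.+-mono-≤ (<⇒≤ (≰⇒> short)) (≤-trans (≤-reflexive (length-filter-split f₂ U₂)) (ℕ.+-monoʳ-≤ (length U₃) at-b)))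
          (≤-reflexive (trans (sym (ℕ.+-assoc g (length U₃) 1)) (ℕ.+-comm _ 1))))))
      continue : (Σ[ stop ∈ ℕ ] stop ≤ D × Run b stop (suc e)) ⊎ Segment D Q g → (Σ[ stop ∈ ℕ ] stop ≤ D × Run a stop (suc (suc e))) ⊎ Segment D Q g
      continue (inj₁ (stop , le' , R)) = inj₁ (stop , le' , cons ha a<b gap R)
      continue (inj₂ sg) = inj₂ sg

-- Every second element, never the last one: selected elements of a sorted list are pairwise
-- non-consecutive and have a successor inside any interval containing the list.
evens : List ℕ → List ℕ
evens (x ∷ y ∷ xs) = x ∷ evens xs
evens _ = []

evens-length : ∀ k U → k + k ≤ length U → k ≤ length (evens U)
evens-length zero U le = z≤n
evens-length (suc k) (x ∷ []) (s≤s le) with ≤-trans (≤-reflexive (sym (ℕ.+-suc k k))) le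
... | ()
evens-length (suc k) (x ∷ y ∷ U) (s≤s le) = s≤s (evens-length k U (≤-pred (≤-trans (≤-reflexive (sym (ℕ.+-suc k k))) le)))

evens-all : ∀ {P : ℕ → Set} U → All P U → All P (evens U)
evens-all [] ps = []
evens-all (x ∷ []) ps = []
evens-all (x ∷ y ∷ U) (px ∷ _ ∷ ps) = px ∷ evens-all U ps

evens-spaced : ∀ U → AllPairs _<_ U → AllPairs (λ x y → suc x < y) (evens U)
evens-spaced [] ps = []
evens-spaced (x ∷ []) ps = []
evens-spaced (x ∷ y ∷ U) ((x<y ∷ _) ∷ y< ∷ ps) = evens-all U (All.map (λ lt → ≤-trans (s≤s x<y) lt) y<) ∷ evens-spaced U ps

evens-below : ∀ {b} U → AllPairs _<_ U → All (_< b) U → All (λ u → suc u < b) (evens U)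
evens-below [] _ _ = []
evens-below (x ∷ []) _ _ = []
evens-below (x ∷ y ∷ U) ((x<y ∷ _) ∷ _ ∷ ps) (_ ∷ y<b ∷ bs) = ≤-<-trans x<y y<b ∷ evens-below U ps bs

-- Attachments to a shortest path

module OnPath {n : ℕ} (G : Graph n) (S : Subset n) (r : Fin n) (rS : r inS S) (P : Pruned G S r) (s : Fin n) (sS : s inS S) where

  open Pruned P
  open InPruned G S r P
  open BFS G M r (M-S rS) connected

  D : ℕ
  D = d s

  pt : ℕ → Fin n
  pt = p s

  pt-M : ∀ {k} → k ≤ D → M (pt k) ≡ true
  pt-M le = proj₁ (p-level (M-S sS) _ le)

  pt-d : ∀ {k} → k ≤ D → d (pt k) ≡ k
  pt-d le = proj₂ (p-level (M-S sS) _ le)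

  pt-adj : ∀ {k k'} → k ≤ D → k' ≤ D → Adj G (pt k) (pt k') ⇔ Consecutive k k'
  pt-adj le le' = p-consecutive (M-S sS) _ _ le le'

  pt-start : pt 0 ≡ r
  pt-start = p-start (M-S sS)

  d-r : d r ≡ 0
  d-r = trans (cong d (sym pt-start)) (pt-d z≤n)

  flag : ℕ → Set
  flag k = pt k inS S

  flag? : ∀ k → Dec (flag k)
  flag? k = Vec.lookup S (pt k) ≟ᵇ true

  open Marks flag flag?

  module Window (a K : ℕ) (bound : a + K ≤ D) where

    at : Fin (suc K) → Fin n
    at k = pt (a + toℕ k)

    at≤ : ∀ (k : Fin (suc K)) → a + toℕ k ≤ D
    at≤ k = ≤-trans (ℕ.+-monoʳ-≤ a (≤-pred (toℕ<n k))) bound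

    at-path : IsPathSeq G at
    at-path = (λ i j e → toℕ-injective (ℕ.+-cancelˡ-≡ a _ _ (p-injective (M-S sS) _ _ (at≤ i) (at≤ j) e))) ,
      λ i j → mk⇔ (λ h → fwd i j (to (pt-adj (at≤ i) (at≤ j)) h)) (λ h → from (pt-adj (at≤ i) (at≤ j)) (bwd i j h))
      where
        down : ∀ i j → suc (a + i) ≡ a + j → suc i ≡ j
        down i j e = ℕ.+-cancelˡ-≡ a _ _ (trans (ℕ.+-suc a i) e)
        up : ∀ i j → suc i ≡ j → suc (a + i) ≡ a + j
        up i j e = trans (sym (ℕ.+-suc a i)) (cong (a +_) e)
        fwd : ∀ (i j : Fin (suc K)) → Consecutive (a + toℕ i) (a + toℕ j) → Consecutive (toℕ i) (toℕ j)
        fwd i j (inj₁ e) = inj₁ (down _ _ e)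
        fwd i j (inj₂ e) = inj₂ (down _ _ e)
        bwd : ∀ (i j : Fin (suc K)) → Consecutive (toℕ i) (toℕ j) → Consecutive (a + toℕ i) (a + toℕ j)
        bwd i j (inj₁ e) = inj₁ (up _ _ e)
        bwd i j (inj₂ e) = inj₂ (up _ _ e)

  run-connectifier : ∀ {e η} → e ≤ D → Run 0 e η → ConnectifierIn G S η
  run-connectifier {e} {η} e≤D run = PathConnectifier.connectifier G S at at-path pos (run-pos run)
      (λ x y lt → subst₂ _<_ (sym (pos-val x)) (sym (pos-val y)) (position-mono run x y lt))
      (λ x h → trans (pos-val x) (position-first run x h))
      (λ x h → cong suc (trans (pos-val x) (position-last run x h)))
      (λ k → mk⇔ (λ h → let (i , e') = position-covers run (toℕ k) z≤n (≤-pred (toℕ<n k)) h in i , toℕ-injective (trans (pos-val i) e'))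
                 (λ { (i , refl) → subst flag (sym (pos-val i)) (position-flag run i) }))
    where
      open Window 0 e e≤D
      pos : Fin η → Fin (suc e)
      pos x = fromℕ< (s≤s (position-≤ run x))
      pos-val : ∀ x → toℕ (pos x) ≡ position run x
      pos-val x = toℕ-fromℕ< (s≤s (position-≤ run x))

  IsFork : ℕ → Fin n → Set
  IsFork u z = M z ≡ true × Adj G (pt u) z × d z ≡ suc u × z ≢ pt (suc u)

  isFork? : ∀ u z → Dec (IsFork u z)
  isFork? u z = (M z ≟ᵇ true) ×-dec ((adj G (pt u) z ≟ᵇ true) ×-dec ((d z ℕ.≟ suc u) ×-dec ¬? (z ≟ᶠ pt (suc u))))

  abstract
    -- One fork vertex is fixed per position, so that the kind of a fork is a Boolean function of
    -- the position; `r` is a placeholder where there is no fork.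
    y : ℕ → Fin n
    y u with any? (isFork? u)
    ... | yes (z , _) = z
    ... | no _ = r

    y-fork : ∀ {u} → Fork s u → IsFork u (y u)
    y-fork {u} (_ , z , h) with any? (isFork? u)
    ... | yes (_ , h') = h'
    ... | no none = ⊥-elim (none (z , h))

  -- At a fork, `triangle` being false covers both the skipping forks and those attached to `pt u`
  -- alone; in each of these cases the leg meets a single core vertex.
  skipping triangle : ℕ → Bool
  skipping u = adj G (y u) (pt (suc (suc u)))
  triangle u = adj G (y u) (pt (suc u)) ∧ not (skipping u)

  module Gadgets {a b : ℕ} (b≤D : b ≤ D) (gap : Gap a b) (I : List ℕ) (spaced : AllPairs (λ u u' → suc u < u') I)
    (inside : All (λ u → a < u × suc u < b × Fork s u) I) where

    t : ℕ
    t = length I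

    i : Fin t → ℕ
    i = lookup I

    yy : Fin t → Fin n
    yy j = y (i j)

    i>a : ∀ j → a < i j
    i>a j = proj₁ (all-lookup inside j)

    i+1<b : ∀ j → suc (i j) < b
    i+1<b j = proj₁ (proj₂ (all-lookup inside j))

    i+2≤D : ∀ j → suc (suc (i j)) ≤ D
    i+2≤D j = ≤-trans (i+1<b j) b≤D

    i+1≤D : ∀ j → suc (i j) ≤ D
    i+1≤D j = ≤-trans (n≤1+n _) (i+2≤D j)

    i≤D : ∀ j → i j ≤ D
    i≤D j = ≤-trans (n≤1+n _) (i+1≤D j)

    fork : ∀ j → IsFork (i j) (yy j)
    fork j = y-fork (proj₂ (proj₂ (all-lookup inside j)))

    yy-M : ∀ j → M (yy j) ≡ true
    yy-M j = proj₁ (fork j)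

    yy-adj : ∀ j → Adj G (pt (i j)) (yy j)
    yy-adj j = proj₁ (proj₂ (fork j))

    yy-d : ∀ j → d (yy j) ≡ suc (i j)
    yy-d j = proj₁ (proj₂ (proj₂ (fork j)))

    i-apart : ∀ j j' → j ≢ j' → suc (i j) < i j' ⊎ suc (i j') < i j
    i-apart j j' ne with <-cmp (toℕ j) (toℕ j')
    ... | tri< lt _ _ = inj₁ (allpairs-lookup spaced j j' lt)
    ... | tri≈ _ eq _ = ⊥-elim (ne (toℕ-injective eq))
    ... | tri> _ _ gt = inj₂ (allpairs-lookup spaced j' j gt)

    i≢suc : ∀ j j' → i j' ≢ suc (i j)
    i≢suc j j' e with j ≟ᶠ j'
    ... | yes refl = 1+n≢n (sym e)
    ... | no ne with i-apart j j' ne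
    ... | inj₁ lt = <⇒≢ lt (sym e)
    ... | inj₂ lt = <⇒≱ (ℕ.<-trans (ℕ.n<1+n _) (subst (λ z → suc z < i j) e lt)) (n≤1+n _)

    i-injective : ∀ j j' → i j ≡ i j' → j ≡ j'
    i-injective j j' e with j ≟ᶠ j'
    ... | yes refl = refl
    ... | no ne with i-apart j j' ne
    ... | inj₁ lt = ⊥-elim (<⇒≢ (ℕ.<-trans (ℕ.n<1+n _) lt) e)
    ... | inj₂ lt = ⊥-elim (<⇒≢ (ℕ.<-trans (ℕ.n<1+n _) lt) (sym e))

    -- By its level, `yy j` could only equal the next path vertex, and the definition of a fork
    -- rules that out.
    yy≢pt : ∀ j {k} → k ≤ D → yy j ≢ pt k
    yy≢pt j {k} le e = proj₂ (proj₂ (proj₂ (fork j))) (trans e (cong pt (trans (sym (pt-d le)) (trans (cong d (sym e)) (yy-d j)))))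

    yy-near : ∀ j {k} → k ≤ D → Adj G (yy j) (pt k) → k ≡ i j ⊎ k ≡ suc (i j) ⊎ k ≡ suc (suc (i j))
    yy-near j {k} le h = near (≤-pred (subst₂ (λ x z → z ≤ suc x) (pt-d le) (yy-d j) (d-adj (pt-M le) (yy-M j) (Adj-sym G h))))
                              (subst₂ (λ x z → z ≤ suc x) (yy-d j) (pt-d le) (d-adj (yy-M j) (pt-M le) h))
      where
        near : ∀ {m k} → m ≤ k → k ≤ suc (suc m) → k ≡ m ⊎ k ≡ suc m ⊎ k ≡ suc (suc m)
        near {m} {k} lo hi with m ℕ.≟ k | suc m ℕ.≟ k
        ... | yes e | _ = inj₁ (sym e)
        ... | no _ | yes e = inj₂ (inj₁ (sym e))
        ... | no ne | no ne' = inj₂ (inj₂ (≤-antisym hi (≤∧≢⇒< (≤∧≢⇒< lo ne) ne')))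

    -- The spacing of the positions puts the two vertices on levels that differ by at least two.
    yy-not-adj : ∀ j j' → j ≢ j' → ¬ Adj G (yy j) (yy j')
    yy-not-adj j j' ne h with i-apart j j' ne
    ... | inj₁ lt = <⇒≱ (s≤s lt) (subst₂ (λ x z → z ≤ suc x) (yy-d j) (yy-d j') (d-adj (yy-M j) (yy-M j') h))
    ... | inj₂ lt = <⇒≱ (s≤s lt) (subst₂ (λ x z → z ≤ suc x) (yy-d j') (yy-d j) (d-adj (yy-M j') (yy-M j) (Adj-sym G h)))

    -- A vertex that does not disconnect the path and the forks: if yy j is a detour around the next
    -- path vertex, then that path vertex, and otherwise yy j. Hence its pendant is private.
    anchorᵇ : Bool → Fin t → Fin n
    anchorᵇ true j = pt (suc (i j))
    anchorᵇ false j = yy j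

    anchor : Fin t → Fin n
    anchor j = anchorᵇ (skipping (i j)) j

    anchor-case : ∀ j → (skipping (i j) ≡ true × anchor j ≡ pt (suc (i j))) ⊎ (skipping (i j) ≡ false × anchor j ≡ yy j)
    anchor-case j with skipping (i j)
    ... | true = inj₁ (refl , refl)
    ... | false = inj₂ (refl , refl)

    anchor-M : ∀ j → M (anchor j) ≡ true
    anchor-M j with anchor-case j
    ... | inj₁ (_ , e) = trans (cong M e) (pt-M (i+1≤D j))
    ... | inj₂ (_ , e) = trans (cong M e) (yy-M j)

    anchor-d : ∀ j → d (anchor j) ≡ suc (i j)
    anchor-d j with anchor-case j
    ... | inj₁ (_ , e) = trans (cong d e) (pt-d (i+1≤D j))
    ... | inj₂ (_ , e) = trans (cong d e) (yy-d j)

    r≢anchor : ∀ j → r ≢ anchor j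
    r≢anchor j e with trans (sym d-r) (trans (cong d e) (anchor-d j))
    ... | ()

    anchor-injective : ∀ j j' → anchor j ≡ anchor j' → j ≡ j'
    anchor-injective j j' e = i-injective j j' (ℕ.suc-injective (trans (sym (anchor-d j)) (trans (cong d e) (anchor-d j'))))

    pt-anchor : ∀ j {k} → k ≤ D → pt k ≡ anchor j → k ≡ suc (i j)
    pt-anchor j le e = trans (sym (pt-d le)) (trans (cong d e) (anchor-d j))

    -- Following the path from the root, only the anchor itself can block the way. In that case
    -- `yy j` is adjacent to the path vertices before and after the anchor and gives a detour. The
    -- detour goes back two positions, so the recursion runs on a separate bound `N`.
    side-pt′ : ∀ j N k → k ≤ N → k ≤ D → pt k ≢ anchor j → Side (anchor j) r (pt k) ≡ true
    side-pt′ j N zero _ _ _ = subst (λ z → Side (anchor j) r z ≡ true) (sym pt-start) (side-base (anchor j) r)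
    side-pt′ j (suc N) (suc k) (s≤s k≤N) k<D ne with pt k ≟ᶠ anchor j
    ... | no ne' = side-closed (anchor j) r (side-pt′ j N k k≤N (<⇒≤ k<D) ne') (pt-M k<D) ne (from (pt-adj (<⇒≤ k<D) k<D) (inj₁ refl))
    ... | yes e with pt-anchor j (<⇒≤ k<D) e | anchor-case j
    ... | refl | inj₂ (_ , e') = ⊥-elim (yy≢pt j (i+1≤D j) (sym (trans e e')))
    -- The detour: from `pt (i j)` to `yy j`, and by `sk` on to the path vertex behind the anchor.
    ... | refl | inj₁ (sk , e') = side-closed (anchor j) r
          (side-closed (anchor j) r (side-pt′ j N (i j) (≤-trans (n≤1+n _) k≤N) (i≤D j) (λ e'' → 1+n≢n (sym (pt-anchor j (i≤D j) e''))))
            (yy-M j) (λ e'' → yy≢pt j (i+1≤D j) (trans e'' e')) (yy-adj j))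
          (pt-M k<D) ne sk

    side-pt : ∀ j {k} → k ≤ D → pt k ≢ anchor j → Side (anchor j) r (pt k) ≡ true
    side-pt j {k} = side-pt′ j k k ≤-refl

    -- The path neighbour `pt (i j')` of `yy j'` is not an anchor, because the spacing keeps `i j'`
    -- different from `suc (i j)`.
    side-yy : ∀ j j' → yy j' ≢ anchor j → Side (anchor j) r (yy j') ≡ true
    side-yy j j' ne = side-closed (anchor j) r (side-pt j (i≤D j') (λ e → i≢suc j j' (pt-anchor j (i≤D j') e))) (yy-M j') ne (yy-adj j')

    side-anchor : ∀ j j' → j ≢ j' → Side (anchor j) r (anchor j') ≡ true
    side-anchor j j' ne with anchor-case j'
    ... | inj₁ (_ , e) = subst (λ z → Side (anchor j) r z ≡ true) (sym e)
          (side-pt j (i+1≤D j') (λ e' → ne (anchor-injective j j' (trans (sym e') (sym e)))))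
    ... | inj₂ (_ , e) = subst (λ z → Side (anchor j) r z ≡ true) (sym e)
          (side-yy j j' (λ e' → ne (anchor-injective j j' (trans (sym e') (sym e)))))

    abstract
      pend : ∀ j → Pendant (anchor j) r
      pend j = pendant (anchor j) r (anchor-M j) (M-S rS) (r≢anchor j)

    -- A leg cut out of the pendant of anchor j, whose neighbours on the path are given by att.
    record Hangs (j : Fin t) (pendant-j : Pendant (anchor j) r) (att : ℕ → Set) : Set where
      field
        ℓ      : ℕ
        q      : Fin (suc ℓ) → Fin n
        q-path : IsPathSeq G q
        q-S    : ∀ x → q x inS S ⇔ (toℕ x ≡ ℓ)
        emb    : Fin (suc ℓ) → Fin (suc (Pendant.k pendant-j))
        q-emb  : ∀ x → q x ≡ Pendant.q pendant-j (emb x)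
        start  : ∀ x → toℕ (emb x) ≡ 0 → q x ≡ yy j
        q≢pt   : ∀ x {k} → k ≤ D → pt k ≢ q x
        pt-q   : ∀ x {k} → k ≤ D → Adj G (pt k) (q x) ⇔ (toℕ x ≡ 0 × att k)

    module _ {att att'} {j j'} (ne : j ≢ j') (A : Hangs j (pend j) att) (B : Hangs j' (pend j') att') where
      private
        module A = Hangs A
        module B = Hangs B

      hangs-apart : ∀ x x' → A.q x ≢ B.q x'
      hangs-apart x x' e = TwoPendants.apart (pend j) (pend j') (side-anchor j j' ne) (side-anchor j' j (ne ∘ sym)) (A.emb x) (B.emb x')
        (trans (sym (A.q-emb x)) (trans e (B.q-emb x')))

      -- An edge between two pendants joins their first vertices. A leg that contains the first
      -- vertex of its pendant starts at `yy j`, so the edge would join two fork vertices.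
      hangs-not-adj : ∀ x x' → ¬ Adj G (A.q x) (B.q x')
      hangs-not-adj x x' h = yy-not-adj j j' ne (subst₂ (Adj G) (A.start x x₀) (B.start x' x'₀) h)
        where
          h' : Adj G (Pendant.q (pend j) (A.emb x)) (Pendant.q (pend j') (B.emb x'))
          h' = subst₂ (Adj G) (A.q-emb x) (B.q-emb x') h
          x'₀ = TwoPendants.adj-start (pend j) (pend j') (side-anchor j j' ne) (side-anchor j' j (ne ∘ sym)) (A.emb x) (B.emb x') h'
          x₀ = TwoPendants.adj-start (pend j') (pend j) (side-anchor j' j (ne ∘ sym)) (side-anchor j j' ne) (B.emb x') (A.emb x) (Adj-sym G h')

    hangs-at-yy : ∀ j att → anchor j ≡ yy j → (∀ {k} → k ≤ D → Adj G (yy j) (pt k) ⇔ att k) → Hangs j (pend j) att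
    hangs-at-yy j att e nb = record
      { ℓ = A.k ; q = A.q ; q-path = A.q-path ; q-S = A.q-S ; emb = id ; q-emb = λ _ → refl ; start = start
      ; q≢pt = λ x le e' → A.q-avoid x (side le) (sym e')
      ; pt-q = λ x le → mk⇔ (λ h → let x₀ = A.q-side x (side le) (Adj-sym G h) in x₀ , to (nb le) (subst (λ z → Adj G z _) (start x x₀) (Adj-sym G h)))
                            (λ (x₀ , h) → Adj-sym G (subst (λ z → Adj G z _) (sym (start x x₀)) (from (nb le) h))) }
      where
        module A = Pendant (pend j)
        start : ∀ x → toℕ x ≡ 0 → A.q x ≡ yy j
        start fzero _ = trans A.q-start e
        side : ∀ {k} → k ≤ D → Side (anchor j) r (pt k) ≡ true
        side le = side-pt j le (λ e' → yy≢pt j le (sym (trans e' e)))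

    -- The anchor belongs to the core, so the leg is its pendant without the first vertex. The rest
    -- is not empty: the anchor lies strictly between two consecutive vertices of `S`, hence outside
    -- `S`, and its pendant has to go on.
    hangs-at-next : ∀ j → anchor j ≡ pt (suc (i j)) → Hangs j (pend j) (_≡ suc (i j))
    hangs-at-next j e = tail (pend j)
      where
        not-S : ¬ flag (suc (i j))
        not-S = gap (suc (i j)) (ℕ.<-trans (i>a j) (ℕ.n<1+n _)) (i+1<b j)
        tail : ∀ A → Hangs j A (_≡ suc (i j))
        tail record { k = zero ; q-start = q-start ; q-S = q-S } = ⊥-elim (not-S (subst (_inS S) (trans q-start e) (from (q-S fzero) refl)))
        tail A@(record { k = suc k ; q = q ; q-path = q-path ; q-start = q-start ; q-S = q-S }) = record
          { ℓ = k ; q = q ∘ fsuc ; q-path = (λ x x' e' → suc-injective (proj₁ q-path _ _ e')) , (λ x x' → mk⇔ (λ h → from Consecutive-suc (to (proj₂ q-path _ _) h)) (λ h → from (proj₂ q-path _ _) (to Consecutive-suc h)))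
          ; q-S = λ x → mk⇔ (λ h → ℕ.suc-injective (to (q-S (fsuc x)) h)) (λ e' → from (q-S (fsuc x)) (cong suc e'))
          ; emb = fsuc ; q-emb = λ _ → refl ; start = λ _ () ; q≢pt = away ; pt-q = λ x le → mk⇔ (fwd x le) (bwd x le) }
          where
            away : ∀ x {k} → k ≤ D → pt k ≢ q (fsuc x)
            away x {k} le e' with pt k ≟ᶠ anchor j
            ... | no ne = Pendant.q-avoid A (fsuc x) (side-pt j le ne) (sym e')
            ... | yes e'' with proj₁ q-path fzero (fsuc x) (trans q-start (trans (sym e'') e'))
            ... | ()
            fwd : ∀ x {k} → k ≤ D → Adj G (pt k) (q (fsuc x)) → toℕ x ≡ 0 × k ≡ suc (i j)
            fwd x {k} le h with pt k ≟ᶠ anchor j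
            ... | yes e'' = first (to (proj₂ q-path fzero (fsuc x)) (subst (λ z → Adj G z (q (fsuc x))) (trans e'' (sym q-start)) h)) , pt-anchor j le e''
              where
                first : Consecutive 0 (suc (toℕ x)) → toℕ x ≡ 0
                first (inj₁ e') = sym (ℕ.suc-injective e')
                first (inj₂ ())
            ... | no ne with Pendant.q-side A (fsuc x) (side-pt j le ne) (Adj-sym G h)
            ... | ()
            bwd : ∀ x {k} → k ≤ D → toℕ x ≡ 0 × k ≡ suc (i j) → Adj G (pt k) (q (fsuc x))
            bwd x le (x₀ , refl) = subst (λ z → Adj G z (q (fsuc x))) (trans q-start e) (from (proj₂ q-path fzero (fsuc x)) (inj₁ (cong suc (sym x₀))))

    module Cut (a<b : a < b) (flag-a : flag a) (flag-b : flag b) where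

      K : ℕ
      K = b ∸ a

      a+K : a + K ≡ b
      a+K = ℕ.m+[n∸m]≡n (<⇒≤ a<b)

      open Window a K (≤-trans (≤-reflexive a+K) b≤D)

      at-S : ∀ k → at k inS S ⇔ (toℕ k ≡ 0 ⊎ toℕ k ≡ K)
      at-S k = mk⇔ fwd bwd
        where
          fwd : at k inS S → toℕ k ≡ 0 ⊎ toℕ k ≡ K
          fwd h with toℕ k ℕ.≟ 0 | toℕ k ℕ.≟ K
          ... | yes e | _ = inj₁ e
          ... | no _ | yes e = inj₂ e
          ... | no ne | no ne' = ⊥-elim (gap (a + toℕ k) (ℕ.m<m+n a (ℕ.n≢0⇒n>0 ne))
                (≤-trans (ℕ.+-monoʳ-< a (≤∧≢⇒< (≤-pred (toℕ<n k)) ne')) (≤-reflexive a+K)) h)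
          bwd : toℕ k ≡ 0 ⊎ toℕ k ≡ K → at k inS S
          bwd (inj₁ e) = subst flag (sym (trans (cong (a +_) e) (ℕ.+-identityʳ a))) flag-a
          bwd (inj₂ e) = subst flag (sym (trans (cong (a +_) e) a+K)) flag-b

      index : ∀ c → a < c → c < b → Σ[ k ∈ Fin (suc K) ] (a + toℕ k ≡ c)
      index c lo hi = fromℕ< lt , trans (cong (a +_) (toℕ-fromℕ< lt)) (ℕ.m+[n∸m]≡n (<⇒≤ lo))
        where
          lt : c ∸ a < suc K
          lt = s≤s (ℕ.∸-monoˡ-≤ a (<⇒≤ hi))

      -- A skipping fork yields a leg at `suc (i j)`, and any other fork here yields one at `i j`.
      -- Selected positions differ by at least two, so the attachment points `m j` increase strictly
      -- whichever of the two occurs.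
      caterpillar-case : 0 < t → All (λ u → triangle u ≡ false) I → ConnectifierIn G S (suc (suc t))
      caterpillar-case t-pos kinds = CaterpillarConnectifier.connectifier G S K t ℓ c c-mono c-pos c-top t-pos comb at-S (λ j → Hangs.q-S (H j))
        where
          leg : ∀ j → Σ[ m ∈ ℕ ] ((m ≡ i j ⊎ m ≡ suc (i j)) × Hangs j (pend j) (_≡ m))
          leg j with anchor-case j
          ... | inj₁ (_ , e) = suc (i j) , inj₂ refl , hangs-at-next j e
          ... | inj₂ (sk , e) = i j , inj₁ refl , hangs-at-yy j (_≡ i j) e (λ le → mk⇔ (λ h → fwd le h (yy-near j le h)) (λ { refl → Adj-sym G (yy-adj j) }))
            where
              fwd : ∀ {k} → k ≤ D → Adj G (yy j) (pt k) → k ≡ i j ⊎ k ≡ suc (i j) ⊎ k ≡ suc (suc (i j)) → k ≡ i j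
              fwd le h (inj₁ e') = e'
              fwd le h (inj₂ (inj₁ refl)) = ⊥-elim (true≢false (∧-true h (cong not sk)) (all-lookup kinds j))
              fwd le h (inj₂ (inj₂ refl)) = ⊥-elim (true≢false h sk)
          m : Fin t → ℕ
          m j = proj₁ (leg j)
          H : ∀ j → Hangs j (pend j) (_≡ m j)
          H j = proj₂ (proj₂ (leg j))
          m-low : ∀ j → i j ≤ m j
          m-low j with proj₁ (proj₂ (leg j))
          ... | inj₁ e = ≤-reflexive (sym e)
          ... | inj₂ e = ≤-trans (n≤1+n _) (≤-reflexive (sym e))
          m-high : ∀ j → m j ≤ suc (i j)
          m-high j with proj₁ (proj₂ (leg j))
          ... | inj₁ e = ≤-trans (≤-reflexive e) (n≤1+n _)
          ... | inj₂ e = ≤-reflexive e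
          ℓ : Fin t → ℕ
          ℓ j = Hangs.ℓ (H j)
          ix : ∀ j → Σ[ k ∈ Fin (suc K) ] (a + toℕ k ≡ m j)
          ix j = index (m j) (<-≤-trans (i>a j) (m-low j)) (≤-<-trans (m-high j) (i+1<b j))
          c : Fin t → Fin (suc K)
          c j = proj₁ (ix j)
          c-mono : ∀ j j' → toℕ j < toℕ j' → toℕ (c j) < toℕ (c j')
          c-mono j j' lt = ℕ.+-cancelˡ-< a _ _ (subst₂ _<_ (sym (proj₂ (ix j))) (sym (proj₂ (ix j')))
            (≤-<-trans (m-high j) (<-≤-trans (allpairs-lookup spaced j j' lt) (m-low j'))))
          c-pos : ∀ j → 0 < toℕ (c j)
          c-pos j = ℕ.+-cancelˡ-< a _ _ (subst₂ _<_ (sym (ℕ.+-identityʳ a)) (sym (proj₂ (ix j))) (<-≤-trans (i>a j) (m-low j)))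
          c-top : ∀ j → toℕ (c j) < K
          c-top j = ℕ.+-cancelˡ-< a _ _ (subst₂ _<_ (sym (proj₂ (ix j))) (sym a+K) (≤-<-trans (m-high j) (i+1<b j)))
          comb : InducedComb G K t ℓ c
          comb = record
            { p = at ; q = λ j → Hangs.q (H j) ; p-path = at-path ; q-path = λ j → Hangs.q-path (H j)
            ; p≢q = λ k j x → Hangs.q≢pt (H j) x (at≤ k)
            ; p-q = λ k j x → mk⇔
                (λ h → let (x₀ , e) = to (Hangs.pt-q (H j) x (at≤ k)) h in x₀ , toℕ-injective (ℕ.+-cancelˡ-≡ a _ _ (trans (proj₂ (ix j)) (sym e))))
                (λ (x₀ , e) → from (Hangs.pt-q (H j) x (at≤ k)) (x₀ , trans (cong (λ z → a + toℕ z) (sym e)) (proj₂ (ix j))))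
            ; q≢q = λ j j' x x' ne → hangs-apart ne (H j) (H j') x x'
            ; q-q = λ j j' x x' ne → hangs-not-adj ne (H j) (H j') x x' }

      -- Each `yy j` forms a triangle with `pt (i j)` and `pt (suc (i j))`. The three vertices are
      -- read as the tree edges at one branch vertex: two core edges and the first edge of the leg.
      line-caterpillar-case : 0 < t → All (λ u → triangle u ≡ true) I → ConnectifierIn G S (suc (suc t))
      line-caterpillar-case t-pos kinds = LineCaterpillarConnectifier.connectifier G S K t ℓ c c-mono c-pos c-top t-pos comb at-S (λ j → Hangs.q-S (H j))
        where
          Near : Fin t → ℕ → Set
          Near j k = k ≡ i j ⊎ k ≡ suc (i j)
          H : ∀ j → Hangs j (pend j) (Near j)
          H j with anchor-case j | ∧-true⁻ (adj G (yy j) (pt (suc (i j)))) (all-lookup kinds j)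
          ... | inj₁ (sk , _) | _ , nsk = ⊥-elim (true≢false nsk (cong not sk))
          ... | inj₂ (sk , e) | tr , _ = hangs-at-yy j (Near j) e (λ le → mk⇔ (λ h → fwd h (yy-near j le h)) bwd)
            where
              fwd : ∀ {k} → Adj G (yy j) (pt k) → k ≡ i j ⊎ k ≡ suc (i j) ⊎ k ≡ suc (suc (i j)) → Near j k
              fwd h (inj₁ e') = inj₁ e'
              fwd h (inj₂ (inj₁ e')) = inj₂ e'
              fwd h (inj₂ (inj₂ refl)) = ⊥-elim (true≢false h sk)
              bwd : ∀ {k} → Near j k → Adj G (yy j) (pt k)
              bwd (inj₁ refl) = Adj-sym G (yy-adj j)
              bwd (inj₂ refl) = tr
          ℓ : Fin t → ℕ
          ℓ j = Hangs.ℓ (H j)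
          i<b : ∀ j → i j < b
          i<b j = ℕ.<-trans (ℕ.n<1+n _) (i+1<b j)
          ix : ∀ j → Σ[ k ∈ Fin (suc K) ] (a + toℕ k ≡ i j)
          ix j = index (i j) (i>a j) (i<b j)
          -- The tree vertex at which the leg hangs is the lower end of the edge pt (i j).
          c : Fin t → Fin (suc (suc K))
          c j = fsuc (proj₁ (ix j))
          c-mono : ∀ j j' → toℕ j < toℕ j' → toℕ (c j) < toℕ (c j')
          c-mono j j' lt = s≤s (ℕ.+-cancelˡ-< a _ _ (subst₂ _<_ (sym (proj₂ (ix j))) (sym (proj₂ (ix j'))) (ℕ.<-trans (ℕ.n<1+n _) (allpairs-lookup spaced j j' lt))))
          c-pos : ∀ j → 0 < toℕ (c j)
          c-pos j = s≤s z≤n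
          c-top : ∀ j → toℕ (c j) < suc K
          c-top j = s≤s (ℕ.+-cancelˡ-< a _ _ (subst₂ _<_ (sym (proj₂ (ix j))) (sym a+K) (i<b j)))
          c-injective : ∀ j j' → c j ≡ c j' → j ≡ j'
          c-injective j j' e = i-injective j j' (trans (sym (proj₂ (ix j))) (trans (cong (λ z → a + toℕ z) (suc-injective e)) (proj₂ (ix j'))))
          near⇔ : ∀ j (k : Fin (suc K)) → Near j (a + toℕ k) ⇔ (c j ≡ inject₁ k ⊎ c j ≡ fsuc k)
          near⇔ j k = mk⇔ fwd bwd
            where
              e = proj₁ (ix j)
              fwd : Near j (a + toℕ k) → c j ≡ inject₁ k ⊎ c j ≡ fsuc k
              fwd (inj₁ h) = inj₂ (cong fsuc (toℕ-injective (ℕ.+-cancelˡ-≡ a _ _ (trans (proj₂ (ix j)) (sym h)))))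
              fwd (inj₂ h) = inj₁ (toℕ-injective (trans (ℕ.+-cancelˡ-≡ a _ _ (trans (ℕ.+-suc a (toℕ e)) (trans (cong suc (proj₂ (ix j))) (sym h)))) (sym (toℕ-inject₁ k))))
              bwd : c j ≡ inject₁ k ⊎ c j ≡ fsuc k → Near j (a + toℕ k)
              bwd (inj₂ h) = inj₁ (trans (cong (λ z → a + toℕ z) (sym (suc-injective h))) (proj₂ (ix j)))
              bwd (inj₁ h) = inj₂ (trans (cong (a +_) (sym (trans (cong toℕ h) (toℕ-inject₁ k)))) (trans (ℕ.+-suc a (toℕ e)) (cong suc (proj₂ (ix j)))))
          comb : InducedLineComb G (suc K) t ℓ c
          comb = record
            { p = at ; q = λ j → Hangs.q (H j) ; p-path = at-path ; q-path = λ j → Hangs.q-path (H j)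
            ; p≢q = λ k j x → Hangs.q≢pt (H j) x (at≤ k)
            ; p-q = λ k j x → mk⇔
                (λ h → let (x₀ , e) = to (Hangs.pt-q (H j) x (at≤ k)) h in x₀ , to (near⇔ j k) e)
                (λ (x₀ , e) → from (Hangs.pt-q (H j) x (at≤ k)) (x₀ , from (near⇔ j k) e))
            ; q≢q = λ j j' x x' ne → hangs-apart ne (H j) (H j') x x'
            ; q-q = λ j j' x x' ne → mk⇔ (λ h → ⊥-elim (hangs-not-adj ne (H j) (H j') x x' h)) (λ (_ , _ , e) → ⊥-elim (ne (c-injective j j' e))) }

  -- No position strictly between two consecutive flags is flagged, so usefulness there can only
  -- come from a fork.
  segment-forks : ∀ {g} (seg : Segment D (λ u → flag u ⊎ Fork s u) g) →
    All (λ u → Segment.a seg < u × suc u < Segment.b seg × Fork s u) (evens (Segment.U seg))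
  segment-forks seg = All.zipWith (λ {u} ((lo , hi , useful) , hi') → lo , hi' , unflagged u lo hi useful)
      (evens-all U inside , evens-below U sorted (All.map (λ (_ , hi , _) → hi) inside))
    where
      open Segment seg
      unflagged : ∀ u → a < u → u < b → flag u ⊎ Fork s u → Fork s u
      unflagged u lo hi (inj₁ h) = ⊥-elim (gap u lo hi h)
      unflagged u lo hi (inj₂ h) = h

  -- Of `4 t` positions, `evens` keeps at least `2 t` that are spaced apart, and one of the two
  -- values of `triangle` is taken by at least `t` of these. Cutting down to exactly `t` legs makes
  -- the count `t + 2` exact.
  segment-connectifier : ∀ t → 0 < t → Segment D (λ u → flag u ⊎ Fork s u) ((t + t) + (t + t)) → ConnectifierIn G S (suc (suc t))
  segment-connectifier t t-pos seg with t ≤? length (filter (λ u → triangle u ≟ᵇ true) (evens (Segment.U seg)))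
  ... | yes le = subst (λ z → ConnectifierIn G S (suc (suc z))) len
        (Gadgets.Cut.line-caterpillar-case b≤D gap I (AllPairsₚ.take⁺ t (AllPairsₚ.filter⁺ _ spaced)) (Allₚ.take⁺ t (Allₚ.filter⁺ _ forks)) a<b flag-a flag-b
          (subst (0 <_) (sym len) t-pos) (Allₚ.take⁺ t (Allₚ.all-filter (λ u → triangle u ≟ᵇ true) E)))
    where
      open Segment seg
      E = evens U
      I = take t (filter (λ u → triangle u ≟ᵇ true) E)
      len : length I ≡ t
      len = trans (length-take t _) (ℕ.m≤n⇒m⊓n≡m le)
      spaced = evens-spaced U sorted
      forks = segment-forks seg
  ... | no nle = subst (λ z → ConnectifierIn G S (suc (suc z))) len
        (Gadgets.Cut.caterpillar-case b≤D gap I (AllPairsₚ.take⁺ t (AllPairsₚ.filter⁺ _ spaced)) (Allₚ.take⁺ t (Allₚ.filter⁺ _ forks)) a<b flag-a flag-b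
          (subst (0 <_) (sym len) t-pos) (Allₚ.take⁺ t (Allₚ.all-filter (λ u → triangle u ≟ᵇ false) E)))
    where
      open Segment seg
      E = evens U
      I = take t (filter (λ u → triangle u ≟ᵇ false) E)
      le : t ≤ length (filter (λ u → triangle u ≟ᵇ false) E)
      le = ℕ.+-cancelˡ-≤ t _ _ (≤-trans (evens-length (t + t) U long) (≤-trans (≤-reflexive (length-filter-split triangle E)) (ℕ.+-monoˡ-≤ _ (<⇒≤ (≰⇒> nle)))))
      len : length I ≡ t
      len = trans (length-take t _) (ℕ.m≤n⇒m⊓n≡m le)
      spaced = evens-spaced U sorted
      forks = segment-forks seg

-- Constants and assembly

common-bound : ∀ {A : Set} (f : A → ℕ) (xs : List A) → Σ[ N ∈ ℕ ] All (λ x → f x ≤ N) xs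
common-bound f [] = 0 , []
common-bound f (x ∷ xs) with common-bound f xs
... | N , all = f x + N , ℕ.m≤m+n (f x) N ∷ All.map (λ le → ≤-trans le (ℕ.m≤n+m N (f x))) all

-- The run of flags begins at position 0, the root, and counts useful positions after it. Dropping
-- the first entry makes the others positive; this is the outer `suc` in `path-length`.
sorted-tail : ∀ {Q : ℕ → Set} {m} U → length U ≡ suc m → AllPairs _<_ U → All Q U →
  Σ[ V ∈ List ℕ ] (length V ≡ m × AllPairs _<_ V × All (λ u → 0 < u × Q u) V)
sorted-tail (u ∷ V) len (lo ∷ inc) (_ ∷ all) = V , ℕ.suc-injective len , inc , All.zipWith (λ (lt , q) → ≤-<-trans z≤n lt , q) (lo , all)

Joined : ∀ {n} → Graph n → Subset n → Set
Joined G S = ∀ u v → u ∈ S → v ∈ S → Walk G u v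

inS⇒∈ : ∀ {n} (S : Subset n) {v} → v inS S → v ∈ S
inS⇒∈ S {v} h = lookup⇒[]= v S h

module Small {n : ℕ} (G : Graph n) (S : Subset n) (joined : Joined G S) (r : Fin n) (rS : r inS S) where

  abstract
    pruned : Pruned G S r
    pruned = prune G S r rS (λ s sS → joined r s (inS⇒∈ S rS) (inS⇒∈ S sS))

  single : ConnectifierIn G S 1
  single = run-connectifier z≤n (Marks.one (subst (_inS S) (sym pt-start) rS))
    where open OnPath G S r rS pruned r rS

  -- The path is cut at the first vertex of `S` after `r` on the way to `s`, so that it has exactly
  -- two vertices in `S`.
  pair : ∀ s → s inS S → r ≢ s → ConnectifierIn G S 2
  pair s sS r≢s = two (next D-pos (subst (_inS S) (sym (p-end s)) sS))
    where
      open Pruned pruned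
      open BFS G M r (M-S rS) connected
      open OnPath G S r rS pruned s sS
      open Marks flag flag?
      D-pos : 0 < D
      D-pos = ℕ.n≢0⇒n>0 (λ e → r≢s (sym (d-zero (M-S sS) e)))
      two : Σ[ b ∈ ℕ ] (0 < b × b ≤ D × flag b × Gap 0 b) → ConnectifierIn G S 2
      two (b , lt , le , hb , gap) = run-connectifier le (cons (subst (_inS S) (sym pt-start) rS) lt gap (one hb))

module Large (t : ℕ) (t-pos : 0 < t) where

  -- With the two ends of the spine, `t` legs give `η` vertices of `S`. A path with `η = t + 2`
  -- flags needs `suc t` passages from flag to flag, each paid by `suc gadgets` useful positions.
  -- The degree bound behind `threshold` is the Ramsey number above which a vertex is wide.
  η gadgets path-length μ : ℕ
  η = suc (suc t)
  gadgets = (t + t) + (t + t)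
  path-length = suc (suc t * suc gadgets)
  μ = threshold (R η η) path-length

  module _ {n : ℕ} (G : Graph n) (S : Subset n) (joined : Joined G S) (r : Fin n) (rS : r inS S) (Ls : List (Fin n))
    (unique : AllPairs _≢_ Ls) (in-S : All (_inS S) Ls) (many : μ ≤ length Ls) where

    open Small G S joined r rS using (pruned)
    open Pruned pruned
    open BFS G M r (M-S rS) connected

    along-path : ∀ s → s inS S → (U : List ℕ) → length U ≡ path-length → AllPairs _<_ U → All (λ u → 0 ≤ u × u ≤ d s × (p s u inS S ⊎ Fork s u)) U → ConnectifierIn G S η
    along-path s sS U len inc all = finish (sorted-tail U len inc all)
      where
        open OnPath G S r rS pruned s sS
        open Marks flag flag?
        Useful : ℕ → Set
        Useful u = flag u ⊎ Fork s u
        conclude : (Σ[ e ∈ ℕ ] e ≤ D × Run 0 e η) ⊎ Segment D Useful gadgets → ConnectifierIn G S η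
        conclude (inj₁ (e , e≤D , run)) = run-connectifier e≤D run
        conclude (inj₂ seg) = segment-connectifier t t-pos seg
        finish : Σ[ V ∈ List ℕ ] (length V ≡ suc t * suc gadgets × AllPairs _<_ V × All (λ u → 0 < u × 0 ≤ u × u ≤ d s × Useful u) V) → ConnectifierIn G S η
        finish (V , len , inc , all) = conclude (run-or-segment Useful gadgets (subst (_inS S) (sym (p-end s)) sS) (suc t) 0 V
          (subst (_inS S) (sym pt-start) rS) z≤n inc (All.map (λ (lo , _ , hi , q) → lo , hi , q) all) (≤-reflexive (sym len)))

    narrow : (∀ v → M v ≡ true → length (neighbours v) ≤ R η η) → ConnectifierIn G S η
    narrow bounded = finish (chain N path-length 0 r Ls below unique many)
      where
        open Chain S M-S (R η η) bounded
        N = proj₁ (common-bound d Ls)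
        below : All (Below N 0 r) Ls
        below = All.zipWith (λ (sS , le) → sS , z≤n , p-start (M-S sS) , le) (in-S , proj₂ (common-bound d Ls))
        finish : UsefulPath path-length 0 Ls → ConnectifierIn G S η
        finish (s , m , U , len , inc , all) = along-path s (All.lookup in-S m) U len inc all

    connectifier : ConnectifierIn G S η
    connectifier = decide (any? (λ v → (M v ≟ᵇ true) ×-dec (R η η ≤? length (neighbours v))))
      where
        decide : Dec (Σ[ v ∈ Fin n ] (M v ≡ true × R η η ≤ length (neighbours v))) → ConnectifierIn G S η
        decide (yes (v , v∈M , le)) = WideVertex.wide G S r pruned v v∈M η (s≤s (s≤s t-pos)) (neighbours v) le
          (AllPairsₚ.filter⁺ _ (allFin⁺ n)) (Allₚ.all-filter _ (allFin n))
        decide (no none) = narrow (λ v v∈M → <⇒≤ (≰⇒> (λ le → none (v , v∈M , le))))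

two-elements : ∀ {n} (S : Subset n) → 2 ≤ ∣ S ∣ → Σ[ r ∈ Fin n ] Σ[ s ∈ Fin n ] (r inS S × s inS S × r ≢ s)
two-elements S le with elements S | elements-⊆ S | elements-unique S | subst (2 ≤_) (sym (length-elements S)) le
... | r ∷ s ∷ _ | rS ∷ sS ∷ _ | (r≢s ∷ _) ∷ _ | _ = r , s , rS , sS , r≢s
... | _ ∷ [] | _ | _ | s≤s ()

-- One vertex of `S` becomes the root and the others are the targets of the search, which explains
-- the added `suc`.
large : ∀ t (t-pos : 0 < t) {n} (G : Graph n) (S : Subset n) → suc (Large.μ t t-pos) ≤ ∣ S ∣ → Joined G S → ConnectifierIn G S (suc (suc t))
large t t-pos {n} G S le joined = pick-root (elements S) (elements-⊆ S) (elements-unique S) (subst (suc (Large.μ t t-pos) ≤_) (sym (length-elements S)) le)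
  where
    pick-root : ∀ Ls → All (_inS S) Ls → AllPairs _≢_ Ls → suc (Large.μ t t-pos) ≤ length Ls → ConnectifierIn G S (suc (suc t))
    pick-root (r ∷ Ls) (rS ∷ in-S) (_ ∷ un) (s≤s le) = Large.connectifier t t-pos G S joined r rS Ls un in-S le

theorem5p2 : (η : ℕ) → 1 ≤ η →
    Σ[ μ ∈ ℕ ] (1 ≤ μ ×
    ((n : ℕ) (G : Graph n) (S : Subset n) → μ ≤ ∣ S ∣
    → (∀ u v → u ∈ S → v ∈ S → Walk G u v)
    → Σ[ m ∈ ℕ ] Σ[ H ∈ Graph m ] Σ[ f ∈ (Fin m → Fin n) ]
    (InducedEmbedding H G f
    × Connectifier H (pullback f S) η
    × Connected H
    × ∣ pullback f S ∣ ≡ η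
    × (∀ v → v ∈ pullback f S → deg H v ≤ η))))
theorem5p2 1 _ = 2 , s≤s z≤n , λ n G S le joined →
  let (r , s , rS , sS , r≢s) = two-elements S le in Small.single G S joined r rS
theorem5p2 2 _ = 2 , s≤s z≤n , λ n G S le joined →
  let (r , s , rS , sS , r≢s) = two-elements S le in Small.pair G S joined r rS s sS r≢s
theorem5p2 (suc (suc (suc t))) _ = suc (Large.μ (suc t) (s≤s z≤n)) , s≤s z≤n , λ n G S le joined →
  large (suc t) (s≤s z≤n) G S le joined
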